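{- Let $L$ be a fixed graph and let $\mathcal{H}$ be a finite family of finite (not necessarily connected) simple graphs. Then there is a one-sided error property tester that, for any $L$-minor-free graph $G$, makes a number of queries to the random neighbor oracle bounded by a function of $\varepsilon$, $L$ and $\mathcal{H}$ only, accepts if $G$ is $\mathcal{H}$-free, and rejects with probability at least $2/3$ if $G$ is $\varepsilon$-far from $\mathcal{H}$-free.
   Context: $G$ is $L$-minor-free if $L$ cannot be obtained from $G$ by vertex deletions, edge deletions and edge contractions. Random neighbor oracle: for $G=(V,E)$, $V=\{1,\dots,n\}$, a query on $v$ returns a uniformly random neighbor of $v$, independently. $G$ is $\mathcal{H}$-free if it contains no subgraph isomorphic to any member of $\mathcal{H}$; it is $\varepsilon$-far from $\mathcal{H}$-free if more than $\varepsilon|V|$ edges must be deleted to obtain an $\mathcal{H}$-free graph. One-sided error: $\mathcal{H}$-free inputs are always accepted. -}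

module Defs where

open import Data.Bool using (Bool; true; false; _∧_; if_then_else_)
open import Data.Nat as ℕ using (ℕ; zero; suc; _∸_; _<ᵇ_)
open import Data.Fin using (Fin; toℕ; punchIn)
open import Data.List using (List; []; _∷_; length; filterᵇ; allFin; cartesianProduct; map; foldr)
open import Data.Maybe using (Maybe; just; nothing)
open import Data.Product using (Σ; Σ-syntax; ∃; _×_; _,_; proj₁; proj₂)
open import Data.Sum using (_⊎_)
open import Data.Integer using (+_)
open import Data.Rational as ℚ using (ℚ; 0ℚ; 1ℚ; _/_; _<_)
open import Function.Definitions using (Injective)
open import Function.Bundles using (_⇔_)
open import Relation.Nullary using (¬_)
open import Relation.Binary.PropositionalEquality using (_≡_; _≢_)
open import Data.List.Membership.Propositional using (_∈_)

record Graph (n : ℕ) : Set where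
  field
    adj    : Fin n → Fin n → Bool
    sym    : ∀ i j → adj i j ≡ adj j i
    irrefl : ∀ i → adj i i ≡ false
open Graph public

AnyGraph : Set
AnyGraph = Σ ℕ Graph

edges : ∀ {n} → Graph n → ℕ
edges {n} G = length (filterᵇ (λ p → adj G (proj₁ p) (proj₂ p) ∧ (toℕ (proj₁ p) <ᵇ toℕ (proj₂ p)))
                               (cartesianProduct (allFin n) (allFin n)))

nbrs : ∀ {n} → Graph n → Fin n → List (Fin n)
nbrs {n} G v = filterᵇ (adj G v) (allFin n)

SpanningSub : ∀ {n} → Graph n → Graph n → Set
SpanningSub G' G = ∀ i j → adj G' i j ≡ true → adj G i j ≡ true

Contains : AnyGraph → ∀ {n} → Graph n → Set
Contains (k , H) {n} G =
  Σ (Fin k → Fin n) λ f → Injective _≡_ _≡_ f × (∀ a b → adj H a b ≡ true → adj G (f a) (f b) ≡ true)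

Free : List AnyGraph → ∀ {n} → Graph n → Set
Free ℋ G = ∀ H → H ∈ ℋ → ¬ Contains H G

Far : ℚ → List AnyGraph → ∀ {n} → Graph n → Set
Far ε ℋ {n} G = ∀ G' → SpanningSub G' G → Free ℋ G' →
  ε ℚ.* ((+ n) / 1) < ((+ (edges G ∸ edges G')) / 1)

Iso : ∀ {l n} → Graph l → Graph n → Set
Iso {l} {n} L G = Σ (Fin l → Fin n) λ f → Σ (Fin n → Fin l) λ g →
  (∀ x → g (f x) ≡ x) × (∀ y → f (g y) ≡ y) × (∀ a b → adj L a b ≡ adj G (f a) (f b))

VertexDel : ∀ {n} → Graph n → Graph (suc n) → Set
VertexDel G' G = Σ[ v ∈ Fin _ ] (∀ i j → adj G' i j ≡ adj G (punchIn v i) (punchIn v j))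

EdgeDel : ∀ {n} → Graph n → Graph n → Set
EdgeDel G' G = Σ[ u ∈ Fin _ ] Σ[ v ∈ Fin _ ]
  adj G u v ≡ true × adj G' u v ≡ false ×
  (∀ i j → ¬ ((i ≡ u × j ≡ v) ⊎ (i ≡ v × j ≡ u)) → adj G' i j ≡ adj G i j)

-- G' = G with the edge {punchIn v u', v} contracted: vertex v is merged
-- into u = punchIn v u'; loops and parallel edges are discarded.
-- The vertex i of G' corresponds to the set pre i of vertices of G.
Contraction : ∀ {n} → Graph n → Graph (suc n) → Set
Contraction {n} G' G = Σ[ v ∈ Fin (suc n) ] Σ[ u' ∈ Fin n ]
  adj G (punchIn v u') v ≡ true ×
  (∀ i j → (adj G' i j ≡ true) ⇔
      (i ≢ j × Σ[ a ∈ Fin (suc n) ] Σ[ b ∈ Fin (suc n) ] pre v u' i a × pre v u' j b × adj G a b ≡ true))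
  where
  pre : Fin (suc n) → Fin n → Fin n → Fin (suc n) → Set
  pre v u' i a = (a ≡ punchIn v i) ⊎ (a ≡ v × i ≡ u')

data Minor {l} (L : Graph l) : ∀ {n} → Graph n → Set where
  iso   : ∀ {n} {G : Graph n} → Iso L G → Minor L G
  vdel  : ∀ {n} {G : Graph (suc n)} {G' : Graph n} → VertexDel G' G → Minor L G' → Minor L G
  edel  : ∀ {n} {G G' : Graph n} → EdgeDel G' G → Minor L G' → Minor L G
  contr : ∀ {n} {G : Graph (suc n)} {G' : Graph n} → Contraction G' G → Minor L G' → Minor L G

MinorFree : ∀ {l} → Graph l → ∀ {n} → Graph n → Set
MinorFree L G = ¬ Minor L G

-- Randomised query algorithms in the random neighbour model on n vertices
-- (the algorithm knows n).  Internal nodes: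
--   sample  : a uniformly random vertex                 (counts as a query)
--   query v : a uniformly random neighbour of v, or
--             nothing if v is isolated                  (counts as a query)
--   flip    : a fair internal coin                      (free)
-- All random choices are independent.

data Tester (n : ℕ) : Set where
  accept reject : Tester n
  sample : (Fin n → Tester n) → Tester n
  query  : Fin n → (Maybe (Fin n) → Tester n) → Tester n
  flip   : (Bool → Tester n) → Tester n

data Queries≤ {n} : ℕ → Tester n → Set where
  accept : ∀ {q} → Queries≤ q accept
  reject : ∀ {q} → Queries≤ q reject
  sample : ∀ {q f} → (∀ x → Queries≤ q (f x)) → Queries≤ (suc q) (sample f)
  query  : ∀ {q v f} → (∀ x → Queries≤ q (f x)) → Queries≤ (suc q) (query v f)
  flip   : ∀ {q f} → (∀ x → Queries≤ q (f x)) → Queries≤ q (flip f)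

-- Uniform average of a list of rationals (0 for the empty list; unused).
avg : List ℚ → ℚ
avg [] = 0ℚ
avg (x ∷ xs) = foldr ℚ._+_ 0ℚ (x ∷ xs) ℚ.* ((+ 1) / length (x ∷ xs))

PrReject : ∀ {n} → Graph n → Tester n → ℚ
PrReject G accept = 0ℚ
PrReject G reject = 1ℚ
PrReject {n} G (sample f) = avg (map (λ x → PrReject G (f x)) (allFin n))
PrReject G (query v f) with nbrs G v
... | [] = PrReject G (f nothing)
... | x ∷ xs = avg (map (λ u → PrReject G (f (just u))) (x ∷ xs))
PrReject G (flip f) = avg (PrReject G (f false) ∷ PrReject G (f true) ∷ [])

{-# OPTIONS --safe #-}
module Submission where

-- The tester repeats a random exploration: in each step coin flips select a visited vertex to query, or a fresh vertex to
-- sample; it rejects once the edges seen contain a member of ℋ.  As the choices are random, the analysis may follow any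
-- strategy depending on G, at the cost of a constant factor per step.
--
-- If G is ε-far from ℋ-free, it contains linearly many edge-disjoint copies of some H in ℋ.  Passing to a constant fraction,
-- the roles (vertices of H) occur in the same degree order in all copies, and a vertex colouring of G separates the roles.
-- Eliminate the roles by increasing degree and consider the fill-in of H.  For a fill-in pair (j , u) with j before u,
-- minor-freeness bounds the sum of deg x over the distinct images (x , y) of (j , u) by O(n): this is a layer cake sum over
-- degree thresholds, using the edge density of topological minors.  So most copies lie on images (x , y) shared by at
-- least δ deg x of the copies; keep those.  Then x has at most 1/δ partners y, and a random neighbour of x leads with
-- constant probability to one of the shared copies, hence, through roles of lower rank, up to y.
--
-- A copy of H is then assembled from the highest role down.  The later fill-in neighbours of a role i are, besides the lowest
-- one p, later fill-in neighbours of p, so the image x of p leaves boundedly many choices for them, and most copies agree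
-- on these neighbours with at least δ deg x copies.  A random neighbour of x lies on one of those with constant
-- probability, and climbing from there reaches an image of i consistent with all roles placed before.  Finally each edge
-- of H is seen by one query, since its lower end has bounded degree.

open import Defs
open import Data.Bool using (Bool; true; false; T; T?; _∧_; if_then_else_)
open import Data.Bool.Properties using () renaming (_≟_ to _≟ᵇ_)
open import Data.Empty using (⊥; ⊥-elim)
open import Data.Fin as Fin using (Fin; zero; suc; toℕ; fromℕ<; punchIn; punchOut; combine; funToFin; finToFun)
import Data.Fin.Properties as FinP
open import Data.List using (List; []; _∷_; _++_; [_]; length; map; filter; concatMap; cartesianProduct; allFin; deduplicate; foldr; lookup)
open import Data.List.Properties as ListP using (length-map; length-++; length-filter; length-tabulate)
open import Data.List.Membership.Propositional using (_∈_; _∉_; find; lose)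
open import Data.List.Membership.Propositional.Properties
open import Data.List.Relation.Binary.Subset.Propositional using (_⊆_)
open import Data.List.Relation.Unary.All as All using (All; []; _∷_)
open import Data.List.Relation.Unary.AllPairs using (AllPairs; []; _∷_)
open import Data.List.Relation.Unary.Any as Any using (Any; here; there)
open import Data.List.Relation.Unary.Any.Properties using (lookup-index)
open import Data.List.Relation.Unary.Unique.Propositional using (Unique)
open import Data.List.Relation.Unary.Unique.Propositional.Properties using (filter⁺; allFin⁺; cartesianProduct⁺)
open import Data.Maybe as Maybe using (Maybe; just; nothing)
open import Data.Maybe.Properties using (just-injective)
open import Data.Nat as ℕ using (ℕ; zero; suc)
import Data.Nat.Properties as ℕ
open import Data.Product using (Σ; ∃; ∃₂; _×_; _,_; proj₁; proj₂)
open import Data.Product.Properties using (≡-dec)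
import Data.Rational as ℚ
import Data.Rational.Properties as ℚ
open import Data.Sum using (_⊎_; inj₁; inj₂; [_,_]′)
open import Data.Unit using (⊤; tt)
open import Function using (_∘_)
open import Relation.Binary using (DecidableEquality; tri<; tri≈; tri>)
open import Relation.Binary.PropositionalEquality as ≡ using (_≡_; _≢_; refl; trans; cong; cong₂; subst; subst₂)
open import Relation.Nullary using (¬_; Dec; yes; no; does)
open import Relation.Nullary.Decidable using (_×-dec_; _⊎-dec_; _→-dec_; ¬?; map′; decidable-stable; toWitness; ¬¬-excluded-middle)
open import Relation.Unary using (Decidable)

-- The obstacle is unbounded degree: a query at the image of a role hits the partner in one fixed
-- copy with no probability bounded from below. What can be hit is a bundle of copies that agree on
-- the image sought; entering the bundle suffices, since roles of lower rank lead back up to the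
-- common image. A pair `(j , u)` thus needs climbs along fill-in pairs that start below `j`, which
-- forces the treatment by increasing rank. The degree order serves the minor argument: if the image
-- of `j` exceeds a degree threshold, so does the image of `u`, and both ends are counted among the
-- vertices above that threshold. Bundles are taken in the family before thinning, while the
-- conclusion concerns the surviving copies as starting points only; hence further thinning never
-- destroys what has been achieved. Division is avoided throughout: a probability is recorded by a
-- natural number that bounds its reciprocal.

module Counting where

  open import Data.Nat
  open import Data.Nat.Properties
  open import Data.Nat.Tactic.RingSolver using (solve-∀)

  private variable
    A K : Set

  -- Finite sums, counting by keys and greedy selection.

  ∑ : List A → (A → ℕ) → ℕ
  ∑ [] w = 0
  ∑ (x ∷ xs) w = w x + ∑ xs w

  ∑-mono : ∀ (xs : List A) {f g : A → ℕ} → (∀ {x} → x ∈ xs → f x ≤ g x) → ∑ xs f ≤ ∑ xs g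
  ∑-mono [] h = z≤n
  ∑-mono (x ∷ xs) h = +-mono-≤ (h (here refl)) (∑-mono xs (h ∘ there))

  ∑-cong : ∀ (xs : List A) {f g : A → ℕ} → (∀ x → f x ≡ g x) → ∑ xs f ≡ ∑ xs g
  ∑-cong [] h = refl
  ∑-cong (x ∷ xs) h = cong₂ _+_ (h x) (∑-cong xs h)

  ∑-+ : ∀ (xs : List A) (f g : A → ℕ) → ∑ xs (λ x → f x + g x) ≡ ∑ xs f + ∑ xs g
  ∑-+ [] f g = refl
  ∑-+ (x ∷ xs) f g rewrite ∑-+ xs f g = lemma (f x) (g x) (∑ xs f) (∑ xs g)
    where lemma : ∀ a b c d → a + b + (c + d) ≡ a + c + (b + d)
          lemma = solve-∀

  ∑-* : ∀ (xs : List A) (c : ℕ) (f : A → ℕ) → ∑ xs (λ x → c * f x) ≡ c * ∑ xs f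
  ∑-* [] c f = ≡.sym (*-zeroʳ c)
  ∑-* (x ∷ xs) c f rewrite ∑-* xs c f = ≡.sym (*-distribˡ-+ c (f x) _)

  ∑-const : ∀ (xs : List A) (c : ℕ) → ∑ xs (λ _ → c) ≡ length xs * c
  ∑-const [] c = refl
  ∑-const (x ∷ xs) c = cong (c +_) (∑-const xs c)

  ∑-swap : ∀ {B : Set} (xs : List A) (ys : List B) (f : A → B → ℕ) →
    ∑ xs (λ x → ∑ ys (f x)) ≡ ∑ ys (λ y → ∑ xs (λ x → f x y))
  ∑-swap [] ys f = ≡.sym (trans (∑-const ys 0) (*-zeroʳ (length ys)))
  ∑-swap (x ∷ xs) ys f rewrite ∑-swap xs ys f = ≡.sym (∑-+ ys (f x) _)

  ∑-++ : ∀ (xs ys : List A) (f : A → ℕ) → ∑ (xs ++ ys) f ≡ ∑ xs f + ∑ ys f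
  ∑-++ [] ys f = refl
  ∑-++ (x ∷ xs) ys f rewrite ∑-++ xs ys f = ≡.sym (+-assoc (f x) _ _)

  ∑-map : ∀ {B : Set} (h : B → A) (xs : List B) (f : A → ℕ) → ∑ (map h xs) f ≡ ∑ xs (f ∘ h)
  ∑-map h [] f = refl
  ∑-map h (x ∷ xs) f = cong (f (h x) +_) (∑-map h xs f)

  ∑-concatMap : ∀ {B : Set} (h : B → List A) (xs : List B) (f : A → ℕ) →
    ∑ (concatMap h xs) f ≡ ∑ xs (λ x → ∑ (h x) f)
  ∑-concatMap h [] f = refl
  ∑-concatMap h (x ∷ xs) f =
    trans (∑-++ (h x) _ f) (cong (∑ (h x) f +_) (∑-concatMap h xs f))

  ∈⇒≤∑ : ∀ {xs : List A} {x} (f : A → ℕ) → x ∈ xs → f x ≤ ∑ xs f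
  ∈⇒≤∑ f (here refl) = m≤m+n _ _
  ∈⇒≤∑ f (there p) = ≤-trans (∈⇒≤∑ f p) (m≤n+m _ _)

  length≡∑ : ∀ (xs : List A) → length xs ≡ ∑ xs (λ _ → 1)
  length≡∑ [] = refl
  length≡∑ (x ∷ xs) = cong suc (length≡∑ xs)

  ∈-remove : ∀ {x y : A} ys {zs} → y ≢ x → y ∈ ys ++ x ∷ zs → y ∈ ys ++ zs
  ∈-remove ys y≢x p with ∈-++⁻ ys p
  ... | inj₁ q = ∈-++⁺ˡ q
  ... | inj₂ (here e) = ⊥-elim (y≢x e)
  ... | inj₂ (there q) = ∈-++⁺ʳ ys q

  ∑-⊆ : ∀ {xs : List A} (f : A → ℕ) → Unique xs → ∀ {ys} → xs ⊆ ys → ∑ xs f ≤ ∑ ys f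
  ∑-⊆ {xs = []} f u s = z≤n
  ∑-⊆ {xs = x ∷ xs} f (x∉ ∷ u) {ys} s with ∈-∃++ (s (here refl))
  ... | as , bs , refl = begin
    f x + ∑ xs f          ≤⟨ +-monoʳ-≤ (f x) (∑-⊆ f u λ {y} p → ∈-remove as (λ e → All.lookup x∉ p (≡.sym e)) (s (there p))) ⟩
    f x + ∑ (as ++ bs) f  ≡⟨ cong (f x +_) (∑-++ as bs f) ⟩
    f x + (∑ as f + ∑ bs f) ≡⟨ lemma (f x) (∑ as f) (∑ bs f) ⟩
    ∑ as f + (f x + ∑ bs f) ≡⟨ ∑-++ as (x ∷ bs) f ⟨
    ∑ (as ++ x ∷ bs) f ∎
    where open ≤-Reasoning
          lemma : ∀ a b c → a + (b + c) ≡ b + (a + c)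
          lemma = solve-∀

  length-⊆ : ∀ {xs ys : List A} → Unique xs → xs ⊆ ys → length xs ≤ length ys
  length-⊆ {xs = xs} {ys} u s =
    subst₂ _≤_ (≡.sym (length≡∑ xs)) (≡.sym (length≡∑ ys)) (∑-⊆ (λ _ → 1) u s)

  unique-map : ∀ {B : Set} (f : A → B) {xs : List A} → Unique xs →
    (∀ {x y} → x ∈ xs → y ∈ xs → f x ≡ f y → x ≡ y) → Unique (map f xs)
  unique-map f {[]} u inj = []
  unique-map f {x ∷ xs} (x∉ ∷ u) inj =
    All.tabulate (λ {b} p e → let (y , q , e') = ∈-map⁻ f p in
        All.lookup x∉ q (inj (here refl) (there q) (trans e e')))
    ∷ unique-map f u (λ p q → inj (there p) (there q))

  length-injection : ∀ {B : Set} (f : A → B) {xs : List A} {ys : List B} → Unique xs →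
    (∀ {x y} → x ∈ xs → y ∈ xs → f x ≡ f y → x ≡ y) → (∀ {x} → x ∈ xs → f x ∈ ys) →
    length xs ≤ length ys
  length-injection f {xs} {ys} u inj s = subst (_≤ length ys) (length-map f xs)
    (length-⊆ (unique-map f u inj) (λ p → let (x , q , e) = ∈-map⁻ f p in subst (_∈ ys) (≡.sym e) (s q)))

  ⟦_⟧ : ∀ {P : Set} → Dec P → ℕ
  ⟦ yes _ ⟧ = 1
  ⟦ no _ ⟧ = 0

  length-filter≡∑ : ∀ {P : A → Set} (P? : Decidable P) (xs : List A) → length (filter P? xs) ≡ ∑ xs (λ x → ⟦ P? x ⟧)
  length-filter≡∑ P? [] = refl
  length-filter≡∑ P? (x ∷ xs) with P? x
  ... | yes _ = cong suc (length-filter≡∑ P? xs)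
  ... | no _ = length-filter≡∑ P? xs

  length-filter-mono : ∀ {P Q : A → Set} (P? : Decidable P) (Q? : Decidable Q) (xs : List A) →
    (∀ {x} → x ∈ xs → P x → Q x) → length (filter P? xs) ≤ length (filter Q? xs)
  length-filter-mono P? Q? [] h = z≤n
  length-filter-mono P? Q? (x ∷ xs) h with P? x | Q? x
  ... | yes p | yes q = s≤s (length-filter-mono P? Q? xs (h ∘ there))
  ... | yes p | no ¬q = ⊥-elim (¬q (h (here refl) p))
  ... | no _ | yes _ = m≤n⇒m≤1+n (length-filter-mono P? Q? xs (h ∘ there))
  ... | no _ | no _ = length-filter-mono P? Q? xs (h ∘ there)

  length-partition : ∀ {P Q : A → Set} (P? : Decidable P) (Q? : Decidable Q) (xs : List A) →
    (∀ {x} → x ∈ xs → ¬ P x → Q x) → length xs ≤ length (filter P? xs) + length (filter Q? xs)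
  length-partition P? Q? [] h = z≤n
  length-partition P? Q? (x ∷ xs) h with P? x | Q? x
  ... | yes p | yes q = s≤s (≤-trans (length-partition P? Q? xs (h ∘ there)) (+-monoʳ-≤ (length (filter P? xs)) (n≤1+n _)))
  ... | yes p | no ¬q = s≤s (length-partition P? Q? xs (h ∘ there))
  ... | no _ | yes _ = ≤-trans (s≤s (length-partition P? Q? xs (h ∘ there))) (≤-reflexive (≡.sym (+-suc _ _)))
  ... | no ¬p | no ¬q = ⊥-elim (¬q (h (here refl) ¬p))

  length-filter-filter : ∀ {P Q : A → Set} (P? : Decidable P) (Q? : Decidable Q) (xs : List A) →
    length (filter P? (filter Q? xs)) ≤ length (filter P? xs)
  length-filter-filter P? Q? [] = z≤n
  length-filter-filter P? Q? (x ∷ xs) with Q? x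
  length-filter-filter P? Q? (x ∷ xs) | yes _ with P? x
  ... | yes _ = s≤s (length-filter-filter P? Q? xs)
  ... | no _ = length-filter-filter P? Q? xs
  length-filter-filter P? Q? (x ∷ xs) | no _ with P? x
  ... | yes _ = m≤n⇒m≤1+n (length-filter-filter P? Q? xs)
  ... | no _ = length-filter-filter P? Q? xs

  module Count {A K : Set} (_≟K_ : DecidableEquality K) (κ : A → K) where

    count : List A → K → ℕ
    count xs k = length (filter (λ x → κ x ≟K k) xs)

    hits : A → List K → ℕ
    hits x ks = ∑ ks (λ k → ⟦ κ x ≟K k ⟧)

    hits-≥ : ∀ {x ks} → κ x ∈ ks → 1 ≤ hits x ks
    hits-≥ {x} {k ∷ ks} (here e) with κ x ≟K k
    ... | yes _ = s≤s z≤n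
    ... | no ¬e = ⊥-elim (¬e e)
    hits-≥ (there p) = ≤-trans (hits-≥ p) (m≤n+m _ _)

    hits-∉ : ∀ {x ks} → κ x ∉ ks → hits x ks ≡ 0
    hits-∉ {x} {[]} h = refl
    hits-∉ {x} {k ∷ ks} h with κ x ≟K k
    ... | yes e = ⊥-elim (h (here e))
    ... | no _ = hits-∉ (h ∘ there)

    hits-≤ : ∀ {x ks} → Unique ks → hits x ks ≤ 1
    hits-≤ {x} {[]} u = z≤n
    hits-≤ {x} {k ∷ ks} (k∉ ∷ u) with κ x ≟K k
    ... | yes refl rewrite hits-∉ {x} {ks} (λ p → All.lookup k∉ p refl) = ≤-refl
    ... | no _ = hits-≤ u

    ∑-count : ∀ xs ks → ∑ ks (count xs) ≡ ∑ xs (λ x → hits x ks)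
    ∑-count xs ks = trans (∑-cong ks (λ k → length-filter≡∑ (λ x → κ x ≟K k) xs))
                          (∑-swap ks xs (λ k x → ⟦ κ x ≟K k ⟧))

    length≤∑-count : ∀ xs ks → (∀ {x} → x ∈ xs → κ x ∈ ks) → length xs ≤ ∑ ks (count xs)
    length≤∑-count xs ks h rewrite ∑-count xs ks | length≡∑ xs = ∑-mono xs (λ p → hits-≥ (h p))

    ∑-count≤length : ∀ xs ks → Unique ks → ∑ ks (count xs) ≤ length xs
    ∑-count≤length xs ks u rewrite ∑-count xs ks | length≡∑ xs = ∑-mono xs (λ _ → hits-≤ u)

    -- A poor item witnesses `B * count xs k < w k` for its key, and the poor items of a key are
    -- among all its items; a key without poor items costs nothing. Summing over the keys charges
    -- the poor items to the total weight.
    few-poor : ∀ (B : ℕ) (w : K → ℕ) (xs : List A) (ks : List K) → (∀ {x} → x ∈ xs → κ x ∈ ks) →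
      B * length (filter (λ x → suc (B * count xs (κ x)) ≤? w (κ x)) xs) ≤ ∑ ks w
    few-poor B w xs ks cover = begin
      B * length poor             ≤⟨ *-monoʳ-≤ B (length≤∑-count poor ks (λ p → cover (proj₁ (∈-filter⁻ poor? p)))) ⟩
      B * ∑ ks (count poor)       ≡⟨ ∑-* ks B (count poor) ⟨
      ∑ ks (λ k → B * count poor k) ≤⟨ ∑-mono ks (λ {k} _ → each k) ⟩
      ∑ ks w ∎
      where
      open ≤-Reasoning
      poor? : Decidable (λ x → suc (B * count xs (κ x)) ≤ w (κ x))
      poor? x = suc (B * count xs (κ x)) ≤? w (κ x)
      poor : List A
      poor = filter poor? xs
      each : ∀ k → B * count poor k ≤ w k
      each k with filter (λ x → κ x ≟K k) poor in eq
      ... | [] = ≤-trans (≤-reflexive (*-zeroʳ B)) z≤n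
      ... | x ∷ _ with ∈-filter⁻ (λ x → κ x ≟K k) {xs = poor} (subst (x ∈_) (≡.sym eq) (here refl))
      ... | p , refl = begin
        B * suc _         ≡⟨ cong (λ l → B * length l) (≡.sym eq) ⟩
        B * count poor k  ≤⟨ *-monoʳ-≤ B (length-filter-filter (λ x → κ x ≟K k) poor? xs) ⟩
        B * count xs k    ≤⟨ n≤1+n _ ⟩
        suc (B * count xs k) ≤⟨ proj₂ (∈-filter⁻ poor? {xs = xs} p) ⟩
        w k ∎

  -- Layer cake: ∑ f is the sum over the thresholds t of the number of f-values exceeding t.
  module _ {B : Set} (xs : List A) (ys : List B) (f : A → ℕ) (g : B → ℕ) (C : ℕ)
           (h : ∀ t → length (filter (λ x → suc t ≤? f x) xs) ≤ C * length (filter (λ y → suc t ≤? g y) ys)) where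
    layer : ∀ {D : Set} (e : D → ℕ) t zs →
      ∑ zs (λ z → e z ⊓ suc t) ≡ ∑ zs (λ z → e z ⊓ t) + length (filter (λ z → suc t ≤? e z) zs)
    layer e t zs = trans (∑-cong zs step) (trans (∑-+ zs _ _) (cong (∑ zs (λ z → e z ⊓ t) +_) (≡.sym (length-filter≡∑ _ zs))))
      where step : ∀ z → e z ⊓ suc t ≡ (e z ⊓ t) + ⟦ suc t ≤? e z ⟧
            step z with suc t ≤? e z
            ... | yes p = trans (m≥n⇒m⊓n≡n p) (trans (+-comm 1 t) (cong (_+ 1) (≡.sym (m≥n⇒m⊓n≡n (<⇒≤ p)))))
            ... | no ¬p = let q = s≤s⁻¹ (≰⇒> ¬p) in
                trans (m≤n⇒m⊓n≡m (m≤n⇒m≤1+n q)) (trans (≡.sym (m≤n⇒m⊓n≡m q)) (≡.sym (+-identityʳ _)))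

    truncated : ∀ t → ∑ xs (λ x → f x ⊓ t) ≤ C * ∑ ys (λ y → g y ⊓ t)
    truncated zero = ≤-trans (≤-reflexive (trans (∑-cong xs (λ x → ⊓-zeroʳ (f x))) (trans (∑-const xs 0) (*-zeroʳ (length xs))))) z≤n
    truncated (suc t) = begin
      ∑ xs (λ x → f x ⊓ suc t) ≡⟨ layer f t xs ⟩
      ∑ xs (λ x → f x ⊓ t) + _ ≤⟨ +-mono-≤ (truncated t) (h t) ⟩
      C * ∑ ys (λ y → g y ⊓ t) + C * _ ≡⟨ *-distribˡ-+ C _ _ ⟨
      C * (∑ ys (λ y → g y ⊓ t) + _) ≡⟨ cong (C *_) (layer g t ys) ⟨
      C * ∑ ys (λ y → g y ⊓ suc t) ∎
      where open ≤-Reasoning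

    layer-cake : ∑ xs f ≤ C * ∑ ys g
    layer-cake = begin
      ∑ xs f ≤⟨ ∑-mono xs (λ p → ≤-reflexive (≡.sym (m≤n⇒m⊓n≡m (∈⇒≤∑ f p)))) ⟩
      ∑ xs (λ x → f x ⊓ ∑ xs f) ≤⟨ truncated (∑ xs f) ⟩
      C * ∑ ys (λ y → g y ⊓ ∑ xs f) ≤⟨ *-monoʳ-≤ C (∑-mono ys (λ {y} _ → m⊓n≤m (g y) (∑ xs f))) ⟩
      C * ∑ ys g ∎
      where open ≤-Reasoning

  length-remove : ∀ (_≟_ : DecidableEquality A) (R : List A) (xs : List A) → Unique xs →
    ∀ {P : A → Set} (P? : Decidable P) → (∀ {x} → x ∈ xs → ¬ P x → x ∈ R) →
    length xs ≤ length (filter P? xs) + length R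
  length-remove _≟_ R xs u P? h = ≤-trans (length-partition P? (λ x → x ∈? R) xs h)
    (+-monoʳ-≤ _ (length-⊆ (filter⁺ (λ x → x ∈? R) u) (λ p → proj₂ (∈-filter⁻ (λ x → x ∈? R) {xs = xs} p))))
    where open import Data.List.Membership.DecPropositional _≟_ using (_∈?_)
          open import Data.List.Relation.Unary.Unique.Propositional.Properties using (filter⁺)

  allPairs : ∀ n → List (Fin n × Fin n)
  allPairs n = cartesianProduct (allFin n) (allFin n)

  ∈-allPairs : ∀ {n} (e : Fin n × Fin n) → e ∈ allPairs n
  ∈-allPairs (x , y) = ∈-cartesianProduct⁺ (∈-allFin x) (∈-allFin y)

  allPairs-unique : ∀ n → Unique (allPairs n)
  allPairs-unique n = cartesianProduct⁺ (allFin⁺ n) (allFin⁺ n)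

  length-concatMap-≤ : ∀ {A B : Set} (f : A → List B) b → (∀ x → length (f x) ≤ b) → ∀ xs → length (concatMap f xs) ≤ length xs * b
  length-concatMap-≤ f b h [] = z≤n
  length-concatMap-≤ f b h (x ∷ xs) = ≤-trans (≤-reflexive (length-++ (f x))) (+-mono-≤ (h x) (length-concatMap-≤ f b h xs))

  length-cartesianProduct : ∀ {A B : Set} (xs : List A) (ys : List B) → length (cartesianProduct xs ys) ≡ length xs * length ys
  length-cartesianProduct [] ys = refl
  length-cartesianProduct (x ∷ xs) ys =
    trans (length-++ (map (x ,_) ys)) (cong₂ _+_ (length-map (x ,_) ys) (length-cartesianProduct xs ys))

  ∈-concatMap : ∀ {A B : Set} (f : A → List B) {x y} {xs} → x ∈ xs → y ∈ f x → y ∈ concatMap f xs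
  ∈-concatMap f x∈ y∈ = ∈-concatMap⁺ f (lose x∈ y∈)

  length-allFin : ∀ n → length (allFin n) ≡ n
  length-allFin n = length-tabulate (λ i → i)

  ∑-cartesianProduct : ∀ {A B : Set} (xs : List A) (ys : List B) (f : A × B → ℕ) →
    ∑ (cartesianProduct xs ys) f ≡ ∑ xs (λ x → ∑ ys (λ y → f (x , y)))
  ∑-cartesianProduct [] ys f = refl
  ∑-cartesianProduct (x ∷ xs) ys f =
    trans (∑-++ (map (x ,_) ys) _ f) (cong₂ _+_ (∑-map (x ,_) ys f) (∑-cartesianProduct xs ys f))

  ∃-max : ∀ {K : Set} (F : K → ℕ) (ks : List K) → 0 < length ks → ∃ λ k → ∑ ks F ≤ length ks * F k
  ∃-max F (k ∷ []) _ = k , ≤-refl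
  ∃-max F (k ∷ k' ∷ ks) _ with ∃-max F (k' ∷ ks) (s≤s z≤n)
  ... | m , h with F k ≤? F m
  ... | yes p = m , +-mono-≤ p h
  ... | no ¬p = k , +-monoʳ-≤ (F k) (≤-trans h (*-monoʳ-≤ (length (k' ∷ ks)) (<⇒≤ (≰⇒> ¬p))))

  ∈⇒nonempty : ∀ {A : Set} {x : A} {xs} → x ∈ xs → 0 < length xs
  ∈⇒nonempty (here _) = s≤s z≤n
  ∈⇒nonempty (there _) = s≤s z≤n

  empty? : ∀ {A : Set} (xs : List A) → Dec (xs ≡ [])
  empty? [] = yes refl
  empty? (_ ∷ _) = no λ ()

  module Independent {A : Set} (_≟_ : DecidableEquality A) (K : ℕ) (conf : A → List A) where
    open import Data.List.Membership.DecPropositional _≟_ using (_∈?_)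
    open import Data.List.Relation.Unary.Unique.Propositional.Properties using (filter⁺)
    open import Relation.Nullary.Decidable using (¬?)
    open import Data.List.Properties using (length-filter)

    -- Greedy: the head is kept and its at most `K` conflicts are dropped from the tail, so each
    -- kept item pays for `suc K`. As `conf` need not be symmetric, only the list of the item kept
    -- first is known to omit the other; hence the disjunction.
    go : ∀ fuel (xs : List A) → length xs ≤ fuel → Unique xs → (∀ {x} → x ∈ xs → length (conf x) ≤ K) →
      ∃ λ ys → Unique ys × ys ⊆ xs ×
               (∀ {x y} → x ∈ ys → y ∈ ys → x ≢ y → y ∉ conf x ⊎ x ∉ conf y) ×
               length xs ≤ suc K * length ys
    go _ [] _ u h = [] , [] , (λ ()) , (λ ()) , z≤n
    go (suc fuel) (x ∷ xs) (s≤s l) (x∉ ∷ u) h with go fuel xs' l' (filter⁺ P? u) (λ p → h (there (proj₁ (∈-filter⁻ P? {xs = xs} p))))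
      where
      P? : Decidable (λ y → y ∉ conf x)
      P? y = ¬? (y ∈? conf x)
      xs' : List A
      xs' = filter P? xs
      l' : length xs' ≤ fuel
      l' = ≤-trans (length-filter P? xs) l
    ... | ys , uy , sub , ind , len = x ∷ ys ,
        (All.tabulate (λ p e → All.lookup x∉ (proj₁ (∈-filter⁻ P? {xs = xs} (sub p))) e) ∷ uy) ,
        (λ { (here e) → here e ; (there p) → there (proj₁ (∈-filter⁻ P? {xs = xs} (sub p))) }) ,
        ind' , (begin
          suc (length xs) ≤⟨ s≤s (length-remove _≟_ (conf x) xs u P? (λ {y} _ ¬n → dn y ¬n)) ⟩
          suc (length (filter P? xs) + length (conf x)) ≤⟨ s≤s (+-mono-≤ len (h (here refl))) ⟩
          suc (suc K * length ys + K) ≡⟨ cong suc (+-comm _ K) ⟩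
          suc K + suc K * length ys ≡⟨ *-suc (suc K) (length ys) ⟨
          suc K * suc (length ys) ∎)
      where
      open ≤-Reasoning
      P? : Decidable (λ y → y ∉ conf x)
      P? y = ¬? (y ∈? conf x)
      dn : ∀ y → ¬ (y ∉ conf x) → y ∈ conf x
      dn y ¬n with y ∈? conf x
      ... | yes p = p
      ... | no ¬p = ⊥-elim (¬n ¬p)
      ind' : ∀ {a b} → a ∈ x ∷ ys → b ∈ x ∷ ys → a ≢ b → b ∉ conf a ⊎ a ∉ conf b
      ind' (here refl) (here refl) ne = ⊥-elim (ne refl)
      ind' (here refl) (there q) ne = inj₁ (proj₂ (∈-filter⁻ P? {xs = xs} (sub q)))
      ind' (there p) (here refl) ne = inj₂ (proj₂ (∈-filter⁻ P? {xs = xs} (sub p)))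
      ind' (there p) (there q) ne = ind p q ne

    independent : (xs : List A) → Unique xs → (∀ {x} → x ∈ xs → length (conf x) ≤ K) →
        ∃ λ ys → Unique ys × ys ⊆ xs ×
                 (∀ {x y} → x ∈ ys → y ∈ ys → x ≢ y → y ∉ conf x ⊎ x ∉ conf y) ×
                 length xs ≤ suc K * length ys
    independent xs = go (length xs) xs ≤-refl

-- Minor models and the minor relation.

module Minors where

  open import Data.Fin using (_≟_)
  open import Data.Fin.Properties using (punchIn-injective; punchInᵢ≢i; punchIn-punchOut; punchOut-cong; punchOut-punchIn)
  import Data.Maybe.Properties as MaybeP
  open import Function.Bundles using (mk⇔)
  open Counting using (allPairs; ∈-allPairs)

  Adj : ∀ {n} → Graph n → Fin n → Fin n → Set
  Adj G x y = adj G x y ≡ true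

  Adj-sym : ∀ {n} (G : Graph n) {x y} → Adj G x y → Adj G y x
  Adj-sym G {x} {y} e = trans (sym G y x) e

  Adj-irrefl : ∀ {n} (G : Graph n) {x y} → Adj G x y → x ≢ y
  Adj-irrefl G {x} e refl with trans (≡.sym e) (irrefl G x)
  ... | ()

  Adj? : ∀ {n} (G : Graph n) x y → Dec (Adj G x y)
  Adj? G x y = adj G x y ≟ᵇ true

  ¬true⇒false : ∀ {b} → b ≢ true → b ≡ false
  ¬true⇒false {false} h = refl
  ¬true⇒false {true} h = ⊥-elim (h refl)

  graphOf : ∀ {n} {R : Fin n → Fin n → Set} → (∀ i j → Dec (R i j)) →
    (∀ {i j} → R i j → R j i) → (∀ {i} → ¬ R i i) → Graph n
  graphOf {n} {R} R? s ir = record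
    { adj = λ i j → does (R? i j)
    ; sym = λ i j → does-sym i j (R? i j) (R? j i)
    ; irrefl = λ i → does-false i (R? i i) }
    where
    does-sym : ∀ i j (a : Dec (R i j)) (b : Dec (R j i)) → does a ≡ does b
    does-sym i j (yes _) (yes _) = refl
    does-sym i j (no _) (no _) = refl
    does-sym i j (yes p) (no q) = ⊥-elim (q (s p))
    does-sym i j (no p) (yes q) = ⊥-elim (p (s q))
    does-false : ∀ i (a : Dec (R i i)) → does a ≡ false
    does-false i (yes p) = ⊥-elim (ir p)
    does-false i (no _) = refl

  does⇒ : ∀ {P : Set} (d : Dec P) → does d ≡ true → P
  does⇒ (yes p) _ = p

  ⇒does : ∀ {P : Set} (d : Dec P) → P → does d ≡ true
  ⇒does (yes _) _ = refl
  ⇒does (no ¬p) p = ⊥-elim (¬p p)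

  data Path {n l} (A : Fin n → Fin n → Set) (φ : Fin n → Maybe (Fin l)) (s : Fin l) (x : Fin n) : Fin n → Set where
    ε    : Path A φ s x x
    snoc : ∀ {y z} → Path A φ s x y → A y z → φ z ≡ just s → Path A φ s x z

  Path-end : ∀ {n l} {A : Fin n → Fin n → Set} {φ : Fin n → Maybe (Fin l)} {s x y} →
    φ x ≡ just s → Path A φ s x y → φ y ≡ just s
  Path-end e ε = e
  Path-end e (snoc p a q) = q

  -- Branch sets are the fibres of a partial map, each connected through paths from its root.
  -- Arbitrary relations are allowed on both sides, so that the notion also covers the complete
  -- graph `_≢_` and auxiliary graphs on the vertices of `G`.
  record Model {n l} (A : Fin n → Fin n → Set) (E : Fin l → Fin l → Set) : Set where
    field
      branch : Fin n → Maybe (Fin l)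
      root : Fin l → Fin n
      root-branch : ∀ s → branch (root s) ≡ just s
      connected : ∀ {x s} → branch x ≡ just s → Path A branch s (root s) x
      link : ∀ {s t} → E s t → ∃₂ λ x y → branch x ≡ just s × branch y ≡ just t × A x y

  module _ {l} (L : Graph l) where

    module Spanning {n} (f : Fin l → Fin n) (g : Fin n → Fin l) (gf : ∀ x → g (f x) ≡ x) (fg : ∀ y → f (g y) ≡ y) where

      L′ : Fin n → Fin n → Bool
      L′ i j = adj L (g i) (g j)

      L′-sym : ∀ i j → L′ i j ≡ L′ j i
      L′-sym i j = sym L (g i) (g j)

      skip : ∀ {x y ps} (G : Graph n) → (∀ i j → (i , j) ∉ (x , y) ∷ ps → (j , i) ∉ (x , y) ∷ ps → adj G i j ≡ L′ i j) →
        adj G x y ≡ L′ x y → ∀ i j → (i , j) ∉ ps → (j , i) ∉ ps → adj G i j ≡ L′ i j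
      skip {x} {y} G same xy i j p q with (i ≟ x) ×-dec (j ≟ y) | (i ≟ y) ×-dec (j ≟ x)
      ... | yes (refl , refl) | _ = xy
      ... | no _ | yes (refl , refl) = trans (sym G y x) (trans xy (L′-sym x y))
      ... | no a | no b = same i j (λ { (here refl) → a (refl , refl) ; (there h) → p h })
                                   (λ { (here refl) → b (refl , refl) ; (there h) → q h })

      -- Edges of `G` without counterpart in `L′` are deleted one at a time. The invariant is that
      -- `G` contains `L′` and agrees with it off the pairs still listed, in either orientation; an
      -- empty list leaves an isomorphism.
      prune : ∀ ps (G : Graph n) → (∀ i j → (i , j) ∉ ps → (j , i) ∉ ps → adj G i j ≡ L′ i j) →
        (∀ i j → L′ i j ≡ true → Adj G i j) → Minor L G
      prune [] G same sub = iso (f , g , gf , fg , λ a b →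
        ≡.sym (trans (same (f a) (f b) (λ ()) (λ ())) (cong₂ (adj L) (gf a) (gf b))))
      prune ((x , y) ∷ ps) G same sub with Adj? G x y | L′ x y ≟ᵇ true
      ... | yes e | no ¬e' = edel (x , y , e , ¬true⇒false (λ h → proj₂ (does⇒ (R? x y) h) (inj₁ (refl , refl))) , unchanged)
                                  (prune ps G' same' sub')
        where
        Removed : Fin n → Fin n → Set
        Removed i j = (i ≡ x × j ≡ y) ⊎ (i ≡ y × j ≡ x)
        removed? : ∀ i j → Dec (Removed i j)
        removed? i j = ((i ≟ x) ×-dec (j ≟ y)) ⊎-dec ((i ≟ y) ×-dec (j ≟ x))
        swap : ∀ {i j} → Removed i j → Removed j i
        swap (inj₁ (a , b)) = inj₂ (b , a)
        swap (inj₂ (a , b)) = inj₁ (b , a)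
        R? : ∀ i j → Dec (Adj G i j × ¬ Removed i j)
        R? i j = Adj? G i j ×-dec ¬? (removed? i j)
        G' : Graph n
        G' = graphOf R? (λ (a , b) → Adj-sym G a , b ∘ swap) (λ (a , _) → Adj-irrefl G a refl)
        unchanged : ∀ i j → ¬ Removed i j → adj G' i j ≡ adj G i j
        unchanged i j nr = by-cases (Adj? G i j)
          where
          by-cases : Dec (Adj G i j) → adj G' i j ≡ adj G i j
          by-cases (no ¬a) = trans (¬true⇒false (λ h → ¬a (proj₁ (does⇒ (R? i j) h)))) (≡.sym (¬true⇒false ¬a))
          by-cases (yes a) = trans (⇒does (R? i j) (a , nr)) (≡.sym a)
        gone : ∀ {i j} → Removed i j → L′ i j ≡ false
        gone (inj₁ (refl , refl)) = ¬true⇒false ¬e'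
        gone (inj₂ (refl , refl)) = trans (L′-sym y x) (¬true⇒false ¬e')
        same' : ∀ i j → (i , j) ∉ ps → (j , i) ∉ ps → adj G' i j ≡ L′ i j
        same' i j p q with removed? i j
        ... | yes r = trans (¬true⇒false (λ h → proj₂ (does⇒ (R? i j) h) r)) (≡.sym (gone r))
        ... | no nr = trans (unchanged i j nr) (same i j
          (λ { (here refl) → nr (inj₁ (refl , refl)) ; (there h) → p h })
          (λ { (here refl) → nr (inj₂ (refl , refl)) ; (there h) → q h }))
        sub' : ∀ i j → L′ i j ≡ true → Adj G' i j
        sub' i j h = ⇒does (R? i j) (sub i j h , λ r → case-⊥ (trans (≡.sym h) (gone r)))
          where case-⊥ : true ≡ false → ⊥
                case-⊥ ()
      ... | yes e | yes e' = prune ps G (skip G same (trans e (≡.sym e'))) sub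
      ... | no ¬e | yes e' = ⊥-elim (¬e (sub x y e'))
      ... | no ¬e | no ¬e' = prune ps G (skip G same (trans (¬true⇒false ¬e) (≡.sym (¬true⇒false ¬e')))) sub

    module Discrete {n} (G : Graph n) (M : Model (Adj G) (Adj L))
                    (total : ∀ v → Model.branch M v ≢ nothing)
                    (discrete : ∀ x y → Adj G x y → Model.branch M x ≢ Model.branch M y) where
      open Model M
      index : ∀ v → ∃ λ s → branch v ≡ just s
      index v with branch v in eq
      ... | nothing = ⊥-elim (total v eq)
      ... | just s = s , refl

      end : ∀ {s x y} → branch x ≡ just s → Path (Adj G) branch s x y → x ≡ y
      end e ε = refl
      end e (snoc {y} p a q) = ⊥-elim (discrete _ _ a (trans (Path-end e p) (≡.sym q)))

      -- With every vertex used and no edge inside a branch set, connectedness makes each branch set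
      -- a singleton. Thus `root` and the branch index are inverse bijections, and only surplus
      -- edges remain to be deleted.
      minor : Minor L G
      minor = Spanning.prune root (proj₁ ∘ index)
        (λ s → just-injective (trans (≡.sym (proj₂ (index (root s)))) (root-branch s)))
        retract
        (allPairs n) G
        (λ i j p _ → ⊥-elim (p (∈-allPairs (i , j))))
        sub
        where
        retract : ∀ y → root (proj₁ (index y)) ≡ y
        retract y = end (root-branch _) (connected (proj₂ (index y)))
        at : ∀ {x y s} → branch x ≡ just s → proj₁ (index y) ≡ s → x ≡ y
        at {x} {y} e h = trans (≡.sym (retract x)) (trans (cong root (trans (just-injective (trans (≡.sym (proj₂ (index x))) e)) (≡.sym h))) (retract y))
        sub : ∀ i j → adj L (proj₁ (index i)) (proj₁ (index j)) ≡ true → Adj G i j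
        sub i j h with link h
        ... | x , y , bx , by , a = subst₂′ (at {x} {i} bx refl) (at {y} {j} by refl) a
          where subst₂′ : ∀ {x y i j} → x ≡ i → y ≡ j → Adj G x y → Adj G i j
                subst₂′ refl refl a = a

    module Delete {n} (G : Graph (suc n)) (M : Model (Adj G) (Adj L)) (v : Fin (suc n))
                  (unused : Model.branch M v ≡ nothing) where
      open Model M
      G' : Graph n
      G' = record { adj = λ i j → adj G (punchIn v i) (punchIn v j)
                  ; sym = λ i j → sym G _ _ ; irrefl = λ i → irrefl G _ }

      used : ∀ {x s} → branch x ≡ just s → v ≢ x
      used e refl with trans (≡.sym unused) e
      ... | ()

      branch' : Fin n → Maybe (Fin l)
      branch' = branch ∘ punchIn v

      lower : ∀ {s x y} → branch x ≡ just s → Path (Adj G) branch s x y → ∀ {x' y'} →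
        punchIn v x' ≡ x → punchIn v y' ≡ y → Path (Adj G') branch' s x' y'
      lower e ε p q with punchIn-injective v _ _ (trans p (≡.sym q))
      ... | refl = ε
      lower e (snoc {y} π a b) p refl =
        snoc (lower e π p (punchIn-punchOut v≢y)) (subst (λ w → Adj G w _) (≡.sym (punchIn-punchOut v≢y)) a) b
        where v≢y : v ≢ y
              v≢y = used (Path-end e π)

      M' : Model (Adj G') (Adj L)
      M' = record
        { branch = branch'
        ; root = λ s → punchOut (used (root-branch s))
        ; root-branch = λ s → trans (cong branch (punchIn-punchOut _)) (root-branch s)
        ; connected = λ e → lower (root-branch _) (connected e) (punchIn-punchOut _) refl
        ; link = λ h → let (x , y , bx , by , a) = link h in
            punchOut (used bx) , punchOut (used by) ,
            trans (cong branch (punchIn-punchOut _)) bx , trans (cong branch (punchIn-punchOut _)) by ,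
            trans (cong₂ (adj G) (punchIn-punchOut _) (punchIn-punchOut _)) a
        }

    module Contract {n} (G : Graph (suc n)) (M : Model (Adj G) (Adj L)) (x y : Fin (suc n))
                    (xy : Adj G x y) (same : Model.branch M x ≡ Model.branch M y) where
      open Model M
      y≢x : y ≢ x
      y≢x e = Adj-irrefl G xy (≡.sym e)

      u' : Fin n
      u' = punchOut y≢x

      quot : Fin (suc n) → Fin n
      quot z with y ≟ z
      ... | yes _ = u'
      ... | no ne = punchOut ne

      Pre : Fin n → Fin (suc n) → Set
      Pre i a = (a ≡ punchIn y i) ⊎ (a ≡ y × i ≡ u')

      pre? : ∀ i a → Dec (Pre i a)
      pre? i a = (a ≟ punchIn y i) ⊎-dec ((a ≟ y) ×-dec (i ≟ u'))

      quot-pre : ∀ z → Pre (quot z) z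
      quot-pre z with y ≟ z
      ... | yes e = inj₂ (≡.sym e , refl)
      ... | no ne = inj₁ (≡.sym (punchIn-punchOut ne))

      R : Fin n → Fin n → Set
      R i j = i ≢ j × ∃₂ λ a b → Pre i a × Pre j b × Adj G a b

      R? : ∀ i j → Dec (R i j)
      R? i j = ¬? (i ≟ j) ×-dec FinP.any? λ a → FinP.any? λ b → pre? i a ×-dec (pre? j b ×-dec Adj? G a b)

      G' : Graph n
      G' = graphOf R? (λ (ne , a , b , p , q , e) → ne ∘ ≡.sym , b , a , q , p , Adj-sym G e) (λ (ne , _) → ne refl)

      contraction : Contraction G' G
      contraction = y , u' , trans (cong (λ w → adj G w y) (punchIn-punchOut y≢x)) xy ,
        λ i j → mk⇔ (does⇒ (R? i j)) (⇒does (R? i j))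

      branch' : Fin n → Maybe (Fin l)
      branch' = branch ∘ punchIn y

      branch-quot : ∀ z → branch' (quot z) ≡ branch z
      branch-quot z with y ≟ z
      ... | yes refl = trans (cong branch (punchIn-punchOut y≢x)) same
      ... | no ne = cong branch (punchIn-punchOut ne)

      lower : ∀ {s a b} → Path (Adj G) branch s a b → Path (Adj G') branch' s (quot a) (quot b)
      lower ε = ε
      lower (snoc {b} {c} π e h) with quot b ≟ quot c
      ... | yes eq = subst (Path (Adj G') branch' _ _) eq (lower π)
      ... | no ne = snoc (lower π) (⇒does (R? _ _) (ne , b , c , quot-pre b , quot-pre c , e)) (trans (branch-quot c) h)

      quot-punchIn : ∀ i → quot (punchIn y i) ≡ i
      quot-punchIn i with y ≟ punchIn y i
      ... | yes e = ⊥-elim (punchInᵢ≢i y i (≡.sym e))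
      ... | no ne = trans (punchOut-cong y refl) (punchOut-punchIn y)

      M' : Model (Adj G') (Adj L)
      M' = record
        { branch = branch'
        ; root = quot ∘ root
        ; root-branch = λ s → trans (branch-quot _) (root-branch s)
        ; connected = λ {i} e → subst (Path (Adj G') branch' _ _) (quot-punchIn i) (lower (connected e))
        ; link = λ {s} {t} h → let (a , b , ba , bb , e) = link h in
            quot a , quot b , trans (branch-quot a) ba , trans (branch-quot b) bb ,
            -- A linking edge is not collapsed: its ends lie in different branch sets, as `L` has no
            -- loops.
            ⇒does (R? _ _) ((λ q → Adj-irrefl L h (just-injective
               (trans (≡.sym ba) (trans (≡.sym (branch-quot a)) (trans (cong branch' q) (trans (branch-quot b) bb)))))) ,
              a , b , quot-pre a , quot-pre b , e)
        }

    model⇒minor : ∀ {n} (G : Graph n) → Model (Adj G) (Adj L) → Minor L G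
    model⇒minor {zero} G M = Discrete.minor G M (λ ()) (λ ())
    model⇒minor {suc n} G M with FinP.any? (λ v → MaybeP.≡-dec _≟_ (Model.branch M v) nothing)
    ... | yes (v , unused) = vdel {G' = Delete.G' G M v unused} (v , λ i j → refl) (model⇒minor _ (Delete.M' G M v unused))
    ... | no total with FinP.any? (λ x → FinP.any? λ y → Adj? G x y ×-dec MaybeP.≡-dec _≟_ (Model.branch M x) (Model.branch M y))
    ... | yes (x , y , xy , same) = contr {G' = Contract.G' G M x y xy same} (Contract.contraction G M x y xy same) (model⇒minor _ (Contract.M' G M x y xy same))
    ... | no discrete = Discrete.minor G M (λ v e → total (v , e)) (λ x y e q → discrete (x , y , e , q))

-- Mader's theorem: large average degree forces a complete minor.

module Density where

  open import Data.Nat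
  open import Data.Nat.Properties
  open import Data.Nat.Tactic.RingSolver using (solve-∀)
  open Counting
  open Minors

  unique-++-remove : ∀ {A : Set} as {v : A} {bs} → Unique (as ++ v ∷ bs) → Unique (as ++ bs)
  unique-++-remove [] (_ ∷ u) = u
  unique-++-remove (a ∷ as) (p ∷ u) =
    All.tabulate (λ q e → All.lookup p (lift (∈-++⁻ as q)) e) ∷ unique-++-remove as u
    where lift : ∀ {x} {bs} {v} → x ∈ as ⊎ x ∈ bs → x ∈ as ++ v ∷ bs
          lift (inj₁ q) = ∈-++⁺ˡ q
          lift (inj₂ q) = ∈-++⁺ʳ as (there q)

  unique-++-∉ : ∀ {A : Set} as {v : A} {bs} → Unique (as ++ v ∷ bs) → v ∉ as ++ bs
  unique-++-∉ [] (p ∷ _) q = All.lookup p q refl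
  unique-++-∉ (a ∷ as) (p ∷ u) (here refl) = All.lookup p (∈-++⁺ʳ as (here refl)) refl
  unique-++-∉ (a ∷ as) (p ∷ u) (there q) = unique-++-∉ as u q

  length-++-∷ : ∀ {A : Set} as {v : A} {bs} → length (as ++ v ∷ bs) ≡ suc (length (as ++ bs))
  length-++-∷ [] = refl
  length-++-∷ (a ∷ as) = cong suc (length-++-∷ as)

  ∑-++-∷ : ∀ {A : Set} as {v : A} {bs} (f : A → ℕ) → ∑ (as ++ v ∷ bs) f ≡ f v + ∑ (as ++ bs) f
  ∑-++-∷ [] f = refl
  ∑-++-∷ (a ∷ as) {v} {bs} f rewrite ∑-++-∷ as {v} {bs} f = lemma (f a) (f v) _
    where lemma : ∀ a b c → a + (b + c) ≡ b + (a + c)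
          lemma = solve-∀

  module Mader {n} (A : Fin n → Fin n → Set) (A? : ∀ x y → Dec (A x y))
               (A-sym : ∀ {x y} → A x y → A y x) (A-irrefl : ∀ {x} → ¬ A x x) where

    deg : List (Fin n) → Fin n → ℕ
    deg R x = ∑ R (λ y → ⟦ A? x y ⟧)

    degrees : List (Fin n) → ℕ
    degrees R = ∑ R (deg R)

    a-sym : ∀ x y → ⟦ A? x y ⟧ ≡ ⟦ A? y x ⟧
    a-sym x y with A? x y | A? y x
    ... | yes _ | yes _ = refl
    ... | no _ | no _ = refl
    ... | yes p | no ¬q = ⊥-elim (¬q (A-sym p))
    ... | no ¬p | yes q = ⊥-elim (¬p (A-sym q))

    a-irrefl : ∀ x → ⟦ A? x x ⟧ ≡ 0
    a-irrefl x with A? x x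
    ... | yes p = ⊥-elim (A-irrefl p)
    ... | no _ = refl

    degrees-remove : ∀ as v bs → degrees (as ++ v ∷ bs) ≡ degrees (as ++ bs) + 2 * deg (as ++ bs) v
    degrees-remove as v bs = begin
      ∑ (as ++ v ∷ bs) (deg (as ++ v ∷ bs)) ≡⟨ ∑-++-∷ as (deg (as ++ v ∷ bs)) ⟩
      deg (as ++ v ∷ bs) v + ∑ R (deg (as ++ v ∷ bs)) ≡⟨ cong₂ _+_ (∑-++-∷ as _) (∑-cong R (λ x → ∑-++-∷ as _)) ⟩
      ⟦ A? v v ⟧ + deg R v + ∑ R (λ x → ⟦ A? x v ⟧ + deg R x) ≡⟨ cong₂ _+_ (cong (_+ deg R v) (a-irrefl v)) (∑-+ R _ _) ⟩
      deg R v + (∑ R (λ x → ⟦ A? x v ⟧) + degrees R) ≡⟨ cong (λ w → deg R v + (w + degrees R)) (∑-cong R (λ x → a-sym x v)) ⟩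
      deg R v + (deg R v + degrees R) ≡⟨ lemma (deg R v) (degrees R) ⟩
      degrees R + 2 * deg R v ∎
      where
      open ≡.≡-Reasoning
      R = as ++ bs
      lemma : ∀ a b → a + (a + b) ≡ b + 2 * a
      lemma = solve-∀

    data Connected : List (Fin n) → Set where
      singleton : ∀ x → Connected [ x ]
      attach : ∀ {u v U} → Connected U → u ∈ U → A u v → Connected (v ∷ U)

    base : ∀ {U} → Connected U → Fin n
    base (singleton x) = x
    base (attach c _ _) = base c

    base∈ : ∀ {U} (c : Connected U) → base c ∈ U
    base∈ (singleton x) = here refl
    base∈ (attach c _ _) = there (base∈ c)

    base-path : ∀ {l} {φ : Fin n → Maybe (Fin l)} {s U} (c : Connected U) → (∀ {x} → x ∈ U → φ x ≡ just s) →
      ∀ {x} → x ∈ U → Path A φ s (base c) x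
    base-path (singleton x) h (here refl) = ε
    base-path (attach c u∈ a) h (here refl) = snoc (base-path c (h ∘ there) u∈) a (h (here refl))
    base-path (attach c u∈ a) h (there p) = base-path c (h ∘ there) p

    touches? : ∀ U → Decidable (λ y → Any (λ u → A u y) U)
    touches? U y = Any.any? (λ u → A? u y) U

    boundary : List (Fin n) → List (Fin n) → List (Fin n)
    boundary U R = filter (touches? U) R

    KModel : ℕ → List (Fin n) → Set
    KModel r R = Σ (Model {l = r} A _≢_) λ M → ∀ {x s} → Model.branch M x ≡ just s → x ∈ R

    open import Data.List.Membership.DecPropositional (Fin._≟_ {n}) using (_∈?_)

    -- Every branch set of the given model lies in the boundary, so its root has a neighbour in `U`;
    -- the connected set `U` is therefore one more branch set, linked to all the others.
    extend : ∀ {r U R} → Connected U → (∀ {x} → x ∈ U → x ∉ R) → KModel r (boundary U R) → KModel (suc r) (U ++ R)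
    extend {r} {U} {R} c disjoint (M , inside) = record
      { branch = branch'
      ; root = λ { zero → base c ; (suc s) → root s }
      ; root-branch = λ { zero → in-U (base∈ c) ; (suc s) → lift (root-branch s) }
      ; connected = connected'
      ; link = link' } , λ {x} {s} e → covered x s e
      where
      open Model M
      branch' : Fin n → Maybe (Fin (suc r))
      branch' x with x ∈? U
      ... | yes _ = just zero
      ... | no _ = Maybe.map suc (branch x)
      in-U : ∀ {x} → x ∈ U → branch' x ≡ just zero
      in-U {x} p with x ∈? U
      ... | yes _ = refl
      ... | no ¬p = ⊥-elim (¬p p)
      in-R : ∀ {x s} → branch x ≡ just s → x ∈ R × Any (λ u → A u x) U
      in-R e = ∈-filter⁻ (touches? U) {xs = R} (inside e)
      lift : ∀ {x s} → branch x ≡ just s → branch' x ≡ just (suc s)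
      lift {x} e with x ∈? U
      ... | yes p = ⊥-elim (disjoint p (proj₁ (in-R e)))
      ... | no _ = cong (Maybe.map suc) e
      lower : ∀ x {s} → branch' x ≡ just (suc s) → branch x ≡ just s
      lower x e with x ∈? U
      lower x () | yes _
      ... | no _ with branch x
      lower x refl | no _ | just s = refl
      lower-zero : ∀ x → branch' x ≡ just zero → x ∈ U
      lower-zero x e with x ∈? U
      ... | yes p = p
      ... | no _ with branch x
      lower-zero x () | no _ | just s
      lower-zero x () | no _ | nothing
      lift-path : ∀ {s x y} → Path A branch s x y → Path A branch' (suc s) x y
      lift-path ε = ε
      lift-path (snoc p a e) = snoc (lift-path p) a (lift e)
      connected' : ∀ {x s} → branch' x ≡ just s → Path A branch' s _ x
      connected' {x} {zero} e = base-path c in-U (lower-zero x e)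
      connected' {x} {suc s} e = lift-path (connected (lower x e))
      touch : ∀ s → ∃ λ u → u ∈ U × A u (root s)
      touch s = find (proj₂ (in-R (root-branch s)))
      link' : ∀ {s t} → s ≢ t → ∃₂ λ x y → branch' x ≡ just s × branch' y ≡ just t × A x y
      link' {zero} {zero} ne = ⊥-elim (ne refl)
      link' {zero} {suc t} ne = let (u , p , a) = touch t in u , root t , in-U p , lift (root-branch t) , a
      link' {suc s} {zero} ne = let (u , p , a) = touch s in root s , u , lift (root-branch s) , in-U p , A-sym a
      link' {suc s} {suc t} ne = let (x , y , ex , ey , a) = link (ne ∘ cong suc) in x , y , lift ex , lift ey , a
      covered : ∀ x s → branch' x ≡ just s → x ∈ U ++ R
      covered x zero e = ∈-++⁺ˡ (lower-zero x e)
      covered x (suc s) e = ∈-++⁺ʳ U (proj₁ (in-R (lower x e)))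

    -- Average degree at least `D` once `U` is contracted to a single vertex: the contracted graph
    -- has `suc (length R)` vertices, and the right-hand side is its degree sum.
    Dense : ℕ → List (Fin n) → List (Fin n) → Set
    Dense D U R = D * suc (length R) ≤ degrees R + 2 * length (boundary U R)

    -- Contracting a boundary vertex v of U into U loses 1 + deg_N(v) edges, N the boundary of U.
    loss : ∀ U as v bs → let N = boundary U (as ++ v ∷ bs) in
      length N + deg (as ++ bs) v ≤ suc (length (boundary (v ∷ U) (as ++ bs)) + deg N v)
    loss U as v bs = begin
      length N + deg R' v ≡⟨ cong (_+ deg R' v) (trans (length-filter≡∑ (touches? U) R) (∑-++-∷ as _)) ⟩
      ⟦ touches? U v ⟧ + ∑ R' (λ y → ⟦ touches? U y ⟧) + deg R' v ≤⟨ +-monoˡ-≤ (deg R' v) (+-monoˡ-≤ _ (⟦⟧≤1 (touches? U v))) ⟩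
      suc (∑ R' (λ y → ⟦ touches? U y ⟧) + deg R' v) ≡⟨ cong suc (∑-+ R' _ _) ⟨
      suc (∑ R' (λ y → ⟦ touches? U y ⟧ + ⟦ A? v y ⟧)) ≤⟨ s≤s (∑-mono R' (λ {y} _ → pointwise y)) ⟩
      suc (∑ R' (λ y → ⟦ touches? (v ∷ U) y ⟧ + inN y)) ≡⟨ cong suc (∑-+ R' _ _) ⟩
      suc (∑ R' (λ y → ⟦ touches? (v ∷ U) y ⟧) + ∑ R' inN) ≤⟨ s≤s (+-mono-≤ (≤-reflexive (≡.sym (length-filter≡∑ (touches? (v ∷ U)) R'))) inN≤) ⟩
      suc (length (boundary (v ∷ U) R') + deg N v) ∎
      where
      open ≤-Reasoning
      R R' N : List (Fin n)
      R = as ++ v ∷ bs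
      R' = as ++ bs
      N = boundary U R
      inN : Fin n → ℕ
      inN y = ⟦ touches? U y ⟧ * ⟦ A? v y ⟧
      ⟦⟧≤1 : ∀ {P : Set} (d : Dec P) → ⟦ d ⟧ ≤ 1
      ⟦⟧≤1 (yes _) = ≤-refl
      ⟦⟧≤1 (no _) = z≤n
      pointwise : ∀ y → ⟦ touches? U y ⟧ + ⟦ A? v y ⟧ ≤ ⟦ touches? (v ∷ U) y ⟧ + inN y
      pointwise y with A? v y | touches? U y
      ... | yes _ | yes _ = ≤-refl
      ... | yes _ | no _ = ≤-refl
      ... | no _ | yes _ = ≤-refl
      ... | no _ | no _ = ≤-refl
      filter-∑ : ∀ xs → ∑ xs inN ≡ ∑ (filter (touches? U) xs) (λ y → ⟦ A? v y ⟧)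
      filter-∑ [] = refl
      filter-∑ (x ∷ xs) with touches? U x
      ... | yes _ = cong₂ _+_ (+-identityʳ _) (filter-∑ xs)
      ... | no _ = filter-∑ xs
      inN≤ : ∑ R' inN ≤ deg N v
      inN≤ = ≤-trans (m≤n+m _ (inN v)) (≤-reflexive (trans (≡.sym (∑-++-∷ as inN)) (filter-∑ R)))

    -- Moving `v` into `U` removes one vertex, worth `2 * D`, and by `loss` at most
    -- `2 * suc (deg N v)` from the degree sum, for `N` the boundary. If density breaks, the second
    -- quantity exceeds the first.
    boundary-degree : ∀ D U as v bs → let R = as ++ v ∷ bs in Dense (2 * D) U R → ¬ Dense (2 * D) (v ∷ U) (as ++ bs) →
      D ≤ deg (boundary U R) v
    boundary-degree D U as v bs dense ¬dense = s≤s⁻¹ (*-cancelˡ-< 2 _ _ (+-cancelˡ-≤ X _ _ (begin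
      X + suc (2 * D) ≡⟨ lem₀ (2 * D) (suc (length R')) ⟩
      suc (2 * D * suc (suc (length R'))) ≡⟨ cong (λ k → suc (2 * D * suc k)) (length-++-∷ as) ⟨
      suc (2 * D * suc (length R)) ≤⟨ s≤s dense ⟩
      suc (degrees R + 2 * length N) ≡⟨ cong (λ k → suc (k + 2 * length N)) (degrees-remove as v bs) ⟩
      suc (degrees R' + 2 * deg R' v + 2 * length N) ≡⟨ cong suc (lem₁ (degrees R') (deg R' v) (length N)) ⟩
      suc (degrees R' + 2 * (length N + deg R' v)) ≤⟨ s≤s (+-monoʳ-≤ (degrees R') (*-monoʳ-≤ 2 (loss U as v bs))) ⟩
      suc (degrees R' + 2 * suc (length N' + deg N v)) ≡⟨ cong suc (lem₂ 1 (degrees R') (length N') (deg N v)) ⟩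
      suc (degrees R' + 2 * length N') + 2 * suc (deg N v) ≤⟨ +-monoˡ-≤ _ (≰⇒> ¬dense) ⟩
      X + 2 * suc (deg N v) ∎)))
      where
      open ≤-Reasoning
      R R' N N' : List (Fin n)
      R = as ++ v ∷ bs
      R' = as ++ bs
      N = boundary U R
      N' = boundary (v ∷ U) R'
      X : ℕ
      X = 2 * D * suc (length R')
      lem₀ : ∀ a b → a * b + suc a ≡ suc (a * suc b)
      lem₀ a b = trans (+-suc (a * b) a) (cong suc (trans (+-comm (a * b) a) (≡.sym (*-suc a b))))
      lem₁ : ∀ a b c → a + 2 * b + 2 * c ≡ a + 2 * (c + b)
      lem₁ = solve-∀
      lem₂ : ∀ e a b c → a + 2 * (e + (b + c)) ≡ a + 2 * b + 2 * (e + c)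
      lem₂ = solve-∀

    KModel-⊆ : ∀ {r R R'} → R ⊆ R' → KModel r R → KModel r R'
    KModel-⊆ s (M , inside) = M , s ∘ inside

    Step : ℕ → Set
    Step r = ∀ {R} → Unique R → R ≢ [] → 2 ^ r * length R ≤ degrees R → KModel r R

    dense-start : ∀ D x R → D * length (x ∷ R) ≤ degrees (x ∷ R) → Dense D [ x ] R
    dense-start D x R h = begin
      D * suc (length R) ≤⟨ h ⟩
      degrees (x ∷ R) ≡⟨ degrees-remove [] x R ⟩
      degrees R + 2 * deg R x ≡⟨ cong (λ k → degrees R + 2 * k) (trans (≡.sym (length-filter≡∑ (A? x) R)) (same R)) ⟩
      degrees R + 2 * length (boundary [ x ] R) ∎
      where
      open ≤-Reasoning
      same : ∀ R → length (filter (A? x) R) ≡ length (boundary [ x ] R)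
      same [] = refl
      same (y ∷ R) with A? x y
      ... | yes _ = cong suc (same R)
      ... | no _ = same R

    Growth : ℕ → List (Fin n) → List (Fin n) → Set
    Growth D U R = ∃ λ v → ∃₂ λ as bs → R ≡ as ++ v ∷ bs × v ∈ boundary U R × Dense (2 * D) (v ∷ U) (as ++ bs)

    scan : ∀ D U R → Dense (2 * D) U R → ∀ vs → vs ⊆ boundary U R →
      Growth D U R ⊎ (∀ {v} → v ∈ vs → D ≤ deg (boundary U R) v)
    scan D U R dense [] sub = inj₂ λ ()
    scan D U R dense (v ∷ vs) sub with ∈-∃++ (proj₁ (∈-filter⁻ (touches? U) {xs = R} (sub (here refl))))
    ... | as , bs , refl with 2 * D * suc (length (as ++ bs)) ≤? degrees (as ++ bs) + 2 * length (boundary (v ∷ U) (as ++ bs))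
    ... | yes p = inj₁ (v , as , bs , refl , sub (here refl) , p)
    ... | no ¬p with scan D U (as ++ v ∷ bs) dense vs (sub ∘ there)
    ... | inj₁ g = inj₁ g
    ... | inj₂ h = inj₂ λ { (here refl) → boundary-degree D U as v bs dense ¬p ; (there q) → h q }

    mutual
      search : ∀ {r} → Step r → ∀ fuel R → length R ≤ fuel → Unique R → R ≢ [] →
        2 ^ suc r * length R ≤ degrees R → KModel (suc r) R
      search step _ [] l u ne h = ⊥-elim (ne refl)
      search {r} step (suc fuel) (x ∷ R) (s≤s l) (x∉ ∷ u) ne h =
        KModel-⊆ (λ p → p)
          (grow step fuel [ x ] R (singleton x) l u (λ { (here refl) q → All.lookup x∉ q refl }) (dense-start (2 ^ suc r) x R h))

      -- `U` absorbs boundary vertices as long as density survives. When no absorption keeps it, the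
      -- boundary has minimum degree at least `2 ^ r`, so it carries a complete model on `r`
      -- vertices, and `U` is the missing branch set. If the boundary is empty, `U` contributes
      -- nothing to the degree sum and the search restarts in `R`.
      grow : ∀ {r} → Step r → ∀ fuel U R → Connected U → length R ≤ fuel → Unique R → (∀ {x} → x ∈ U → x ∉ R) →
        Dense (2 ^ suc r) U R → KModel (suc r) (U ++ R)
      grow {r} step fuel U R c l u disjoint dense with empty? (boundary U R)
      ... | yes eq = KModel-⊆ (∈-++⁺ʳ U) (search step fuel R l u nonempty (≤-trans (*-monoʳ-≤ (2 ^ suc r) (n≤1+n _)) dense'))
        where
        dense' : 2 ^ suc r * suc (length R) ≤ degrees R
        dense' = subst (λ k → 2 ^ suc r * suc (length R) ≤ k) (+-identityʳ (degrees R))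
          (subst (λ N → 2 ^ suc r * suc (length R) ≤ degrees R + 2 * length N) eq dense)
        nonempty : R ≢ []
        nonempty refl = <⇒≱ (≤-trans (m^n>0 2 (suc r)) (≤-reflexive (≡.sym (*-identityʳ _)))) dense'
      ... | no ne with scan (2 ^ r) U R dense (boundary U R) (λ p → p)
      ... | inj₂ h = extend c disjoint (step (filter⁺ (touches? U) u) ne
                       (≤-trans (≤-reflexive (trans (*-comm (2 ^ r) _) (≡.sym (∑-const (boundary U R) (2 ^ r))))) (∑-mono (boundary U R) h)))
      grow {r} step zero U R c l u disjoint dense | no ne | inj₁ (v , as , bs , refl , v∈ , d) =
        ⊥-elim (<⇒≱ (s≤s (z≤n {length (as ++ bs)})) (≤-trans (≤-reflexive (≡.sym (length-++-∷ as))) l))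
      grow {r} step (suc fuel) U R c l u disjoint dense | no ne | inj₁ (v , as , bs , refl , v∈ , d) =
        KModel-⊆ widen (grow step fuel (v ∷ U) (as ++ bs) (attach c (proj₁ (proj₂ touch)) (proj₂ (proj₂ touch)))
          (s≤s⁻¹ (≤-trans (≤-reflexive (≡.sym (length-++-∷ as))) l)) (unique-++-remove as u) disjoint' d)
        where
        touch : ∃ λ x → x ∈ U × A x v
        touch = find (proj₂ (∈-filter⁻ (touches? U) {xs = as ++ v ∷ bs} v∈))
        back : ∀ {x} → x ∈ as ++ bs → x ∈ as ++ v ∷ bs
        back p with ∈-++⁻ as p
        ... | inj₁ q = ∈-++⁺ˡ q
        ... | inj₂ q = ∈-++⁺ʳ as (there q)
        disjoint' : ∀ {x} → x ∈ v ∷ U → x ∉ as ++ bs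
        disjoint' (here refl) q = unique-++-∉ as u q
        disjoint' (there p) q = disjoint p (back q)
        widen : ∀ {x} → x ∈ (v ∷ U) ++ (as ++ bs) → x ∈ U ++ (as ++ v ∷ bs)
        widen (here refl) = ∈-++⁺ʳ U (∈-++⁺ʳ as (here refl))
        widen (there p) with ∈-++⁻ U p
        ... | inj₁ q = ∈-++⁺ˡ q
        ... | inj₂ q = ∈-++⁺ʳ U (back q)

    mader : ∀ r → Step r
    mader zero u ne h = record
      { branch = λ _ → nothing ; root = λ () ; root-branch = λ () ; connected = λ () ; link = λ {s} → ⊥-elim (Fin0 s) } , λ ()
      where Fin0 : Fin 0 → ⊥
            Fin0 ()
    mader (suc r) {R} u ne h = search (mader r) (length R) R ≤-refl u ne h

-- Sparsity of topological minors.

module Subdivisions where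

  open import Data.Nat
  open import Data.Nat.Properties
  open Counting
  open Minors
  open Density

  -- The list holds the inner vertices, without the endpoints.
  data Walk {V : Set} (A : V → V → Set) (x : V) : List V → V → Set where
    step : ∀ {z} → A x z → Walk A x [] z
    cons : ∀ {y ys z} → A x y → Walk A y ys z → Walk A x (y ∷ ys) z

  module _ {V : Set} {A : V → V → Set} where

    Walk-++ : ∀ {x ys y zs z} → Walk A x ys y → Walk A y zs z → Walk A x (ys ++ y ∷ zs) z
    Walk-++ (step a) w = cons a w
    Walk-++ (cons a v) w = cons a (Walk-++ v w)

    Walk-reverse : (∀ {x y} → A x y → A y x) → ∀ {x ys z} → Walk A x ys z →
      ∃ λ ys' → Walk A z ys' x × ys' ⊆ ys
    Walk-reverse s (step a) = [] , step (s a) , λ p → p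
    Walk-reverse s (cons {y} {ys} a w) with Walk-reverse s w
    ... | ys' , w' , sub = ys' ++ [ y ] , Walk-++ w' (step (s a)) , λ p → widen (∈-++⁻ ys' p)
      where
      open import Data.List.Membership.Propositional.Properties using (∈-++⁻)
      widen : ∀ {u} → u ∈ ys' ⊎ u ∈ [ y ] → u ∈ y ∷ ys
      widen (inj₁ p) = there (sub p)
      widen (inj₂ (here e)) = here e

    Walk-last : ∀ {x ys z} → Walk A x ys z → ∃ λ y → (y ≡ x ⊎ y ∈ ys) × A y z
    Walk-last (step a) = _ , inj₁ refl , a
    Walk-last (cons a w) with Walk-last w
    ... | y , inj₁ refl , b = y , inj₂ (here refl) , b
    ... | y , inj₂ p , b = y , inj₂ (there p) , b

  Walk-map : ∀ {V V' : Set} {A : V → V → Set} {A' : V' → V' → Set} (f : V → V') →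
    (∀ {x y} → A x y → A' (f x) (f y)) → ∀ {x ys z} → Walk A x ys z → Walk A' (f x) (map f ys) (f z)
  Walk-map f h (step a) = step (h a)
  Walk-map f h (cons a w) = cons (h a) (Walk-map f h w)

  -- The graph with edge list E on W, subdivided in G with inner vertices int e.
  module Topological {l} (L : Graph l) {n} (G : Graph n) (free : MinorFree L G)
    {W : Fin n → Set} (W? : Decidable W) (E : List (Fin n × Fin n)) (E-unique : Unique E)
    (int : Fin n × Fin n → List (Fin n))
    (ends : ∀ {e} → e ∈ E → W (proj₁ e) × W (proj₂ e) × proj₁ e ≢ proj₂ e)
    (walk : ∀ {e} → e ∈ E → Walk (Adj G) (proj₁ e) (int e) (proj₂ e))
    (outside : ∀ {e y} → e ∈ E → y ∈ int e → ¬ W y)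
    (disjoint : ∀ {e e' y} → e ∈ E → e' ∈ E → y ∈ int e → y ∈ int e' → e ≡ e') where

    open import Data.List.Membership.DecPropositional (≡-dec (Fin._≟_ {n}) (Fin._≟_ {n})) using (_∈?_)
    open import Data.List.Membership.DecPropositional (Fin._≟_ {n}) using () renaming (_∈?_ to _∈ᵛ?_)

    A : Fin n → Fin n → Set
    A x y = (x , y) ∈ E ⊎ (y , x) ∈ E

    A? : ∀ x y → Dec (A x y)
    A? x y = ((x , y) ∈? E) ⊎-dec ((y , x) ∈? E)

    A-sym : ∀ {x y} → A x y → A y x
    A-sym (inj₁ p) = inj₂ p
    A-sym (inj₂ p) = inj₁ p

    A-irrefl : ∀ {x} → ¬ A x x
    A-irrefl (inj₁ p) = proj₂ (proj₂ (ends p)) refl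
    A-irrefl (inj₂ p) = proj₂ (proj₂ (ends p)) refl

    open Mader A A? A-sym A-irrefl

    R : List (Fin n)
    R = filter W? (allFin n)

    ∈R : ∀ {x} → W x → x ∈ R
    ∈R w = ∈-filter⁺ W? (∈-allFin _) w

    size≤degrees : length E ≤ degrees R
    size≤degrees = begin
      length E ≤⟨ length-⊆ E-unique (λ p → ∈-filter⁺ A₂? (∈-cartesianProduct⁺ (∈R (proj₁ (ends p))) (∈R (proj₁ (proj₂ (ends p))))) (inj₁ p)) ⟩
      length (filter A₂? (cartesianProduct R R)) ≡⟨ length-filter≡∑ A₂? (cartesianProduct R R) ⟩
      ∑ (cartesianProduct R R) (λ e → ⟦ A₂? e ⟧) ≡⟨ ∑-cartesianProduct R R _ ⟩
      degrees R ∎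
      where open ≤-Reasoning
            A₂? : Decidable (λ e → A (proj₁ e) (proj₂ e))
            A₂? e = A? (proj₁ e) (proj₂ e)

    module Lift (K : KModel l R) where
      open Model (proj₁ K)

      in-W : ∀ {x s} → branch x ≡ just s → W x
      in-W e = proj₂ (∈-filter⁻ W? {xs = allFin n} (proj₂ K e))

      -- All inner vertices of a subdivided edge follow its first end. The last of them, or the
      -- first end itself if there are none, is then adjacent to the second end, so links of the
      -- complete model become edges of `G`.
      branch' : Fin n → Maybe (Fin l)
      branch' y with W? y
      ... | yes _ = branch y
      ... | no _ with Any.any? (λ e → y ∈ᵛ? int e) E
      ... | yes p = branch (proj₁ (proj₁ (find p)))
      ... | no _ = nothing

      branch'-W : ∀ {x s} → branch x ≡ just s → branch' x ≡ just s
      branch'-W {x} e with W? x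
      ... | yes _ = e
      ... | no ¬w = ⊥-elim (¬w (in-W e))

      branch'-int : ∀ {e y} → e ∈ E → y ∈ int e → branch' y ≡ branch (proj₁ e)
      branch'-int {e} {y} e∈ y∈ with W? y
      ... | yes w = ⊥-elim (outside e∈ y∈ w)
      ... | no _ with Any.any? (λ e → y ∈ᵛ? int e) E
      ... | no ¬p = ⊥-elim (¬p (lose e∈ y∈))
        where open import Data.List.Membership.Propositional using (lose)
      ... | yes p with find p
      ... | e' , e'∈ , y∈' = cong (branch ∘ proj₁) (disjoint e'∈ e∈ y∈' y∈)

      origin : ∀ y {s} → branch' y ≡ just s → branch y ≡ just s ⊎ ∃ λ e → e ∈ E × y ∈ int e × branch (proj₁ e) ≡ just s
      origin y h with W? y
      ... | yes _ = inj₁ h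
      ... | no _ with Any.any? (λ e → y ∈ᵛ? int e) E
      origin y () | no _ | no _
      ... | yes p with find p
      ... | e , e∈ , y∈ = inj₂ (e , e∈ , y∈ , h)

      P : Fin l → Fin n → Fin n → Set
      P = Path (Adj G) branch'

      follow : ∀ {s r x ys z} → P s r x → Walk (Adj G) x ys z → (∀ {y} → y ∈ ys → branch' y ≡ just s) →
        branch' z ≡ just s → P s r z
      follow p (step a) h e = snoc p a e
      follow p (cons a w) h e = follow (snoc p a (h (here refl))) w (h ∘ there) e

      follow-into : ∀ {s r x ys z} → P s r x → Walk (Adj G) x ys z → (∀ {y} → y ∈ ys → branch' y ≡ just s) →
        ∀ {y} → y ∈ ys → P s r y
      follow-into p (cons a w) h (here refl) = snoc p a (h (here refl))
      follow-into p (cons a w) h (there q) = follow-into (snoc p a (h (here refl))) w (h ∘ there) q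

      lift : ∀ {s r x} → branch r ≡ just s → Path A branch s r x → P s r x
      lift e ε = ε
      lift {s} e (snoc {y} {z} p (inj₁ q) h) =
        follow (lift e p) (walk q) (λ y∈ → trans (branch'-int q y∈) (Path-end e p)) (branch'-W h)
      lift {s} e (snoc {y} {z} p (inj₂ q) h) with Walk-reverse (Adj-sym G) (walk q)
      -- Walking backwards, the new vertex `z` is the first end, so the inner vertices already have
      -- its branch, which is `s` again.
      ... | ys' , w , sub = follow (lift e p) w (λ y∈ → trans (branch'-int q (sub y∈)) h) (branch'-W h)

      connected' : ∀ {y s} → branch' y ≡ just s → P s (root s) y
      connected' {y} {s} h with origin y h
      ... | inj₁ e = lift (root-branch s) (connected e)
      ... | inj₂ (e , e∈ , y∈ , b) =
        follow-into (lift (root-branch s) (connected b)) (walk e∈) (λ z∈ → trans (branch'-int e∈ z∈) b) y∈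

      last-branch : ∀ {e s} → e ∈ E → branch (proj₁ e) ≡ just s → ∃ λ y → branch' y ≡ just s × Adj G y (proj₂ e)
      last-branch e∈ b with Walk-last (walk e∈)
      ... | y , inj₁ refl , a = y , branch'-W b , a
      ... | y , inj₂ p , a = y , trans (branch'-int e∈ p) b , a

      link' : ∀ {s t} → Adj L s t → ∃₂ λ x y → branch' x ≡ just s × branch' y ≡ just t × Adj G x y
      link' st with link (Adj-irrefl L st)
      ... | x , y , bx , by , inj₁ p = let (z , bz , a) = last-branch p bx in z , y , bz , branch'-W by , a
      ... | x , y , bx , by , inj₂ p = let (z , bz , a) = last-branch p by in x , z , branch'-W bx , bz , Adj-sym G a

      model : Model (Adj G) (Adj L)
      model = record { branch = branch' ; root = root ; root-branch = λ s → branch'-W (root-branch s)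
                     ; connected = connected' ; link = link' }

    -- Otherwise the graph with edges `E` on `W` has average degree above `2 ^ l`, hence by `mader`
    -- a complete model on `l` vertices. It lifts to `G` and contains in particular a model of `L`.
    sparse : length E ≤ 2 ^ l * length (filter W? (allFin n))
    sparse with length E ≤? 2 ^ l * length R
    ... | yes p = p
    ... | no ¬p = ⊥-elim (free (model⇒minor L G (Lift.model (mader l (filter⁺ W? (allFin⁺ n)) nonempty
                    (≤-trans (<⇒≤ (≰⇒> ¬p)) size≤degrees)))))
      where
      some : ∀ (xs : List (Fin n × Fin n)) → 0 < length xs → ∃ λ e → e ∈ xs
      some (e ∷ _) _ = e , here refl
      nonempty : R ≢ []
      nonempty eq with some E (≤-trans (s≤s z≤n) (≰⇒> ¬p))
      ... | e , e∈ = ∉[] (subst (proj₁ e ∈_) eq (∈R (proj₁ (ends e∈))))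

-- Rational averages.

module Averages where

  open import Data.Integer as ℤ using (+_)
  import Data.Integer.Properties as ℤ
  open import Data.Rational
  open import Data.Rational.Properties
  import Data.Rational.Unnormalised as ℚᵘ
  import Data.Rational.Unnormalised.Properties as ℚᵘ
  open import Data.Rational.Solver using (module +-*-Solver)

  ι : ℕ → ℚ
  ι n = + n / 1

  toℚᵘ-ι : ∀ n → toℚᵘ (ι n) ℚᵘ.≃ ℚᵘ.mkℚᵘ (+ n) 0
  toℚᵘ-ι n = toℚᵘ-fromℚᵘ (ℚᵘ.mkℚᵘ (+ n) 0)

  ι-+ : ∀ m n → ι (m ℕ.+ n) ≡ ι m + ι n
  ι-+ m n = toℚᵘ-injective (ℚᵘ.≃-trans (toℚᵘ-ι (m ℕ.+ n)) (ℚᵘ.≃-trans (ℚᵘ.*≡* eq)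
    (ℚᵘ.≃-sym (ℚᵘ.≃-trans (toℚᵘ-homo-+ (ι m) (ι n)) (ℚᵘ.+-cong (toℚᵘ-ι m) (toℚᵘ-ι n))))))
    where eq : + (m ℕ.+ n) ℤ.* + 1 ≡ (+ m ℤ.* + 1 ℤ.+ + n ℤ.* + 1) ℤ.* + 1
          eq = cong (ℤ._* + 1) (cong₂ ℤ._+_ (≡.sym (ℤ.*-identityʳ (+ m))) (≡.sym (ℤ.*-identityʳ (+ n))))

  ι-* : ∀ m n → ι (m ℕ.* n) ≡ ι m * ι n
  ι-* m n = toℚᵘ-injective (ℚᵘ.≃-trans (toℚᵘ-ι (m ℕ.* n)) (ℚᵘ.≃-trans (ℚᵘ.*≡* eq)
    (ℚᵘ.≃-sym (ℚᵘ.≃-trans (toℚᵘ-homo-* (ι m) (ι n)) (ℚᵘ.*-cong (toℚᵘ-ι m) (toℚᵘ-ι n))))))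
    where eq : + (m ℕ.* n) ℤ.* + 1 ≡ (+ m ℤ.* + n) ℤ.* + 1
          eq = cong (ℤ._* + 1) (ℤ.pos-* m n)

  ι-mono : ∀ {m n} → m ℕ.≤ n → ι m ≤ ι n
  ι-mono {m} {n} h = toℚᵘ-cancel-≤ (ℚᵘ.≤-respˡ-≃ (ℚᵘ.≃-sym (toℚᵘ-ι m)) (ℚᵘ.≤-respʳ-≃ (ℚᵘ.≃-sym (toℚᵘ-ι n))
    (ℚᵘ.*≤* (ℤ.*-monoʳ-≤-nonNeg (+ 1) (ℤ.+≤+ h)))))

  ι-mono-< : ∀ {m n} → m ℕ.< n → ι m < ι n
  ι-mono-< {m} {n} h = toℚᵘ-cancel-< (ℚᵘ.<-respˡ-≃ (ℚᵘ.≃-sym (toℚᵘ-ι m)) (ℚᵘ.<-respʳ-≃ (ℚᵘ.≃-sym (toℚᵘ-ι n))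
    (ℚᵘ.*<* (ℤ.*-monoʳ-<-pos (+ 1) (ℤ.+<+ h)))))

  ι-cancel-< : ∀ {m n} → ι m < ι n → m ℕ.< n
  ι-cancel-< {m} {n} h with m ℕ.<? n
  ... | yes p = p
  ... | no ¬p = ⊥-elim (<-irrefl refl (<-≤-trans h (ι-mono (ℕ.≮⇒≥ ¬p))))

  ι-nonNeg : ∀ n → NonNegative (ι n)
  ι-nonNeg n = nonNegative (ι-mono (ℕ.z≤n {n}))

  ι-pos : ∀ n → Positive (ι (suc n))
  ι-pos n = positive (ι-mono-< (ℕ.s≤s (ℕ.z≤n {n})))

  /-*-ι : ∀ k d → (+ k / suc d) * ι (suc d) ≡ ι k
  /-*-ι k d = toℚᵘ-injective (ℚᵘ.≃-trans (toℚᵘ-homo-* (+ k / suc d) (ι (suc d)))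
    (ℚᵘ.≃-trans (ℚᵘ.*-cong (toℚᵘ-fromℚᵘ (ℚᵘ.mkℚᵘ (+ k) d)) (toℚᵘ-ι (suc d))) (ℚᵘ.≃-trans (ℚᵘ.*≡* eq) (ℚᵘ.≃-sym (toℚᵘ-ι k)))))
    where eq : (+ k ℤ.* + suc d) ℤ.* + 1 ≡ + k ℤ.* + (suc d ℕ.* 1)
          eq = trans (ℤ.*-identityʳ _) (cong (λ z → + k ℤ.* + z) (≡.sym (ℕ.*-identityʳ (suc d))))

  sumℚ : List ℚ → ℚ
  sumℚ = foldr _+_ 0ℚ

  avg-scale : ∀ x xs → ι (length (x ∷ xs)) * avg (x ∷ xs) ≡ sumℚ (x ∷ xs)
  avg-scale x xs = trans (lemma (ι (suc (length xs))) (sumℚ (x ∷ xs)) (+ 1 / suc (length xs)))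
    (trans (cong (sumℚ (x ∷ xs) *_) (/-*-ι 1 (length xs))) (*-identityʳ _))
    where lemma : ∀ a b c → a * (b * c) ≡ b * (c * a)
          lemma = solve 3 (λ a b c → a :* (b :* c) := b :* (c :* a)) refl
            where open +-*-Solver

  private variable A : Set

  sumℚ-mono : ∀ (ys : List A) {F F' : A → ℚ} → (∀ {y} → y ∈ ys → F y ≤ F' y) → sumℚ (map F ys) ≤ sumℚ (map F' ys)
  sumℚ-mono [] h = ≤-refl
  sumℚ-mono (y ∷ ys) h = +-mono-≤ (h (here refl)) (sumℚ-mono ys (h ∘ there))

  avg-cancel : ∀ {a b : ℚ} k → ι (suc k) * a ≤ ι (suc k) * b → a ≤ b
  avg-cancel k = *-cancelˡ-≤-pos (ι (suc k)) {{ι-pos k}}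

  avg-map-scale : ∀ y (ys : List A) (F : A → ℚ) → ι (suc (length ys)) * avg (map F (y ∷ ys)) ≡ sumℚ (map F (y ∷ ys))
  avg-map-scale y ys F = subst (λ k → ι (suc k) * avg (map F (y ∷ ys)) ≡ sumℚ (map F (y ∷ ys))) (length-map F ys) (avg-scale (F y) (map F ys))

  avg-mono : ∀ (ys : List A) {F F' : A → ℚ} → (∀ {y} → y ∈ ys → F y ≤ F' y) → avg (map F ys) ≤ avg (map F' ys)
  avg-mono [] h = ≤-refl
  avg-mono (y ∷ ys) {F} {F'} h = avg-cancel (length ys) (begin
    ι (suc (length ys)) * avg (map F (y ∷ ys)) ≡⟨ avg-map-scale y ys F ⟩
    sumℚ (map F (y ∷ ys)) ≤⟨ sumℚ-mono (y ∷ ys) h ⟩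
    sumℚ (map F' (y ∷ ys)) ≡⟨ avg-map-scale y ys F' ⟨
    ι (suc (length ys)) * avg (map F' (y ∷ ys)) ∎)
    where open ≤-Reasoning

  sumℚ-const : ∀ (ys : List A) q → sumℚ (map (λ _ → q) ys) ≡ ι (length ys) * q
  sumℚ-const [] q = ≡.sym (*-zeroˡ q)
  sumℚ-const (y ∷ ys) q = trans (cong (λ z → q + z) (sumℚ-const ys q))
    (≡.sym (trans (cong (_* q) (ι-+ 1 (length ys))) (trans (*-distribʳ-+ q (ι 1) (ι (length ys))) (cong (_+ ι (length ys) * q) (*-identityˡ q)))))

  avg-const : ∀ (ys : List A) q → ys ≢ [] → avg (map (λ _ → q) ys) ≡ q
  avg-const [] q ne = ⊥-elim (ne refl)
  avg-const (y ∷ ys) q ne = ≤-antisym (avg-cancel (length ys) (≤-reflexive eq)) (avg-cancel (length ys) (≤-reflexive (≡.sym eq)))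
    where
    eq : ι (suc (length ys)) * avg (map (λ _ → q) (y ∷ ys)) ≡ ι (suc (length ys)) * q
    eq = trans (avg-map-scale y ys (λ _ → q)) (sumℚ-const (y ∷ ys) q)

  avg-≥ : ∀ (ys : List A) {F : A → ℚ} {q} → ys ≢ [] → (∀ {y} → y ∈ ys → q ≤ F y) → q ≤ avg (map F ys)
  avg-≥ ys {F} {q} ne h = subst (_≤ avg (map F ys)) (avg-const ys q ne) (avg-mono ys h)

  avg-≤ : ∀ (ys : List A) {F : A → ℚ} {q} → 0ℚ ≤ q → (∀ {y} → y ∈ ys → F y ≤ q) → avg (map F ys) ≤ q
  avg-≤ [] 0≤q h = 0≤q
  avg-≤ (y ∷ ys) {F} {q} 0≤q h = subst (avg (map F (y ∷ ys)) ≤_) (avg-const (y ∷ ys) q λ ()) (avg-mono (y ∷ ys) h)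

  module _ {a g c : ℚ} (0≤g : 0ℚ ≤ g) {P : A → Set} (P? : Decidable P) {F : A → ℚ} where
    open ≤-Reasoning

    sumℚ-lower : ∀ ys → (∀ {y} → y ∈ ys → a ≤ c * F y) → (∀ {y} → y ∈ ys → P y → a + g ≤ c * F y) →
      ι (length ys) * a + ι (length (filter P? ys)) * g ≤ c * sumℚ (map F ys)
    sumℚ-lower [] low high = ≤-reflexive (trans (cong₂ _+_ (*-zeroˡ a) (*-zeroˡ g)) (≡.sym (*-zeroʳ c)))
    sumℚ-lower (y ∷ ys) low high with P? y
    ... | yes p = begin
      ι (suc k) * a + ι (suc j) * g ≡⟨ cong₂ (λ u v → u * a + v * g) (ι-+ 1 k) (ι-+ 1 j) ⟩
      (1ℚ + ι k) * a + (1ℚ + ι j) * g ≡⟨ lemma a g (ι k) (ι j) ⟩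
      (a + g) + (ι k * a + ι j * g) ≤⟨ +-mono-≤ (high (here refl) p) (sumℚ-lower ys (low ∘ there) (high ∘ there)) ⟩
      c * F y + c * sumℚ (map F ys) ≡⟨ *-distribˡ-+ c _ _ ⟨
      c * (F y + sumℚ (map F ys)) ∎
      where
      k = length ys
      j = length (filter P? ys)
      lemma : ∀ a g u v → (1ℚ + u) * a + (1ℚ + v) * g ≡ (a + g) + (u * a + v * g)
      lemma = solve 4 (λ a g u v → (con 1ℚ :+ u) :* a :+ (con 1ℚ :+ v) :* g := (a :+ g) :+ (u :* a :+ v :* g)) refl
        where open +-*-Solver
    ... | no _ = begin
      ι (suc k) * a + ι j * g ≡⟨ cong (λ u → u * a + ι j * g) (ι-+ 1 k) ⟩
      (1ℚ + ι k) * a + ι j * g ≡⟨ lemma a g (ι k) (ι j) ⟩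
      a + (ι k * a + ι j * g) ≤⟨ +-mono-≤ (low (here refl)) (sumℚ-lower ys (low ∘ there) (high ∘ there)) ⟩
      c * F y + c * sumℚ (map F ys) ≡⟨ *-distribˡ-+ c _ _ ⟨
      c * (F y + sumℚ (map F ys)) ∎
      where
      k = length ys
      j = length (filter P? ys)
      lemma : ∀ a g u v → (1ℚ + u) * a + v * g ≡ a + (u * a + v * g)
      lemma = solve 4 (λ a g u v → (con 1ℚ :+ u) :* a :+ v :* g := a :+ (u :* a :+ v :* g)) refl
        where open +-*-Solver

    -- A fraction of at least `1 / A₀` of the terms beats the common bound `a` by `g`. Multiplying
    -- through by `ι A₀` and `c` avoids every division.
    avg-lower : ∀ ys A₀ → ys ≢ [] → (∀ {y} → y ∈ ys → a ≤ c * F y) → (∀ {y} → y ∈ ys → P y → a + g ≤ c * F y) →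
      length ys ℕ.≤ A₀ ℕ.* length (filter P? ys) → ι A₀ * a + g ≤ (ι A₀ * c) * avg (map F ys)
    avg-lower [] A₀ ne low high len = ⊥-elim (ne refl)
    avg-lower (y ∷ ys) A₀ ne low high len = avg-cancel (length ys) (begin
      ℓ * (ι A₀ * a + g) ≡⟨ lem₁ ℓ (ι A₀) a g ⟩
      ι A₀ * (ℓ * a) + ℓ * g ≤⟨ +-monoʳ-≤ (ι A₀ * (ℓ * a)) (*-monoʳ-≤-nonNeg g {{nonNegative 0≤g}} (ι-mono len)) ⟩
      ι A₀ * (ℓ * a) + ι (A₀ ℕ.* j) * g ≡⟨ cong (λ u → ι A₀ * (ℓ * a) + u * g) (ι-* A₀ j) ⟩
      ι A₀ * (ℓ * a) + ι A₀ * ι j * g ≡⟨ lem₂ (ι A₀) (ℓ * a) (ι j) g ⟩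
      ι A₀ * (ℓ * a + ι j * g) ≤⟨ *-monoˡ-≤-nonNeg (ι A₀) {{ι-nonNeg A₀}} (sumℚ-lower (y ∷ ys) low high) ⟩
      ι A₀ * (c * sumℚ (map F (y ∷ ys))) ≡⟨ cong (λ u → ι A₀ * (c * u)) (avg-map-scale y ys F) ⟨
      ι A₀ * (c * (ℓ * avg (map F (y ∷ ys)))) ≡⟨ lem₃ (ι A₀) c ℓ (avg (map F (y ∷ ys))) ⟩
      ℓ * ((ι A₀ * c) * avg (map F (y ∷ ys))) ∎)
      where
      ℓ = ι (suc (length ys))
      j = length (filter P? (y ∷ ys))
      open +-*-Solver
      lem₁ : ∀ l u a g → l * (u * a + g) ≡ u * (l * a) + l * g
      lem₁ = solve 4 (λ l u a g → l :* (u :* a :+ g) := u :* (l :* a) :+ l :* g) refl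
      lem₂ : ∀ u v w g → u * v + u * w * g ≡ u * (v + w * g)
      lem₂ = solve 4 (λ u v w g → u :* v :+ u :* w :* g := u :* (v :+ w :* g)) refl
      lem₃ : ∀ u c l v → u * (c * (l * v)) ≡ l * ((u * c) * v)
      lem₃ = solve 4 (λ u c l v → u :* (c :* (l :* v)) := l :* ((u :* c) :* v)) refl

-- The tester, its one-sided error and the calculus of success probabilities.

module Exploration where

  open import Data.Integer using (+_)
  open import Data.Rational
  open import Data.Rational.Properties
  open import Data.Rational.Solver using (module +-*-Solver)
  open import Data.Nat using (_^_)
  open Averages
  open Counting using (length-⊆; empty?; length-allFin; ∈⇒nonempty)

  degree : ∀ {n} → Graph n → Fin n → ℕ
  degree G x = length (nbrs G x)

  module _ {n} (G : Graph n) where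

    ∈-nbrs⁻ : ∀ {x y} → y ∈ nbrs G x → adj G x y ≡ true
    ∈-nbrs⁻ {x} {y} p = T⇒≡ (proj₂ (∈-filter⁻ (T? ∘ adj G x) {xs = allFin n} p))
      where T⇒≡ : ∀ {b} → T b → b ≡ true
            T⇒≡ {true} _ = refl

    ∈-nbrs⁺ : ∀ {x y} → adj G x y ≡ true → y ∈ nbrs G x
    ∈-nbrs⁺ {x} {y} e = ∈-filter⁺ (T? ∘ adj G x) (∈-allFin y) (subst T (≡.sym e) _)

  record State (n : ℕ) : Set where
    constructor _,_
    field
      visited : List (Fin n)
      seen    : List (Fin n × Fin n)
  open State public

  infix 4 _⊑_
  _⊑_ : ∀ {n} → State n → State n → Set
  st ⊑ st' = (∀ {x} → x ∈ visited st → x ∈ visited st') × (∀ {e} → e ∈ seen st → e ∈ seen st')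

  ⊑-refl : ∀ {n} {st : State n} → st ⊑ st
  ⊑-refl = (λ p → p) , (λ p → p)

  ⊑-trans : ∀ {n} {a b c : State n} → a ⊑ b → b ⊑ c → a ⊑ c
  ⊑-trans (p , q) (p' , q') = (λ x → p' (p x)) , (λ x → q' (q x))

  visit : ∀ {n} → Fin n → State n → State n
  visit y st = (y ∷ visited st) , seen st

  traverse : ∀ {n} → Fin n → Fin n → State n → State n
  traverse x y st = (y ∷ visited st) , ((x , y) ∷ seen st)

  Link : ∀ {n} → List (Fin n × Fin n) → Fin n → Fin n → Set
  Link es x y = (x , y) ∈ es ⊎ (y , x) ∈ es

  Occurs : AnyGraph → ∀ {n} → List (Fin n × Fin n) → Set
  Occurs (k , H) {n} es = Σ (Fin k → Fin n) λ f → (∀ a b → f a ≡ f b → a ≡ b) × (∀ a b → adj H a b ≡ true → Link es (f a) (f b))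

  occurs? : ∀ H {n} (es : List (Fin n × Fin n)) → Dec (Occurs H es)
  occurs? (k , H) {n} es = map′ (λ (i , p) → finToFun i , p) (λ (f , p , q) → funToFin f , transport f p q)
    (FinP.any? λ i → embedding? (finToFun i))
    where
    open import Data.List.Membership.DecPropositional (≡-dec (Fin._≟_ {n}) (Fin._≟_ {n})) using (_∈?_)
    Embedding : (Fin k → Fin n) → Set
    Embedding f = (∀ a b → f a ≡ f b → a ≡ b) × (∀ a b → adj H a b ≡ true → Link es (f a) (f b))
    embedding? : ∀ f → Dec (Embedding f)
    embedding? f = (FinP.all? λ a → FinP.all? λ b → (f a Fin.≟ f b) →-dec (a Fin.≟ b)) ×-dec
      (FinP.all? λ a → FinP.all? λ b → (adj H a b ≟ᵇ true) →-dec (((f a , f b) ∈? es) ⊎-dec ((f b , f a) ∈? es)))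
    transport : ∀ f → (∀ a b → f a ≡ f b → a ≡ b) → (∀ a b → adj H a b ≡ true → Link es (f a) (f b)) → Embedding (finToFun (funToFin f))
    transport f p q = (λ a b e → p a b (trans (≡.sym (same a)) (trans e (same b)))) ,
                      (λ a b h → subst₂ (Link es) (≡.sym (same a)) (≡.sym (same b)) (q a b h))
      where same = FinP.finToFun-funToFin f

  module Explorer (ℋ : List AnyGraph) where

    Found : ∀ {n} → State n → Set
    Found st = Any (λ H → Occurs H (seen st)) ℋ

    found? : ∀ {n} (st : State n) → Dec (Found st)
    found? st = Any.any? (λ H → occurs? H (seen st)) ℋ

    module _ {n : ℕ} where

      arrive : State n → (State n → Tester n) → Fin n → Maybe (Fin n) → Tester n
      arrive st next x nothing = next st
      arrive st next x (just y) = next (traverse x y st)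

      -- The coin flips give every visited vertex, and the choice of a fresh one, a positive probability.
      choose : State n → (State n → Tester n) → List (Fin n) → Tester n
      branch : State n → (State n → Tester n) → Fin n → List (Fin n) → Bool → Tester n
      choose st next [] = sample (λ y → next (visit y st))
      choose st next (x ∷ xs) = flip (branch st next x xs)

      branch st next x xs b = if b then query x (arrive st next x) else choose st next xs

      -- `cont` runs when the exploration ends without a find. It does not receive the state, which
      -- makes the repetitions independent.
      explore : ℕ → State n → Tester n → Tester n
      explore′ : ∀ r (st : State n) → Tester n → Dec (Found st) → Tester n
      explore r st cont = explore′ r st cont (found? st)
      explore′ r st cont (yes _) = reject
      explore′ zero st cont (no _) = cont
      explore′ (suc r) st cont (no _) = choose st (λ st' → explore r st' cont) (visited st)

      initial : State n
      initial = [] , []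

      repeat : ℕ → ℕ → Tester n
      repeat zero R = accept
      repeat (suc i) R = explore R initial (repeat i R)

      Queries≤-choose : ∀ {q} st next xs → (∀ st' → Queries≤ q (next st')) → Queries≤ (suc q) (choose st next xs)
      Queries≤-choose st next [] h = sample (λ y → h _)
      Queries≤-choose st next (x ∷ xs) h = flip λ
        { true → query λ { nothing → h _ ; (just y) → h _ }
        ; false → Queries≤-choose st next xs h }

      Queries≤-explore : ∀ {q} r st {cont} → Queries≤ q cont → Queries≤ (r ℕ.+ q) (explore r st cont)
      Queries≤-explore′ : ∀ {q} r st {cont} d → Queries≤ q cont → Queries≤ (r ℕ.+ q) (explore′ r st cont d)
      Queries≤-explore r st h = Queries≤-explore′ r st (found? st) h
      Queries≤-explore′ r st (yes _) h = reject
      Queries≤-explore′ zero st (no _) h = h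
      Queries≤-explore′ (suc r) st (no _) h = Queries≤-choose st _ (visited st) (λ st' → Queries≤-explore r st' h)

      Queries≤-repeat : ∀ i R → Queries≤ (i ℕ.* R) (repeat i R)
      Queries≤-repeat zero R = accept
      Queries≤-repeat (suc i) R = Queries≤-explore R initial (Queries≤-repeat i R)

    module _ {n} (G : Graph n) where

      Pr : Tester n → ℚ
      Pr = PrReject G

      Pr-query : ∀ x f → nbrs G x ≢ [] → Pr (query x f) ≡ avg (map (λ y → Pr (f (just y))) (nbrs G x))
      Pr-query x f ne with nbrs G x
      ... | [] = ⊥-elim (ne refl)
      ... | _ ∷ _ = refl

      Pr-query-isolated : ∀ x f → nbrs G x ≡ [] → Pr (query x f) ≡ Pr (f nothing)
      Pr-query-isolated x f e with nbrs G x
      Pr-query-isolated x f refl | [] = refl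

      Pr-≤1 : ∀ T → Pr T ≤ 1ℚ
      Pr-≤1 accept = nonNegative⁻¹ 1ℚ
      Pr-≤1 reject = ≤-refl
      Pr-≤1 (sample f) = avg-≤ (allFin n) (nonNegative⁻¹ 1ℚ) (λ {y} _ → Pr-≤1 (f y))
      Pr-≤1 (query x f) with empty? (nbrs G x)
      ... | yes e = ≤-respˡ (Pr-query-isolated x f e) (Pr-≤1 (f nothing))
        where ≤-respˡ : ∀ {a b c} → a ≡ b → b ≤ c → a ≤ c
              ≤-respˡ refl p = p
      ... | no ne = subst (_≤ 1ℚ) (≡.sym (Pr-query x f ne)) (avg-≤ (nbrs G x) (nonNegative⁻¹ 1ℚ) (λ {y} _ → Pr-≤1 (f (just y))))
      Pr-≤1 (flip f) = avg-≤ (false ∷ true ∷ []) {λ b → Pr (f b)} (nonNegative⁻¹ 1ℚ) (λ {b} _ → Pr-≤1 (f b))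

      -- One-sided error

      Sound : State n → Set
      Sound st = ∀ {x y} → (x , y) ∈ seen st → adj G x y ≡ true

      avg-zero : ∀ {A : Set} (ys : List A) {F : A → ℚ} → (∀ {y} → y ∈ ys → F y ≡ 0ℚ) → avg (map F ys) ≡ 0ℚ
      avg-zero [] h = refl
      avg-zero (y ∷ ys) h = ≤-antisym (avg-≤ (y ∷ ys) ≤-refl (λ p → ≤-reflexive (h p)))
                                      (avg-≥ (y ∷ ys) (λ ()) (λ p → ≤-reflexive (≡.sym (h p))))

      choose-zero : ∀ st next xs → Sound st → (∀ st' → Sound st' → Pr (next st') ≡ 0ℚ) → Pr (choose st next xs) ≡ 0ℚ
      query-zero : ∀ st next x → Sound st → (∀ st' → Sound st' → Pr (next st') ≡ 0ℚ) → Pr (query x (arrive st next x)) ≡ 0ℚ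
      query-zero st next x ok h with empty? (nbrs G x)
      ... | yes e = trans (Pr-query-isolated x _ e) (h _ ok)
      ... | no ne = trans (Pr-query x _ ne) (avg-zero (nbrs G x) (λ p → h _ λ { (here refl) → ∈-nbrs⁻ G p ; (there q) → ok q }))
      choose-zero st next [] ok h = avg-zero (allFin n) (λ _ → h _ ok)
      choose-zero st next (x ∷ xs) ok h =
        avg-zero (false ∷ true ∷ []) {Pr ∘ branch st next x xs}
          λ { {false} _ → choose-zero st next xs ok h ; {true} _ → query-zero st next x ok h }

      module _ (free : Free ℋ G) where

        not-found : ∀ st → Sound st → ¬ Found st
        not-found st ok p with find p
        ... | H , H∈ , f , inj , edge = free H H∈ (f , (λ {a} {b} → inj a b) , λ a b e → present (edge a b e))
          where present : ∀ {x y} → Link (seen st) x y → adj G x y ≡ true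
                present (inj₁ q) = ok q
                present {x} {y} (inj₂ q) = trans (sym G x y) (ok q)

        explore-zero : ∀ r st cont → Sound st → Pr cont ≡ 0ℚ → Pr (explore r st cont) ≡ 0ℚ
        explore′-zero : ∀ r st cont d → Sound st → Pr cont ≡ 0ℚ → Pr (explore′ r st cont d) ≡ 0ℚ
        explore-zero r st cont ok h = explore′-zero r st cont (found? st) ok h
        explore′-zero r st cont (yes p) ok h = ⊥-elim (not-found st ok p)
        explore′-zero zero st cont (no _) ok h = h
        explore′-zero (suc r) st cont (no _) ok h = choose-zero st _ (visited st) ok (λ st' ok' → explore-zero r st' cont ok' h)

        repeat-zero : ∀ i R → Pr (repeat i R) ≡ 0ℚ
        repeat-zero zero R = refl
        repeat-zero (suc i) R = explore-zero R initial (repeat i R) (λ ()) (repeat-zero i R)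

      -- Detection probability

      repeat-found : Found (initial {n}) → ∀ {i R} → Pr (repeat (suc i) R) ≡ 1ℚ
      repeat-found p {i} {R} = by-cases (found? initial)
        where by-cases : ∀ d → Pr (explore′ R initial (repeat i R) d) ≡ 1ℚ
              by-cases (yes _) = refl
              by-cases (no ¬p) = ⊥-elim (¬p p)

      -- 1 - P ≤ (1 - 1/m)(1 - q): a success of probability 1/m before continuing with probability q, without division.
      Gain : ℕ → ℚ → ℚ → Set
      Gain m q P = ι m * q + (1ℚ - q) ≤ ι m * P

      Gain-mono : ∀ {m m' q P} → q ≤ P → m ℕ.≤ m' → Gain m q P → Gain m' q P
      Gain-mono {m} {q = q} {P} q≤P l h with ℕ.m≤n⇒∃[o]m+o≡n l
      ... | d , refl = begin
        ι (m ℕ.+ d) * q + (1ℚ - q) ≡⟨ cong (λ z → z * q + (1ℚ - q)) (ι-+ m d) ⟩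
        (ι m + ι d) * q + (1ℚ - q) ≡⟨ lemma (ι m) (ι d) q (1ℚ - q) ⟩
        (ι m * q + (1ℚ - q)) + ι d * q ≤⟨ +-mono-≤ h (*-monoˡ-≤-nonNeg (ι d) {{ι-nonNeg d}} q≤P) ⟩
        ι m * P + ι d * P ≡⟨ *-distribʳ-+ P (ι m) (ι d) ⟨
        (ι m + ι d) * P ≡⟨ cong (_* P) (ι-+ m d) ⟨
        ι (m ℕ.+ d) * P ∎
        where
        open ≤-Reasoning
        open +-*-Solver
        lemma : ∀ u v q w → (u + v) * q + w ≡ (u * q + w) + v * q
        lemma = solve 4 (λ u v q w → (u :+ v) :* q :+ w := (u :* q :+ w) :+ v :* q) refl

      -- This is `avg-lower` with common bound `ι m * q` and surplus `1ℚ - q`: a random choice that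
      -- is good with probability at least `1 / A₀` multiplies the cost by `A₀`.
      Gain-avg : ∀ {A : Set} {P : A → Set} (P? : Decidable P) (ys : List A) {F : A → ℚ} {q} A₀ m → q ≤ 1ℚ → ys ≢ [] →
        (∀ {y} → y ∈ ys → q ≤ F y) → (∀ {y} → y ∈ ys → P y → Gain m q (F y)) →
        length ys ℕ.≤ A₀ ℕ.* length (filter P? ys) → Gain (A₀ ℕ.* m) q (avg (map F ys))
      Gain-avg P? ys {F} {q} A₀ m q≤1 ne low high len = begin
        ι (A₀ ℕ.* m) * q + (1ℚ - q) ≡⟨ cong (λ z → z * q + (1ℚ - q)) (ι-* A₀ m) ⟩
        (ι A₀ * ι m) * q + (1ℚ - q) ≡⟨ cong (λ z → z + (1ℚ - q)) (*-assoc (ι A₀) (ι m) q) ⟩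
        ι A₀ * (ι m * q) + (1ℚ - q) ≤⟨ avg-lower (subst (_≤ 1ℚ - q) (+-inverseʳ q) (+-monoˡ-≤ (- q) q≤1)) P? ys A₀ ne
                                         (λ p → *-monoˡ-≤-nonNeg (ι m) {{ι-nonNeg m}} (low p)) high len ⟩
        (ι A₀ * ι m) * avg (map F ys) ≡⟨ cong (_* avg (map F ys)) (ι-* A₀ m) ⟨
        ι (A₀ ℕ.* m) * avg (map F ys) ∎
        where open ≤-Reasoning

      module Success (inhabited : Fin n) (S : ℕ) where

        allFin≢[] : allFin n ≢ []
        allFin≢[] e with subst (inhabited ∈_) e (∈-allFin inhabited)
        ... | ()

        query-≥ : ∀ st next x {q} → (∀ st' → q ≤ Pr (next st')) → q ≤ Pr (query x (arrive st next x))
        query-≥ st next x h with empty? (nbrs G x)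
        ... | yes e = subst (_ ≤_) (≡.sym (Pr-query-isolated x _ e)) (h _)
        ... | no ne = subst (_ ≤_) (≡.sym (Pr-query x _ ne)) (avg-≥ (nbrs G x) ne (λ _ → h _))

        choose-≥ : ∀ st next xs {q} → (∀ st' → q ≤ Pr (next st')) → q ≤ Pr (choose st next xs)
        choose-≥ st next [] h = avg-≥ (allFin n) allFin≢[] (λ _ → h _)
        choose-≥ st next (x ∷ xs) h =
          avg-≥ (false ∷ true ∷ []) {Pr ∘ branch st next x xs} (λ ())
            λ { {false} _ → choose-≥ st next xs h ; {true} _ → query-≥ st next x h }

        explore-≥ : ∀ r st cont → Pr cont ≤ Pr (explore r st cont)
        explore′-≥ : ∀ r st cont d → Pr cont ≤ Pr (explore′ r st cont d)
        explore-≥ r st cont = explore′-≥ r st cont (found? st)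
        explore′-≥ r st cont (yes _) = Pr-≤1 cont
        explore′-≥ zero st cont (no _) = ≤-refl
        explore′-≥ (suc r) st cont (no _) = choose-≥ st _ (visited st) (λ st' → explore-≥ r st' cont)

        query-mono : ∀ st next next' x → (∀ st' → Pr (next st') ≤ Pr (next' st')) →
          Pr (query x (arrive st next x)) ≤ Pr (query x (arrive st next' x))
        query-mono st next next' x h with empty? (nbrs G x)
        ... | yes e = subst₂ _≤_ (≡.sym (Pr-query-isolated x _ e)) (≡.sym (Pr-query-isolated x _ e)) (h _)
        ... | no ne = subst₂ _≤_ (≡.sym (Pr-query x _ ne)) (≡.sym (Pr-query x _ ne)) (avg-mono (nbrs G x) (λ _ → h _))

        choose-mono : ∀ st next next' xs → (∀ st' → Pr (next st') ≤ Pr (next' st')) →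
          Pr (choose st next xs) ≤ Pr (choose st next' xs)
        choose-mono st next next' [] h = avg-mono (allFin n) (λ _ → h _)
        choose-mono st next next' (x ∷ xs) h =
          avg-mono (false ∷ true ∷ []) {Pr ∘ branch st next x xs}
            {Pr ∘ branch st next' x xs}
            λ { {false} _ → choose-mono st next next' xs h ; {true} _ → query-mono st next next' x h }

        explore-suc : ∀ r st cont → Pr (explore r st cont) ≤ Pr (explore (suc r) st cont)
        explore′-suc : ∀ r st cont d → Pr (explore′ r st cont d) ≤ Pr (explore′ (suc r) st cont d)
        explore-suc r st cont = explore′-suc r st cont (found? st)
        explore′-suc r st cont (yes _) = ≤-refl
        explore′-suc zero st cont (no _) = choose-≥ st _ (visited st) (λ st' → explore-≥ zero st' cont)
        explore′-suc (suc r) st cont (no _) = choose-mono st _ _ (visited st) (λ st' → explore-suc r st' cont)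

        branch-≥ : ∀ st next x xs {q} → (∀ st' → q ≤ Pr (next st')) → ∀ b → q ≤ Pr (branch st next x xs b)
        branch-≥ st next x xs h false = choose-≥ st next xs h
        branch-≥ st next x xs h true = query-≥ st next x h

        flip-gain : ∀ st next x xs {q} m b → q ≤ 1ℚ → (∀ st' → q ≤ Pr (next st')) →
          Gain (2 ^ length xs ℕ.* m) q (Pr (branch st next x xs b)) → Gain (2 ^ length (x ∷ xs) ℕ.* m) q (Pr (choose st next (x ∷ xs)))
        flip-gain st next x xs {q} m b q≤1 h g =
          subst (λ k → Gain k q (Pr (choose st next (x ∷ xs)))) (≡.sym (ℕ.*-assoc 2 (2 ^ length xs) m))
            (Gain-avg (_≟ᵇ b) (false ∷ true ∷ []) {Pr ∘ branch st next x xs} 2 (2 ^ length xs ℕ.* m) q≤1 (λ ())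
              (λ {b} _ → branch-≥ st next x xs h b) (λ { _ refl → g }) (half b))
          where half : ∀ b → 2 ℕ.≤ 2 ℕ.* length (filter (_≟ᵇ b) (false ∷ true ∷ []))
                half false = ℕ.≤-refl
                half true = ℕ.≤-refl

        -- Selecting a given entry takes the right outcome of at most `length xs` fair coins. The
        -- cost is padded to the full power of two, so that it does not depend on the position of
        -- the entry.
        choose-visited : ∀ st next xs {x q} m → x ∈ xs → q ≤ 1ℚ → (∀ st' → q ≤ Pr (next st')) →
          Gain m q (Pr (query x (arrive st next x))) → Gain (2 ^ length xs ℕ.* m) q (Pr (choose st next xs))
        choose-visited st next (x ∷ xs) m (here refl) q≤1 h g = flip-gain st next x xs m true q≤1 h
          (Gain-mono (query-≥ st next x h) (ℕ.m≤n*m m (2 ^ length xs) {{ℕ.m^n≢0 2 (length xs)}}) g)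
        choose-visited st next (x ∷ xs) m (there p) q≤1 h g =
          flip-gain st next x xs m false q≤1 h (choose-visited st next xs m p q≤1 h g)

        choose-fresh : ∀ st next xs {q} m → q ≤ 1ℚ → (∀ st' → q ≤ Pr (next st')) →
          Gain m q (Pr (choose st next [])) → Gain (2 ^ length xs ℕ.* m) q (Pr (choose st next xs))
        choose-fresh st next [] {q} m q≤1 h g = subst (λ k → Gain k q (Pr (choose st next []))) (≡.sym (ℕ.+-identityʳ m)) g
        choose-fresh st next (x ∷ xs) m q≤1 h g = flip-gain st next x xs m false q≤1 h (choose-fresh st next xs m q≤1 h g)

        -- Exploring from st for r more steps succeeds with probability at least 1/m.
        record Succeeds (r : ℕ) (st : State n) (m : ℕ) : Set where
          constructor succeeds
          field
            cost≥1 : 1 ℕ.≤ m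
            -- The bound `S` on the entries ever visited turns the varying price
            -- `2 ^ length (visited st)` of a choice into the constant `2 ^ S`.
            gain : length (visited st) ℕ.+ r ℕ.≤ S → ∀ cont → Gain m (Pr cont) (Pr (explore r st cont))
        open Succeeds public

        succeeds-mono : ∀ {r st m m'} → m ℕ.≤ m' → Succeeds r st m → Succeeds r st m'
        succeeds-mono {r} {st} l h =
          succeeds (ℕ.≤-trans (cost≥1 h) l) (λ s cont → Gain-mono (explore-≥ r st cont) l (gain h s cont))

        succeeds-suc : ∀ {r st m} → Succeeds r st m → Succeeds (suc r) st m
        succeeds-suc {r} {st} {m} h = succeeds (cost≥1 h) λ s cont →
          ≤-trans (gain h (ℕ.≤-trans (ℕ.+-monoʳ-≤ (length (visited st)) (ℕ.n≤1+n r)) s) cont)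
                  (*-monoˡ-≤-nonNeg (ι m) {{ι-nonNeg m}} (explore-suc r st cont))

        succeeds-≤ : ∀ {r r' st m} → r ℕ.≤ r' → Succeeds r st m → Succeeds r' st m
        succeeds-≤ {r} {r'} {st} {m} l = go (ℕ.≤⇒≤′ l)
          where go : ∀ {r'} → r ℕ.≤′ r' → Succeeds r st m → Succeeds r' st m
                go (ℕ.≤′-reflexive refl) h = h
                go (ℕ.≤′-step l) h = succeeds-suc (go l h)

        gain-found : ∀ r st m cont d → 1 ℕ.≤ m → Found st → Gain m (Pr cont) (Pr (explore′ r st cont d))
        gain-found r st m cont (no ¬p) l p = ⊥-elim (¬p p)
        gain-found r st m cont (yes _) l p = Gain-mono (Pr-≤1 cont) l (≤-reflexive (lemma (Pr cont)))
          where
          open +-*-Solver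
          lemma : ∀ q → 1ℚ * q + (1ℚ - q) ≡ 1ℚ * 1ℚ
          lemma = solve 1 (λ q → con 1ℚ :* q :+ (con 1ℚ :- q) := con 1ℚ :* con 1ℚ) refl

        succeeds-found : ∀ {r st} → Found st → Succeeds r st 1
        succeeds-found {r} {st} p = succeeds ℕ.≤-refl λ s cont → gain-found r st 1 cont (found? st) ℕ.≤-refl p

        product-positive : ∀ {d} A₀ (Good : List (Fin n)) {m} → 1 ℕ.≤ d → d ℕ.≤ A₀ ℕ.* length Good →
          (∀ {y} → y ∈ Good → 1 ℕ.≤ m) → 1 ℕ.≤ 2 ^ S ℕ.* (A₀ ℕ.* m)
        product-positive zero Good pos len h = ⊥-elim (ℕ.<⇒≱ pos len)
        product-positive (suc a) [] pos len h = ⊥-elim (ℕ.<⇒≱ pos (ℕ.≤-trans len (ℕ.≤-reflexive (ℕ.*-zeroʳ a))))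
        product-positive (suc a) (y ∷ _) {m} pos len h =
          ℕ.*-mono-≤ (ℕ.m^n>0 2 S) (ℕ.*-mono-≤ (ℕ.s≤s (ℕ.z≤n {a})) (h (here refl)))

        -- The common core of a query and of a fresh sample: `ys` are the equally likely answers,
        -- `es` the edges seen after each, and the last hypothesis accounts for the coin flips that
        -- select this move.
        succeeds-step : ∀ {r st} A₀ m (Good ys : List (Fin n)) (es : Fin n → List (Fin n × Fin n)) → Unique Good →
          Good ⊆ ys → 1 ℕ.≤ length ys → length ys ℕ.≤ A₀ ℕ.* length Good →
          (∀ {y} → y ∈ Good → Succeeds r ((y ∷ visited st) , es y) m) →
          (∀ cont → Gain (A₀ ℕ.* m) (Pr cont) (avg (map (λ y → Pr (explore r ((y ∷ visited st) , es y) cont)) ys)) →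
            Gain (2 ^ length (visited st) ℕ.* (A₀ ℕ.* m)) (Pr cont) (Pr (choose st (λ st' → explore r st' cont) (visited st)))) →
          Succeeds (suc r) st (2 ^ S ℕ.* (A₀ ℕ.* m))
        succeeds-step {r} {st} A₀ m Good ys es u sub pos len ok chosen = succeeds cost (λ s cont → by-cases s cont (found? st))
          where
          cost : 1 ℕ.≤ 2 ^ S ℕ.* (A₀ ℕ.* m)
          cost = product-positive A₀ Good pos len (λ p → cost≥1 (ok p))
          good? : Decidable (_∈ Good)
          good? y = Any.any? (y Fin.≟_) Good
          by-cases : length (visited st) ℕ.+ suc r ℕ.≤ S → ∀ cont d → Gain (2 ^ S ℕ.* (A₀ ℕ.* m)) (Pr cont) (Pr (explore′ (suc r) st cont d))
          by-cases s cont (yes p) = gain-found (suc r) st _ cont (yes p) cost p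
          by-cases s cont (no _) =
            Gain-mono (choose-≥ st _ (visited st) (λ st' → explore-≥ r st' cont))
              (ℕ.*-monoˡ-≤ (A₀ ℕ.* m) (ℕ.^-monoʳ-≤ 2 (ℕ.≤-trans (ℕ.m≤m+n (length (visited st)) _) s)))
              (chosen cont (Gain-avg good? ys A₀ m (Pr-≤1 cont) (λ e → ℕ.n≮0 (subst (λ l → 1 ℕ.≤ length l) e pos))
                (λ _ → explore-≥ r _ cont)
                (λ _ p → gain (ok p) (ℕ.≤-trans (ℕ.≤-reflexive (≡.sym (ℕ.+-suc (length (visited st)) r))) s) cont)
                (ℕ.≤-trans len (ℕ.*-monoʳ-≤ A₀ (length-⊆ u (λ p → ∈-filter⁺ good? (sub p) p))))))

        succeeds-query : ∀ {r st x} A₀ m (Good : List (Fin n)) → x ∈ visited st → Unique Good →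
          (∀ {y} → y ∈ Good → adj G x y ≡ true) → 1 ℕ.≤ degree G x → degree G x ℕ.≤ A₀ ℕ.* length Good →
          (∀ {y} → y ∈ Good → Succeeds r (traverse x y st) m) → Succeeds (suc r) st (2 ^ S ℕ.* (A₀ ℕ.* m))
        succeeds-query {r} {st} {x} A₀ m Good x∈ u sub pos len ok =
          succeeds-step A₀ m Good (nbrs G x) (λ y → (x , y) ∷ seen st) u (λ p → ∈-nbrs⁺ G (sub p)) pos len ok λ cont g →
            choose-visited st _ (visited st) (A₀ ℕ.* m) x∈ (Pr-≤1 cont) (λ st' → explore-≥ r st' cont)
              (subst (Gain (A₀ ℕ.* m) (Pr cont)) (≡.sym (Pr-query x _ (λ e → ℕ.n≮0 (subst (λ l → 1 ℕ.≤ length l) e pos)))) g)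

        succeeds-sample : ∀ {r st} A₀ m (Good : List (Fin n)) → Unique Good → n ℕ.≤ A₀ ℕ.* length Good →
          (∀ {y} → y ∈ Good → Succeeds r (visit y st) m) → Succeeds (suc r) st (2 ^ S ℕ.* (A₀ ℕ.* m))
        succeeds-sample {r} {st} A₀ m Good u len ok =
          succeeds-step A₀ m Good (allFin n) (λ _ → seen st) u (λ _ → ∈-allFin _) (∈⇒nonempty (∈-allFin inhabited))
            (ℕ.≤-trans (ℕ.≤-reflexive (length-allFin n)) len) ok λ cont g →
            choose-fresh st _ (visited st) (A₀ ℕ.* m) (Pr-≤1 cont) (λ st' → explore-≥ r st' cont) g

        -- With `q` and `P` the probabilities after `i` and `i + 1` repetitions, `Gain` reads
        -- `m * P ≥ (m - 1) * q + 1`, so `q ≥ i / (m + i)` yields `P ≥ (i + 1) / (m + i)`. This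
        -- bound, weaker than `1 - (1 - 1 / m) ^ i`, involves no powers and equals 2/3 at
        -- `i = 2 * m`.
        repeat-bound : ∀ {R m} → R ℕ.≤ S → Succeeds R initial m → ∀ i → ι i ≤ ι (m ℕ.+ i) * Pr (repeat i R)
        repeat-bound {R} {m} R≤S h zero = ≤-reflexive (≡.sym (*-zeroʳ (ι (m ℕ.+ 0))))
        repeat-bound {R} {zero} R≤S h (suc i) with cost≥1 h
        ... | ()
        repeat-bound {R} {suc m} R≤S h (suc i) = avg-cancel m (begin
          ι (suc m) * ι (suc i) ≡⟨ ι-* (suc m) (suc i) ⟨
          ι (suc m ℕ.* suc i) ≤⟨ ι-mono (ℕ.≤-trans (ℕ.≤-reflexive (nat₁ m i)) (ℕ.+-monoʳ-≤ (m ℕ.* i) (ℕ.n≤1+n (m ℕ.+ suc i)))) ⟩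
          ι (m ℕ.* i ℕ.+ (suc m ℕ.+ suc i)) ≡⟨ trans (ι-+ (m ℕ.* i) _) (cong (λ z → z + ι (suc m ℕ.+ suc i)) (ι-* m i)) ⟩
          ι m * ι i + k ≤⟨ +-monoˡ-≤ k (*-monoˡ-≤-nonNeg (ι m) {{ι-nonNeg m}} (≤-trans (repeat-bound R≤S h i) mono-q)) ⟩
          ι m * (k * q) + k ≡⟨ rat₁ (ι m) k q ⟩
          k * ((1ℚ + ι m) * q + (1ℚ - q)) ≡⟨ cong (λ z → k * (z * q + (1ℚ - q))) (ι-+ 1 m) ⟨
          k * (ι (suc m) * q + (1ℚ - q)) ≤⟨ *-monoˡ-≤-nonNeg k {{ι-nonNeg (suc m ℕ.+ suc i)}} (gain h R≤S (repeat i R)) ⟩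
          k * (ι (suc m) * Pr (repeat (suc i) R)) ≡⟨ rat₂ k (ι (suc m)) (Pr (repeat (suc i) R)) ⟩
          ι (suc m) * (k * Pr (repeat (suc i) R)) ∎)
          where
          open ≤-Reasoning
          k = ι (suc m ℕ.+ suc i)
          q = Pr (repeat i R)
          nat₁ : ∀ m i → suc m ℕ.* suc i ≡ m ℕ.* i ℕ.+ (m ℕ.+ suc i)
          nat₁ m i = trans (cong (suc i ℕ.+_) (ℕ.*-suc m i)) (trans (ℕ.+-comm (suc i) _) (trans (cong (ℕ._+ suc i) (ℕ.+-comm m _)) (ℕ.+-assoc (m ℕ.* i) m (suc i))))
          pr-nonNeg : ∀ i → 0ℚ ≤ Pr (repeat i R)
          pr-nonNeg zero = ≤-refl
          pr-nonNeg (suc i) = ≤-trans (pr-nonNeg i) (explore-≥ R initial (repeat i R))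
          mono-q : ι (suc m ℕ.+ i) * q ≤ k * q
          mono-q = *-monoʳ-≤-nonNeg q {{nonNegative (pr-nonNeg i)}} (ι-mono (ℕ.+-monoʳ-≤ (suc m) (ℕ.n≤1+n i)))
          open +-*-Solver
          rat₁ : ∀ m k q → m * (k * q) + k ≡ k * ((1ℚ + m) * q + (1ℚ - q))
          rat₁ = solve 3 (λ m k q → m :* (k :* q) :+ k := k :* ((con 1ℚ :+ m) :* q :+ (con 1ℚ :- q))) refl
          rat₂ : ∀ a b c → a * (b * c) ≡ b * (a * c)
          rat₂ = solve 3 (λ a b c → a :* (b :* c) := b :* (a :* c)) refl

        repeat-≥⅔ : ∀ {R m} → R ℕ.≤ S → Succeeds R initial m → + 2 / 3 ≤ Pr (repeat (2 ℕ.* m) R)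
        repeat-≥⅔ {R} {zero} R≤S h with cost≥1 h
        ... | ()
        repeat-≥⅔ {R} {suc m} R≤S h = avg-cancel 2 (begin
          ι 3 * (+ 2 / 3) ≡⟨ *-comm (ι 3) (+ 2 / 3) ⟩
          (+ 2 / 3) * ι 3 ≡⟨ /-*-ι 2 2 ⟩
          ι 2 ≤⟨ avg-cancel m (begin
            ι (suc m) * ι 2 ≡⟨ ι-* (suc m) 2 ⟨
            ι (suc m ℕ.* 2) ≡⟨ cong ι (ℕ.*-comm (suc m) 2) ⟩
            ι (2 ℕ.* suc m) ≤⟨ repeat-bound R≤S h (2 ℕ.* suc m) ⟩
            ι (3 ℕ.* suc m) * P ≡⟨ cong (_* P) (trans (ι-* 3 (suc m)) (*-comm (ι 3) (ι (suc m)))) ⟩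
            ι (suc m) * ι 3 * P ≡⟨ *-assoc (ι (suc m)) (ι 3) P ⟩
            ι (suc m) * (ι 3 * P) ∎) ⟩
          ι 3 * P ∎)
          where
          open ≤-Reasoning
          P = Pr (repeat (2 ℕ.* suc m) R)

-- The fill-in of a graph under an elimination order.

module FillIn where

  open import Data.Nat
  open import Data.Nat.Properties
  open Minors using (Adj; Adj-sym)
  open Subdivisions using (Walk; step; cons; Walk-++; Walk-reverse)

  module Elimination {k} (H : Graph k) (ρ : Fin k → ℕ) where

    -- The fill-in of H under elimination in increasing order of ρ.
    data Fill : Fin k → Fin k → Set where
      edge : ∀ {a b} → Adj H a b → Fill a b
      elim : ∀ {a b} m → ρ m < ρ a → ρ m < ρ b → a ≢ b → Fill m a → Fill m b → Fill a b

    -- Chain r ℓ x y: ℓ increasing steps of the fill-in, all starting below r.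
    data Chain (r : ℕ) : ℕ → Fin k → Fin k → Set where
      []   : ∀ {x} → Chain r 0 x x
      link : ∀ {ℓ x m y} → Fill x m → ρ x < ρ m → ρ x < r → Chain r ℓ m y → Chain r (suc ℓ) x y

    chain-snoc : ∀ {r ℓ x m y} → Chain r ℓ x m → Fill m y → ρ m < ρ y → ρ m < r → Chain r (suc ℓ) x y
    chain-snoc [] f l b = link f l b []
    chain-snoc (link g l' b' c) f l b = link g l' b' (chain-snoc c f l b)

    chain-weaken : ∀ {r r' ℓ x y} → r ≤ r' → Chain r ℓ x y → Chain r' ℓ x y
    chain-weaken h [] = []
    chain-weaken h (link f l b c) = link f l (≤-trans b h) (chain-weaken h c)

    chain-length : ∀ {r ℓ x y} → Chain r ℓ x y → ℓ + ρ x ≤ ρ y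
    chain-length [] = ≤-refl
    chain-length {ℓ = suc ℓ} {x} (link f l b c) = ≤-trans (≤-reflexive (≡.sym (+-suc ℓ (ρ x)))) (≤-trans (+-monoʳ-≤ ℓ l) (chain-length c))

    -- Unfolding the pair from the side of `j` must end at a genuine edge at `j`; the eliminated
    -- roles passed on the way form the increasing chain up to `m`. A query can only leave the image
    -- of `j` along such an edge.
    neighbour-below : ∀ {m j} → Fill m j → ρ m < ρ j → ∃₂ λ x ℓ → Adj H j x × Chain (ρ m) ℓ x m
    neighbour-below {m} (edge a) l = m , 0 , Adj-sym H a , []
    neighbour-below {m} (elim o o<m o<j _ fm fj) l with neighbour-below fj o<j
    ... | x , ℓ , a , c = x , suc ℓ , a , chain-snoc (chain-weaken (<⇒≤ o<m) c) fm o<m o<m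

    -- The form in which a pair is climbed: one query along an edge at `j`, then steps that all
    -- start below `j` and so are available when `(j , u)` is treated.
    first-step : ∀ {j u} → Fill j u → ρ j < ρ u → ∃₂ λ x ℓ → Adj H j x × Chain (ρ j) ℓ x u
    first-step {j} {u} (edge a) l = u , 0 , a , []
    first-step {j} {u} (elim m m<j m<u _ fj fu) l with neighbour-below fj m<j
    ... | x , ℓ , a , c = x , suc ℓ , a , chain-snoc (chain-weaken (<⇒≤ m<j) c) fu m<u m<j

    Below : Fin k → Fin k → Fin k → Set
    Below a b w = ρ w < ρ a × ρ w < ρ b × (∃ λ ℓ → Chain (ρ a ⊓ ρ b) ℓ w a) × (∃ λ ℓ → Chain (ρ a ⊓ ρ b) ℓ w b)

    -- Splicing the walks of the two pairs at the eliminated role leaves only lower roles inside.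
    -- The chains to both ends are recorded because they bound how many images of the pair are
    -- compatible with a given inner vertex.
    fill-walk : ∀ {a b} → Fill a b → ∃ λ ws → Walk (Adj H) a ws b × (∀ {w} → w ∈ ws → Below a b w)
    fill-walk (edge e) = [] , step e , λ ()
    fill-walk {a} {b} (elim m m<a m<b _ fa fb) with fill-walk fa | fill-walk fb
    ... | us , wa , ha | vs , wb , hb with Walk-reverse (Adj-sym H) wa
    ... | us' , wa' , sub = us' ++ m ∷ vs , Walk-++ wa' wb , λ p → below (∈-++⁻ us' p)
      where
      m<r : ρ m < ρ a ⊓ ρ b
      m<r = ⊓-pres-m< m<a m<b
      through : ∀ {w r ℓ} → ρ w < ρ m → r ≤ ρ m → Chain r ℓ w m → Below a b w
      through l h c = <-trans l m<a , <-trans l m<b ,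
        (_ , chain-snoc (chain-weaken h' c) fa m<a m<r) , (_ , chain-snoc (chain-weaken h' c) fb m<b m<r)
        where h' = ≤-trans h (<⇒≤ m<r)
      below : ∀ {w} → _ → Below a b w
      below (inj₁ p) = let (l , _ , (_ , c) , _) = ha (sub p) in through l (m⊓n≤m (ρ m) (ρ a)) c
      below (inj₂ (here refl)) = m<a , m<b , (_ , link fa m<a m<r []) , (_ , link fb m<b m<r [])
      below (inj₂ (there p)) = let (l , _ , (_ , c) , _) = hb p in through l (m⊓n≤m (ρ m) (ρ b)) c

-- Thinning of weighted families, and the constants.

module Packings where

  open import Data.Nat
  open import Data.Nat.Properties
  open import Data.Nat.Tactic.RingSolver using (solve-∀)
  open Counting
  open Minors using (Adj; Adj?; Adj-sym; Adj-irrefl)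
  open Subdivisions
  open FillIn
  open Exploration

  record Weighted (A K : Set) : Set where
    field
      _≟K_ : DecidableEquality K
      κ : A → K
      w : K → ℕ
      xs : List A
      xs-unique : Unique xs
      keys : List K
      covered : ∀ {x} → x ∈ xs → κ x ∈ keys
      n W d : ℕ
      weight : ∑ keys w ≤ W * n
      dense : n ≤ d * length xs

  -- Drop the items whose key y is shared by fewer than w y / B items.  As the keys have total weight at most W n,
  -- at least half of the items survive.
  module Thinning {A K : Set} (𝒲 : Weighted A K) where
    open Weighted 𝒲
    open Count _≟K_ κ public using (count; few-poor)

    B : ℕ
    -- `few-poor` gives `B * poor ≤ W * n ≤ W * d * length xs`, so with this `B` at most half of the
    -- items are poor.
    B = 2 * suc (W * d)

    rich? : Decidable (λ x → w (κ x) ≤ B * count xs (κ x))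
    rich? x = w (κ x) ≤? B * count xs (κ x)

    poor? : Decidable (λ x → suc (B * count xs (κ x)) ≤ w (κ x))
    poor? x = suc (B * count xs (κ x)) ≤? w (κ x)

    kept : List A
    kept = filter rich? xs

    kept-unique : Unique kept
    kept-unique = filter⁺ rich? xs-unique

    kept⊆xs : kept ⊆ xs
    kept⊆xs p = proj₁ (∈-filter⁻ rich? {xs = xs} p)

    is-rich : ∀ {x} → x ∈ kept → w (κ x) ≤ B * count xs (κ x)
    is-rich p = proj₂ (∈-filter⁻ rich? {xs = xs} p)

    group : K → List A
    group y = filter (λ x → κ x ≟K y) xs

    group-unique : ∀ y → Unique (group y)
    group-unique y = filter⁺ (λ x → κ x ≟K y) xs-unique

    group⁻ : ∀ {y x} → x ∈ group y → x ∈ xs × κ x ≡ y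
    group⁻ {y} p = ∈-filter⁻ (λ x → κ x ≟K y) {xs = xs} p

    kept-dense : n ≤ 2 * d * length kept
    kept-dense = begin
      n ≤⟨ dense ⟩
      d * length xs ≤⟨ *-monoʳ-≤ d (+-cancelʳ-≤ (length xs) (length xs) (2 * length kept) (begin
        length xs + length xs ≡⟨ cong (length xs +_) (+-identityʳ (length xs)) ⟨
        2 * length xs ≤⟨ *-monoʳ-≤ 2 (length-partition rich? poor? xs (λ _ → ≰⇒>)) ⟩
        2 * (length kept + poor) ≡⟨ *-distribˡ-+ 2 (length kept) poor ⟩
        2 * length kept + 2 * poor ≤⟨ +-monoʳ-≤ (2 * length kept) (*-cancelˡ-≤ (suc (W * d)) few) ⟩
        2 * length kept + length xs ∎)) ⟩
      d * (2 * length kept) ≡⟨ lemma₁ d (length kept) ⟩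
      2 * d * length kept ∎
      where
      open ≤-Reasoning
      poor : ℕ
      poor = length (filter poor? xs)
      lemma₁ : ∀ a b → a * (2 * b) ≡ 2 * a * b
      lemma₁ = solve-∀
      few : suc (W * d) * (2 * poor) ≤ suc (W * d) * length xs
      few = begin
        suc (W * d) * (2 * poor) ≡⟨ lemma₁ (suc (W * d)) poor ⟩
        B * poor ≤⟨ few-poor B w xs keys covered ⟩
        ∑ keys w ≤⟨ weight ⟩
        W * n ≤⟨ *-monoʳ-≤ W dense ⟩
        W * (d * length xs) ≡⟨ *-assoc W d (length xs) ⟨
        W * d * length xs ≤⟨ m≤n+m _ (length xs) ⟩
        suc (W * d) * length xs ∎

  sequence-mono : ∀ (f : ℕ → ℕ) → (∀ q → f q ≤ f (suc q)) → ∀ {q q'} → q ≤ q' → f q ≤ f q'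
  sequence-mono f h {q} l = go (≤⇒≤′ l)
    where go : ∀ {q'} → q ≤′ q' → f q ≤ f q'
          go (≤′-reflexive refl) = ≤-refl
          go (≤′-step l) = ≤-trans (go l) (h _)

  steps : ℕ → ℕ → ℕ
  steps k zero = 0
  steps k (suc q) = steps k q + suc (k * steps k q)

  module Constants (k l S g : ℕ) where

    -- An inner vertex has one of `k` roles and leaves at most `Δ ^ k` images for either end of the
    -- pair. Of the two factors `2 ^ l`, one is the density of topological minors and the other the
    -- average degree of `G`.
    conflictBound richnessWeight : ℕ → ℕ
    conflictBound Δ = k * (Δ ^ k * Δ ^ k)
    richnessWeight Δ = suc (conflictBound Δ) * 2 ^ l * 2 ^ l

    richness : ℕ → ℕ → ℕ
    richness d Δ = 2 * suc (richnessWeight Δ * d)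

    -- The index counts the pairs processed. A thinning at most halves the family; the summands
    -- `fan q` and `cost q` make the sequences monotone, so that earlier bounds stay valid.
    density fan cost : ℕ → ℕ
    density zero = g
    density (suc q) = 2 * density q
    fan zero = 1
    fan (suc q) = fan q + richness (density q) (fan q)
    cost zero = 1
    cost (suc q) = cost q + 2 ^ S * (richness (density q) (fan q) * cost q ^ k)

    fan≥1 : ∀ q → 1 ≤ fan q
    fan≥1 zero = ≤-refl
    fan≥1 (suc q) = ≤-trans (fan≥1 q) (m≤m+n _ _)

    cost-positive : ∀ q → 1 ≤ cost q
    cost-positive zero = ≤-refl
    cost-positive (suc q) = ≤-trans (cost-positive q) (m≤m+n _ _)

  module Descent (k l S d Δ s m : ℕ) where

    density₂ richness₂ verifyCost : ℕ → ℕ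
    density₂ zero = d
    density₂ (suc r) = 2 * density₂ r
    richness₂ r = 2 * suc (Δ ^ k * 2 ^ l * density₂ r)
    verifyCost zero = 1
    verifyCost (suc q) = verifyCost q + 2 ^ S * (Δ * verifyCost q)

    -- The two ways to place a role: sampling an image of a lower neighbour and one climb, or a
    -- query at a placed role followed by a chain of at most `k` climbs. `cost₂` adds both prices
    -- and so covers either.
    rootCost branchCost : ℕ → ℕ → ℕ
    rootCost r M = 2 ^ S * (density₂ r * Δ * (m * M))
    branchCost r M = 2 ^ S * (richness₂ r * (m ^ k * M))

    cost₂ : ℕ → ℕ → ℕ
    cost₂ v zero = verifyCost v
    cost₂ v (suc r) = cost₂ v r + (rootCost r (cost₂ v r) + branchCost r (cost₂ v r))

  steps₂ : ℕ → ℕ → ℕ → ℕ → ℕ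
  steps₂ k s v zero = v
  steps₂ k s v (suc r) = steps₂ k s v r + suc (k * s + s)

  rounds : ℕ → ℕ
  -- Ranks lie between 0 and `k`, and all pairs are swept once for each rank.
  rounds k = suc k * length (allPairs k)

  totalSteps : ℕ → ℕ
  totalSteps k = steps₂ k (steps k (rounds k)) (length (allPairs k)) (suc k)

  totalCost : (k l S g : ℕ) → ℕ
  totalCost k l S g = Descent.cost₂ k l S (density (rounds k)) (fan (rounds k)) (steps k (rounds k)) (cost (rounds k)) (length (allPairs k)) (suc k)
    where open Constants k l S g

  argmin : ∀ {A : Set} (f : A → ℕ) x (xs : List A) → ∃ λ y → y ∈ x ∷ xs × (∀ {z} → z ∈ x ∷ xs → f y ≤ f z)
  argmin f x [] = x , here refl , λ { (here refl) → ≤-refl }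
  argmin f x (x' ∷ xs) with argmin f x' xs
  ... | y , y∈ , h with f x ≤? f y
  ... | yes p = x , here refl , λ { (here refl) → ≤-refl ; (there q) → ≤-trans p (h q) }
  ... | no ¬p = y , there y∈ , λ { (here refl) → <⇒≤ (≰⇒> ¬p) ; (there q) → h q }

  -- `χ` assigns to each vertex the only role it can play. It makes the maps `emb c` injective and
  -- gives a vertex shared by two copies the same role in both; so edge-disjointness,
  -- `emb-disjoint`, need only compare equal roles.
  record Context : Set where
    field
      ℋ : List AnyGraph
      l n k N S : ℕ
      L : Graph l
      G : Graph n
      free : MinorFree L G
      H : Graph k
      ρ : Fin k → ℕ
      ρ≤k : ∀ a → ρ a ≤ k
      ρ-injective : ∀ {a b} → ρ a ≡ ρ b → a ≡ b
      χ : Fin n → Fin k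
      emb : Fin N → Fin k → Fin n
      emb-adj : ∀ c {a b} → Adj H a b → Adj G (emb c a) (emb c b)
      emb-χ : ∀ c a → χ (emb c a) ≡ a
      emb-degree : ∀ c {a b} → ρ a < ρ b → degree G (emb c a) ≤ degree G (emb c b)
      emb-disjoint : ∀ {c c' a b} → Adj H a b → emb c a ≡ emb c' a → emb c b ≡ emb c' b → c ≡ c'
      inhabited : Fin n

  -- Fans, climbs and the images of a fill-in pair.

  module Copies (X : Context) where
    open Context X
    open Explorer ℋ
    open Elimination H ρ
    open Success G inhabited S

    deg : Fin n → ℕ
    deg = degree G

    -- The case of `sparse` without subdivisions: all vertices, all oriented edges, no inner
    -- vertices.
    degree-sum : ∑ (allFin n) deg ≤ 2 ^ l * n
    degree-sum = begin
      ∑ (allFin n) deg ≡⟨ ∑-cong (allFin n) (λ x → length-filter≡∑ (T? ∘ adj G x) (allFin n)) ⟩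
      ∑ (allFin n) (λ x → ∑ (allFin n) (λ y → ⟦ T? (adj G x y) ⟧)) ≡⟨ ∑-cartesianProduct (allFin n) (allFin n) _ ⟨
      ∑ (allPairs n) (λ e → ⟦ E? e ⟧) ≡⟨ length-filter≡∑ E? (allPairs n) ⟨
      length E ≤⟨ Topological.sparse L G free {W = λ _ → T true} (λ _ → T? true) E
                    (filter⁺ E? (allPairs-unique n)) (λ _ → [])
                    (λ p → _ , _ , Adj-irrefl G (adjacent p)) (λ p → step (adjacent p)) (λ _ ()) (λ _ _ ()) ⟩
      2 ^ l * length (filter (λ _ → T? true) (allFin n)) ≤⟨ *-monoʳ-≤ (2 ^ l) (≤-trans (length-filter (λ _ → T? true) (allFin n)) (≤-reflexive (length-allFin n))) ⟩
      2 ^ l * n ∎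
      where
      open ≤-Reasoning
      E? : Decidable (λ (e : Fin n × Fin n) → T (adj G (proj₁ e) (proj₂ e)))
      E? e = T? (adj G (proj₁ e) (proj₂ e))
      E : List (Fin n × Fin n)
      E = filter E? (allPairs n)
      adjacent : ∀ {e} → e ∈ E → Adj G (proj₁ e) (proj₂ e)
      adjacent {e} p = ∈-nbrs⁻ G (∈-filter⁺ (T? ∘ adj G (proj₁ e)) (∈-allFin _) (proj₂ (∈-filter⁻ E? {xs = allPairs n} p)))

    Fan : ℕ → Fin k → Fin k → List (Fin N) → Set
    Fan Δ i m D = ∀ y → Σ (List (Fin n)) λ vs → length vs ≤ Δ × (∀ {c} → c ∈ D → emb c i ≡ y → emb c m ∈ vs)

    Fans : ℕ → ℕ → List (Fin N) → Set
    Fans r Δ D = ∀ {i m} → Fill i m → ρ i < ρ m → ρ i < r → Fan Δ i m D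

    -- Continuation form lets climbs compose. Only the starting copy `c` has to belong to `D`, while
    -- the exploration may use copies outside it; this is why the property passes to subfamilies.
    Up : ℕ → ℕ → Fin k → Fin k → List (Fin N) → Set
    Up s m i u D = ∀ {c} → c ∈ D → ∀ {st} → emb c i ∈ visited st → ∀ {r M} →
      (∀ {st'} → st ⊑ st' → emb c u ∈ visited st' → Succeeds r st' M) → Succeeds (s + r) st (m * M)

    Ups : ℕ → ℕ → ℕ → List (Fin N) → Set
    Ups r s m D = ∀ {i u} → Fill i u → ρ i < ρ u → ρ i < r → Up s m i u D

    chain-fan : ∀ {r Δ D ℓ x y} → Fans r Δ D → Chain r ℓ x y → Fan (Δ ^ ℓ) x y D
    chain-fan fans [] v = v ∷ [] , s≤s z≤n , λ { _ refl → here refl }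
    chain-fan {r} {Δ} {ℓ = suc ℓ} fans (link f l b c) v with fans f l b v
    ... | vs , len , cov = concatMap next vs ,
          ≤-trans (length-concatMap-≤ next (Δ ^ ℓ) (λ w → proj₁ (proj₂ (chain-fan fans c w))) vs) (*-monoˡ-≤ (Δ ^ ℓ) len) ,
          λ c∈ e → ∈-concatMap next (cov c∈ e) (proj₂ (proj₂ (chain-fan fans c _)) c∈ refl)
      where next : Fin n → List (Fin n)
            next w = proj₁ (chain-fan fans c w)

    succeeds-cast : ∀ {r r' st m m'} → r ≤ r' → m ≤ m' → Succeeds r st m → Succeeds r' st m'
    succeeds-cast p q h = succeeds-≤ p (succeeds-mono q h)

    chain-up : ∀ {r s m D ℓ x y} → Ups r s m D → Chain r ℓ x y → Up (ℓ * s) (m ^ ℓ) x y D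
    chain-up ups [] c∈ v∈ {r} {M} h = succeeds-cast ≤-refl (≤-reflexive (≡.sym (+-identityʳ M))) (h ⊑-refl v∈)
    chain-up {s = s} {m} {ℓ = suc ℓ} ups (link f l b c) c∈ v∈ {r} {M} h =
      succeeds-cast (≤-reflexive (≡.sym (+-assoc s (ℓ * s) r))) (≤-reflexive (≡.sym (*-assoc m (m ^ ℓ) M)))
        (ups f l b c∈ v∈ (λ le v∈' → chain-up ups c c∈ v∈' (λ le' → h (⊑-trans le le'))))

    Up-mono : ∀ {s s' m m' i u D D'} → s ≤ s' → m ≤ m' → D' ⊆ D → Up s m i u D → Up s' m' i u D'
    Up-mono p q sub up c∈ v∈ {r} {M} h = succeeds-cast (+-monoˡ-≤ r p) (*-monoˡ-≤ M q) (up (sub c∈) v∈ h)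

    Fan-mono : ∀ {Δ Δ' i m D D'} → Δ ≤ Δ' → D' ⊆ D → Fan Δ i m D → Fan Δ' i m D'
    Fan-mono p sub fan v = let (vs , len , cov) = fan v in vs , ≤-trans len p , λ c∈ → cov (sub c∈)

    chain≤k : ∀ {r ℓ x y} → Chain r ℓ x y → ℓ ≤ k
    chain≤k {ℓ = ℓ} {y = y} c = ≤-trans (m≤m+n ℓ _) (≤-trans (chain-length c) (ρ≤k y))

    chain-up-k : ∀ {r s m D ℓ x y} → 1 ≤ m → Ups r s m D → Chain r ℓ x y → Up (k * s) (m ^ k) x y D
    chain-up-k {s = s} {m} {D} pos ups c =
      Up-mono {D = D} {D} (*-monoˡ-≤ s (chain≤k c)) (^-monoʳ-≤ m {{>-nonZero pos}} (chain≤k c)) (λ p → p) (chain-up ups c)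

    chain-fan-k : ∀ {r Δ D ℓ x y} → 1 ≤ Δ → Fans r Δ D → Chain r ℓ x y → Fan (Δ ^ k) x y D
    chain-fan-k {Δ = Δ} {D} pos fans c = Fan-mono {D = D} {D} (^-monoʳ-≤ Δ {{>-nonZero pos}} (chain≤k c)) (λ p → p) (chain-fan fans c)

    -- Copies through a common vertex use distinct edges there.
    copies-at : ∀ {i x} → Adj H i x → ∀ {D} → Unique D → ∀ v →
      length (filter (λ c → emb c i Fin.≟ v) D) ≤ deg v
    copies-at {i} {x} a {D} u v = length-injection (λ c → emb c x) (filter⁺ at? u)
      (λ p q e → emb-disjoint a (trans (at p) (≡.sym (at q))) e)
      (λ {c} p → ∈-nbrs⁺ G (subst (λ w → Adj G w (emb c x)) (at p) (emb-adj c a)))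
      where
      at? : Decidable (λ c → emb c i ≡ v)
      at? c = emb c i Fin.≟ v
      at : ∀ {c} → c ∈ filter at? D → emb c i ≡ v
      at p = proj₂ (∈-filter⁻ at? {xs = D} p)

    -- By edge-disjointness the copies of `group` leave `v` towards distinct neighbours, so a random
    -- neighbour of `v` lies on one of them with probability at least `1 / A`.
    spread : ∀ {i x} → Adj H i x → ∀ {c v A M r st group} → emb c i ≡ v → v ∈ visited st → Unique group →
      (∀ {c'} → c' ∈ group → emb c' i ≡ v) → deg v ≤ A * length group →
      (∀ {c'} → c' ∈ group → Succeeds r (traverse v (emb c' x) st) M) → Succeeds (suc r) st (2 ^ S * (A * M))
    spread {i} {x} a {c} {v} {A} {M} {r} {st} {group} refl v∈ u at rich next =
      succeeds-query A M (map (λ c' → emb c' x) group) v∈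
        (unique-map (λ c' → emb c' x) u (λ p q → emb-disjoint a (trans (at p) (≡.sym (at q)))))
        (λ p → let (c' , c'∈ , e) = ∈-map⁻ _ p in subst₂ (Adj G) (at c'∈) (≡.sym e) (emb-adj c' a))
        (∈⇒nonempty (∈-nbrs⁺ G (emb-adj c a)))
        (≤-trans rich (≤-reflexive (cong (A *_) (≡.sym (length-map _ group)))))
        (λ p → let (c' , c'∈ , e) = ∈-map⁻ _ p in subst (λ y → Succeeds r (traverse v y st) M) (≡.sym e) (next c'∈))

    _≟₂_ : DecidableEquality (Fin n × Fin n)
    _≟₂_ = ≡-dec Fin._≟_ Fin._≟_

    record PairData : Set where
      field
        j u : Fin k
        fill : Fill j u
        j<u : ρ j < ρ u
        D : List (Fin N)
        D-unique : Unique D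
        Δ d : ℕ
        Δ≥1 : 1 ≤ Δ
        fans : Fans (ρ j) Δ D
        D-dense : n ≤ d * length D

    module Pair (P : PairData) where
      open PairData P

      key : Fin N → Fin n × Fin n
      key c = emb c j , emb c u

      -- The images of (j , u) are few: joining each by a copy of the fill-in walk from j to u, a constant fraction of
      -- these walks is internally disjoint, since an inner vertex determines the image of (j , u) up to Δ ^ k * Δ ^ k
      -- choices; and disjoint walks form a topological minor.
      pairs : List (Fin n × Fin n)
      pairs = deduplicate _≟₂_ (map key D)

      pairs-unique : Unique pairs
      pairs-unique = deduplicate-! (map key D)
        where open import Data.List.Relation.Unary.Unique.DecPropositional.Properties _≟₂_ using (deduplicate-!)

      key∈pairs : ∀ {c} → c ∈ D → key c ∈ pairs
      key∈pairs p = ∈-deduplicate⁺ _≟₂_ (∈-map⁺ key p)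

      Rep : Fin n × Fin n → Set
      Rep e = Any (λ c → key c ≡ e) D

      rep? : ∀ e → Dec (Rep e)
      rep? e = Any.any? (λ c → key c ≟₂ e) D

      pair-rep : ∀ {e} → e ∈ pairs → Rep e
      pair-rep p with ∈-map⁻ key (∈-deduplicate⁻ _≟₂_ (map key D) p)
      ... | c , c∈ , refl = lose c∈ refl

      between : List (Fin k)
      between = proj₁ (fill-walk fill)

      inner : Fin n × Fin n → List (Fin n)
      inner e with rep? e
      ... | yes p = map (emb (proj₁ (find p))) between
      ... | no _ = []

      in-between? : ∀ w → Dec (w ∈ between)
      in-between? w = Any.any? (w Fin.≟_) between

      rank-min : ρ j ⊓ ρ u ≡ ρ j
      rank-min = m≤n⇒m⊓n≡m (<⇒≤ j<u)

      toward-j : ∀ {w} → w ∈ between → Fan (Δ ^ k) w j D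
      toward-j p = let (_ , _ , (_ , c) , _) = proj₂ (proj₂ (fill-walk fill)) p in
        chain-fan-k Δ≥1 fans (chain-weaken (≤-reflexive rank-min) c)

      toward-u : ∀ {w} → w ∈ between → Fan (Δ ^ k) w u D
      toward-u p = let (_ , _ , _ , (_ , c)) = proj₂ (proj₂ (fill-walk fill)) p in
        chain-fan-k Δ≥1 fans (chain-weaken (≤-reflexive rank-min) c)

      compatible : ∀ w → Dec (w ∈ between) → Fin n → List (Fin n × Fin n)
      compatible w (no _) v = []
      compatible w (yes p) v = cartesianProduct (proj₁ (toward-j p v)) (proj₁ (toward-u p v))

      compatible-length : ∀ w d v → length (compatible w d v) ≤ Δ ^ k * Δ ^ k
      compatible-length w (no _) v = z≤n
      compatible-length w (yes p) v = ≤-trans (≤-reflexive (length-cartesianProduct (proj₁ (toward-j p v)) _))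
        (*-mono-≤ (proj₁ (proj₂ (toward-j p v))) (proj₁ (proj₂ (toward-u p v))))

      compatible-∈ : ∀ {w} d → w ∈ between → ∀ {c v} → c ∈ D → emb c w ≡ v → key c ∈ compatible w d v
      compatible-∈ (no ¬p) p = ⊥-elim (¬p p)
      compatible-∈ (yes p) _ {v = v} c∈ e =
        ∈-cartesianProduct⁺ (proj₂ (proj₂ (toward-j p v)) c∈ e) (proj₂ (proj₂ (toward-u p v)) c∈ e)

      conflicts : Fin n × Fin n → List (Fin n × Fin n)
      conflicts e with rep? e
      ... | yes p = concatMap (λ w → compatible w (in-between? w) (emb (proj₁ (find p)) w)) (allFin k)
      ... | no _ = []

      K : ℕ
      K = k * (Δ ^ k * Δ ^ k)

      conflicts-length : ∀ e → length (conflicts e) ≤ K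
      conflicts-length e with rep? e
      ... | no _ = z≤n
      ... | yes p = ≤-trans (length-concatMap-≤ _ (Δ ^ k * Δ ^ k) (λ w → compatible-length w (in-between? w) _) (allFin k))
                            (≤-reflexive (cong (_* (Δ ^ k * Δ ^ k)) (length-allFin k)))

      inner-role : ∀ {e y} → y ∈ inner e → ∃₂ λ c w → c ∈ D × key c ≡ e × w ∈ between × y ≡ emb c w
      inner-role {e} y∈ with rep? e
      ... | yes p with find p | ∈-map⁻ _ y∈
      ... | c , c∈ , eq | w , w∈ , refl = c , w , c∈ , eq , w∈ , refl

      -- The colour of a common inner vertex forces the same role in both representatives, so the
      -- second pair is among those compatible with this vertex in this role.
      conflict : ∀ {e e' y} → y ∈ inner e → y ∈ inner e' → e' ∈ conflicts e
      conflict {e} {e'} y∈ y∈' with rep? e | inner-role {e'} y∈'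
      ... | yes p | c' , w' , c'∈ , refl , w'∈ , eq with find p | ∈-map⁻ _ y∈
      ... | c , c∈ , _ | w , w∈ , refl =
        ∈-concatMap (λ w → compatible w (in-between? w) (emb c w)) (∈-allFin w)
          (compatible-∈ (in-between? w) w∈ c'∈ (subst (λ z → emb c' z ≡ emb c w) same (≡.sym eq)))
        where same : w' ≡ w
              same = trans (≡.sym (emb-χ c' w')) (trans (cong χ (≡.sym eq)) (emb-χ c w))

      open Independent _≟₂_ K conflicts

      heavy? : ∀ t → Decidable (λ (e : Fin n × Fin n) → suc t ≤ deg (proj₁ e))
      heavy? t e = suc t ≤? deg (proj₁ e)

      heavy : ℕ → List (Fin n × Fin n)
      heavy t = filter (heavy? t) pairs

      -- The branch vertices `W` have degree above `t` and colour `j` or `u`. Both ends of a heavy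
      -- pair qualify because degree grows with rank, and inner vertices do not because their roles,
      -- hence their colours, are lower.
      threshold : ∀ t → length (heavy t) ≤ (suc K * 2 ^ l) * length (filter (λ v → suc t ≤? deg v) (allFin n))
      threshold t with independent (heavy t) (filter⁺ (heavy? t) pairs-unique) (λ _ → conflicts-length _)
      ... | E , E-unique , E-sub , E-ind , len = begin
        length (heavy t) ≤⟨ len ⟩
        suc K * length E ≤⟨ *-monoʳ-≤ (suc K) (≤-trans (Topological.sparse L G free W? E E-unique inner ends walk outside disjoint)
                               (*-monoʳ-≤ (2 ^ l) (length-filter-mono W? _ (allFin n) (λ _ → proj₁)))) ⟩
        suc K * (2 ^ l * length (filter (λ v → suc t ≤? deg v) (allFin n))) ≡⟨ *-assoc (suc K) (2 ^ l) _ ⟨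
        (suc K * 2 ^ l) * length (filter (λ v → suc t ≤? deg v) (allFin n)) ∎
        where
        open ≤-Reasoning
        W : Fin n → Set
        W v = suc t ≤ deg v × (χ v ≡ j ⊎ χ v ≡ u)
        W? : Decidable W
        W? v = (suc t ≤? deg v) ×-dec ((χ v Fin.≟ j) ⊎-dec (χ v Fin.≟ u))
        E-pair : ∀ {e} → e ∈ E → e ∈ pairs × suc t ≤ deg (proj₁ e)
        E-pair p = ∈-filter⁻ (heavy? t) {xs = pairs} (E-sub p)
        ends : ∀ {e} → e ∈ E → W (proj₁ e) × W (proj₂ e) × proj₁ e ≢ proj₂ e
        ends e∈ with E-pair e∈
        ... | e∈' , big with find (pair-rep e∈')
        ... | c , c∈ , refl = (big , inj₁ (emb-χ c j)) , (≤-trans big (emb-degree c j<u) , inj₂ (emb-χ c u)) ,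
              λ eq → <-irrefl (cong ρ (trans (≡.sym (emb-χ c j)) (trans (cong χ eq) (emb-χ c u)))) j<u
        walk : ∀ {e} → e ∈ E → Walk (Adj G) (proj₁ e) (inner e) (proj₂ e)
        walk {e} e∈ with rep? e
        ... | no ¬p = ⊥-elim (¬p (pair-rep (proj₁ (E-pair e∈))))
        ... | yes p with find p
        ... | c , c∈ , refl = Walk-map (emb c) (emb-adj c) (proj₁ (proj₂ (fill-walk fill)))
        outside : ∀ {e y} → e ∈ E → y ∈ inner e → ¬ W y
        outside {e} e∈ y∈ (_ , color) with inner-role {e} y∈
        ... | c , w , c∈ , _ , w∈ , refl with proj₂ (proj₂ (fill-walk fill)) w∈ | color
        ... | w<j , _ | inj₁ eq = <-irrefl (cong ρ (trans (≡.sym (emb-χ c w)) eq)) w<j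
        ... | _ , w<u , _ | inj₂ eq = <-irrefl (cong ρ (trans (≡.sym (emb-χ c w)) eq)) w<u
        disjoint : ∀ {e e' y} → e ∈ E → e' ∈ E → y ∈ inner e → y ∈ inner e' → e ≡ e'
        disjoint {e} {e'} e∈ e'∈ y∈ y∈' with e ≟₂ e'
        ... | yes eq = eq
        ... | no ne with E-ind e∈ e'∈ ne
        ... | inj₁ h = ⊥-elim (h (conflict {e} {e'} y∈ y∈'))
        ... | inj₂ h = ⊥-elim (h (conflict {e'} {e} y∈' y∈))

      pairs-weight : ∑ pairs (deg ∘ proj₁) ≤ suc K * 2 ^ l * 2 ^ l * n
      pairs-weight = begin
        ∑ pairs (deg ∘ proj₁) ≤⟨ layer-cake pairs (allFin n) (deg ∘ proj₁) deg (suc K * 2 ^ l) threshold ⟩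
        suc K * 2 ^ l * ∑ (allFin n) deg ≤⟨ *-monoʳ-≤ (suc K * 2 ^ l) degree-sum ⟩
        suc K * 2 ^ l * (2 ^ l * n) ≡⟨ *-assoc (suc K * 2 ^ l) (2 ^ l) n ⟨
        suc K * 2 ^ l * 2 ^ l * n ∎
        where open ≤-Reasoning

      weighted : Weighted (Fin N) (Fin n × Fin n)
      weighted = record
        { _≟K_ = _≟₂_ ; κ = key ; w = deg ∘ proj₁ ; xs = D ; xs-unique = D-unique ; keys = pairs ; covered = key∈pairs
        ; n = n ; W = suc K * 2 ^ l * 2 ^ l ; d = d ; weight = pairs-weight ; dense = D-dense }

      open Thinning weighted public

      fan' : Fan B j u kept
      fan' a with deg a ≟ 0
      -- Richness is void at degree zero and would admit every `b`; but no copy maps `j` to an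
      -- isolated vertex.
      ... | yes isolated = [] , z≤n , λ {c} c∈ e → ⊥-elim (m<n⇒n≢0 (positive-degree c e) isolated)
        where
        positive-degree : ∀ c → emb c j ≡ a → 0 < deg a
        positive-degree c refl = let (x , _ , jx , _) = first-step fill j<u in ∈⇒nonempty (∈-nbrs⁺ G (emb-adj c jx))
      ... | no positive = vs , few , λ { c∈ refl → ∈-filter⁺ often? (∈-allFin _) (is-rich c∈) }
        where
        open ≤-Reasoning
        often? : Decidable (λ b → deg a ≤ B * count D (a , b))
        often? b = deg a ≤? B * count D (a , b)
        vs : List (Fin n)
        vs = filter often? (allFin n)
        at : List (Fin N)
        at = filter (λ c → emb c j Fin.≟ a) D
        module Second = Count Fin._≟_ (λ c → emb c u)
        split : ∀ b → count D (a , b) ≤ Second.count at b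
        split b = length-⊆ (filter⁺ (λ c → key c ≟₂ (a , b)) D-unique) λ p →
          let (c∈ , e) = ∈-filter⁻ (λ c → key c ≟₂ (a , b)) {xs = D} p in
          ∈-filter⁺ (λ c → emb c u Fin.≟ b) (∈-filter⁺ (λ c → emb c j Fin.≟ a) c∈ (cong proj₁ e)) (cong proj₂ e)
        -- Different partners `b` have disjoint sets of copies, together at most the `deg a` copies
        -- through `a`, and each set has at least `deg a / B` members.
        few : length vs ≤ B
        few = *-cancelʳ-≤ (length vs) B (deg a) {{≢-nonZero positive}} (begin
          length vs * deg a ≡⟨ ∑-const vs (deg a) ⟨
          ∑ vs (λ _ → deg a) ≤⟨ ∑-mono vs (λ p → proj₂ (∈-filter⁻ often? {xs = allFin n} p)) ⟩
          ∑ vs (λ b → B * count D (a , b)) ≡⟨ ∑-* vs B _ ⟩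
          B * ∑ vs (λ b → count D (a , b)) ≤⟨ *-monoʳ-≤ B (∑-mono vs (λ {b} _ → split b)) ⟩
          B * ∑ vs (Second.count at) ≤⟨ *-monoʳ-≤ B (Second.∑-count≤length at vs (filter⁺ often? (allFin⁺ n))) ⟩
          B * length at ≤⟨ *-monoʳ-≤ B (copies-at (proj₁ (proj₂ (proj₂ (first-step fill j<u)))) D-unique a) ⟩
          B * deg a ∎)

      -- For an edge of `H`, edge-disjointness leaves a single copy per key, so richness itself
      -- bounds the degree.
      low' : Adj H j u → ∀ {c} → c ∈ kept → deg (emb c j) ≤ B
      low' ju {c} c∈ = begin
        deg (emb c j) ≤⟨ is-rich c∈ ⟩
        B * length (group (key c)) ≤⟨ *-monoʳ-≤ B (length-⊆ {ys = c ∷ []} (group-unique (key c)) (λ p →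
            let e = proj₂ (group⁻ p) in here (emb-disjoint ju (cong proj₁ e) (cong proj₂ e)))) ⟩
        B * 1 ≡⟨ *-identityʳ B ⟩
        B ∎
        where open ≤-Reasoning

      -- One query enters some copy of the group of `c` at the role `x`; climbing inside that copy
      -- ends at the image of `u`, which it shares with `c`. The group is taken in `D`, where the
      -- lower climbs hold for every copy, and not in `kept`.
      up' : ∀ {s m} → 1 ≤ m → Ups (ρ j) s m D → Up (suc (k * s)) (2 ^ S * (B * m ^ k)) j u kept
      up' {s} {m} m≥1 ups {c} c∈ {st} v∈ {r} {M} h with first-step fill j<u
      ... | x , ℓ , jx , chain = succeeds-cast ≤-refl (≤-reflexive (lemma (2 ^ S) B (m ^ k) M))
            (spread jx {A = B} {m ^ k * M} refl v∈ (group-unique (key c)) (λ p → cong proj₁ (proj₂ (group⁻ p))) (is-rich c∈)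
              λ p → chain-up-k m≥1 ups chain (proj₁ (group⁻ p)) (here refl)
                (λ le v∈' → h (⊑-trans (there , there) le) (subst (_∈ _) (cong proj₂ (proj₂ (group⁻ p))) v∈')))
        where
        lemma : ∀ a b c d → a * (b * (c * d)) ≡ a * (b * c) * d
        lemma = solve-∀

    -- First phase: thinning pair by pair.

    module Phase₁ (g : ℕ) (fill? : ∀ a b → Dec (Fill a b)) where
      open Constants k l S g

      record Good (q : ℕ) (D : List (Fin N)) (j u : Fin k) : Set where
        field
          good-fan : Fan (fan q) j u D
          good-low : Adj H j u → ∀ {c} → c ∈ D → deg (emb c j) ≤ fan q
          good-up  : Up (steps k q) (cost q) j u D
      open Good public

      good-mono : ∀ {q q' D D' j u} → q ≤ q' → D' ⊆ D → Good q D j u → Good q' D' j u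
      good-mono {D = D} {D'} l sub good = record
        { good-fan = Fan-mono {D = D} {D'} fan≤ sub (good-fan good)
        ; good-low = λ a c∈ → ≤-trans (good-low good a (sub c∈)) fan≤
        ; good-up = Up-mono {D = D} {D'} (sequence-mono (steps k) (λ q → m≤m+n _ _) l)
                            (sequence-mono cost (λ q → m≤m+n _ _) l) sub (good-up good) }
        where fan≤ = sequence-mono fan (λ q → m≤m+n _ _) l

      Lower : ℕ → ℕ → List (Fin N) → Set
      Lower r q D = ∀ {i m} → Fill i m → ρ i < ρ m → ρ i < r → Good q D i m

      record Family (q : ℕ) (D : List (Fin N)) : Set where
        constructor family
        field
          unique : Unique D
          dense  : n ≤ density q * length D
      open Family public

      abstract
        improve : ∀ {q D j u} → Family q D → Fill j u → ρ j < ρ u → Lower (ρ j) q D →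
          ∃ λ D' → Family (suc q) D' × D' ⊆ D × Good (suc q) D' j u
        improve {q} {D} {j} {u} F f l lower = P.kept , family P.kept-unique P.kept-dense , P.kept⊆xs , record
          { good-fan = Fan-mono {D = P.kept} {P.kept} (m≤n+m _ _) (λ p → p) P.fan'
          ; good-low = λ a c∈ → ≤-trans (P.low' a c∈) (m≤n+m _ _)
          ; good-up = Up-mono {s = suc (k * steps k q)} {m = 2 ^ S * (P.B * cost q ^ k)} {D = P.kept} {P.kept}
                        (m≤n+m _ (steps k q)) (m≤n+m _ (cost q)) (λ p → p)
                        (P.up' (cost-positive q) (λ f l b → good-up (lower f l b))) }
          where
          pair : PairData
          pair = record
            { fill = f ; j<u = l ; d = density q ; D-unique = unique F ; Δ≥1 = fan≥1 q
            ; fans = λ f l b → good-fan (lower f l b) ; D-dense = dense F }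
          module P = Pair pair

      weaken-family : ∀ {q q' D} → q ≤ q' → Family q D → Family q' D
      weaken-family {D = D} l F = family (unique F) (≤-trans (dense F) (*-monoˡ-≤ (length D) (sequence-mono density (λ q → m≤m+n _ _) l)))

      -- Pairs with the same lower rank do not depend on one another: each needs only pairs starting
      -- strictly below, so their order in `ps` is immaterial.
      sweep : ∀ r ps {q D} → Family q D → Lower r q D →
        ∃ λ D' → Family (length ps + q) D' × D' ⊆ D ×
          (∀ {j u} → (j , u) ∈ ps → ρ j ≡ r → Fill j u → ρ j < ρ u → Good (length ps + q) D' j u)
      sweep r [] {q} {D} F lower = D , F , (λ p → p) , λ ()
      sweep r ((j , u) ∷ ps) {q} {D} F lower with sweep r ps F lower
      ... | D₁ , F₁ , sub₁ , done with fill? j u ×-dec ((ρ j <? ρ u) ×-dec (ρ j ≟ r))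
      ... | no no-step = D₁ , weaken-family (n≤1+n _) F₁ , sub₁ ,
            λ { (here refl) e f l → ⊥-elim (no-step (f , l , e)) ; (there p) e f l → good-mono (n≤1+n _) (λ p → p) (done p e f l) }
      ... | yes (f , l , refl) with improve F₁ f l (λ f l b → good-mono (m≤n+m q (length ps)) sub₁ (lower f l b))
      ... | D₂ , F₂ , sub₂ , new = D₂ , F₂ , (λ p → sub₁ (sub₂ p)) ,
            λ { (here refl) _ _ _ → new ; (there p) e f l → good-mono (n≤1+n _) sub₂ (done p e f l) }

      phase₁ : n ≤ g * N → ∀ r → ∃ λ D → Family (r * length (allPairs k)) D × Lower r (r * length (allPairs k)) D
      phase₁ h zero = allFin N , family (allFin⁺ N) (subst (λ m → n ≤ g * m) (≡.sym (length-allFin N)) h) , λ _ _ ()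
      phase₁ h (suc r) with phase₁ h r
      ... | D , F , lower with sweep r (allPairs k) F lower
      ... | D' , F' , sub , done = D' , F' , all-good
        where
        all-good : Lower (suc r) (suc r * length (allPairs k)) D'
        all-good {i} {m} f l b with ρ i ≟ r
        ... | yes e = done (∈-allPairs (i , m)) e f l
        ... | no ne = good-mono (m≤n+m _ (length (allPairs k))) sub (lower f l (≤∧≢⇒< (s≤s⁻¹ b) ne))

    record Stage : Set where
      field
        H∈ : (k , H) ∈ ℋ
        c₀ : Fin N
        fill? : ∀ a b → Dec (Fill a b)
        d Δ s m : ℕ
        Δ≥1 : 1 ≤ Δ
        m≥1 : 1 ≤ m
        D : List (Fin N)
        fans : ∀ {i u} → Fill i u → ρ i < ρ u → Fan Δ i u D
        low : ∀ {i u} → Adj H i u → ρ i < ρ u → ∀ {c} → c ∈ D → deg (emb c i) ≤ Δ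
        ups : ∀ {i u} → Fill i u → ρ i < ρ u → Up s m i u D

    -- Second phase: assembling a copy of `H`.

    module Phase₂ (Y : Stage) where
      open Stage Y
      open Descent k l S d Δ s m

      NonIsolated : Fin k → Set
      NonIsolated i = ∃ λ a → Adj H i a

      nonIsolated? : Decidable NonIsolated
      nonIsolated? i = FinP.any? (Adj? H i)

      -- The placement `t` need not come from a single copy: each role has its own witness, agreeing
      -- with `t` on that role and its later fill-in neighbours. Every edge of `H` is covered by the
      -- witness of its lower end, and colours give injectivity.
      record Partial (r : ℕ) (C : List (Fin N)) (st : State n) (t : Fin k → Fin n) (i : Fin k) : Set where
        constructor located
        field
          reached : t i ∈ visited st
          witness : Fin N
          witness∈ : witness ∈ C
          agree : emb witness i ≡ t i
          agrees : ∀ {u} → Fill i u → ρ i < ρ u → emb witness u ≡ t u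
      open Partial

      -- The roles of rank at least r have been placed by t, consistently on each role and its later fill-in neighbours.
      Placed : ℕ → List (Fin N) → State n → (Fin k → Fin n) → Set
      Placed r C st t = ∀ {i} → NonIsolated i → r ≤ ρ i → Partial r C st t i

      Completes : ℕ → List (Fin N) → ℕ → ℕ → Set
      Completes r C q M = ∀ st t → Placed r C st t → Succeeds q st M

      occurs : ∀ {st t C} → Placed 0 C st t → (∀ {a b} → Adj H a b → ρ a < ρ b → (t a , t b) ∈ seen st) → Found st
      occurs {st} {t} placed edges∈ = lose H∈ (f , injective , linked)
        where
        place : ∀ i → Dec (NonIsolated i) → Fin n
        place i (yes _) = t i
        -- Isolated roles are not explored: any vertex of the right colour serves, and colours keep
        -- the map injective.
        place i (no _) = emb c₀ i
        place-χ : ∀ i d → χ (place i d) ≡ i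
        place-χ i (yes p) = trans (cong χ (≡.sym (agree (placed p z≤n)))) (emb-χ _ i)
        place-χ i (no _) = emb-χ c₀ i
        f : Fin k → Fin n
        f i = place i (nonIsolated? i)
        injective : ∀ a b → f a ≡ f b → a ≡ b
        injective a b e = trans (≡.sym (place-χ a (nonIsolated? a))) (trans (cong χ e) (place-χ b (nonIsolated? b)))
        f-t : ∀ {i a} → Adj H i a → f i ≡ t i
        f-t {i} {a} h = on (nonIsolated? i)
          where on : ∀ d → place i d ≡ t i
                on (yes _) = refl
                on (no ¬p) = ⊥-elim (¬p (a , h))
        linked : ∀ a b → adj H a b ≡ true → Link (seen st) (f a) (f b)
        linked a b h = subst₂ (Link (seen st)) (≡.sym (f-t h)) (≡.sym (f-t (Adj-sym H h))) (oriented (<-cmp (ρ a) (ρ b)))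
          where
          oriented : _ → Link (seen st) (t a) (t b)
          oriented (tri< a<b _ _) = inj₁ (edges∈ h a<b)
          oriented (tri≈ _ e _) = ⊥-elim (Adj-irrefl H h (ρ-injective e))
          oriented (tri> _ _ b<a) = inj₂ (edges∈ (Adj-sym H h) b<a)

      placed-⊑ : ∀ {r C st st' t} → st ⊑ st' → Placed r C st t → Placed r C st' t
      placed-⊑ le placed ni h = let p = placed ni h in
        located (proj₁ le (reached p)) (witness p) (witness∈ p) (agree p) (agrees p)

      verify : ∀ ps {st t} → Placed 0 D st t →
        (∀ {st'} → st ⊑ st' → (∀ {a b} → (a , b) ∈ ps → Adj H a b → ρ a < ρ b → (t a , t b) ∈ seen st') → Found st') →
        Succeeds (length ps) st (verifyCost (length ps))
      verify [] placed h = succeeds-found (h ⊑-refl λ ())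
      verify ((a , b) ∷ ps) {st} {t} placed h with Adj? H a b ×-dec (ρ a <? ρ b)
      ... | no no-step = succeeds-cast (n≤1+n _) (m≤m+n _ _) (verify ps placed
              (λ le edges∈ → h le λ { (here refl) ab a<b → ⊥-elim (no-step (ab , a<b)) ; (there p) ad l → edges∈ p ad l }))
      ... | yes (ab , a<b) = succeeds-mono (m≤n+m _ (verifyCost (length ps)))
              (succeeds-query Δ (verifyCost (length ps)) (t b ∷ []) (reached pa) ([] ∷ []) (λ { (here refl) → adjacent })
                (∈⇒nonempty (∈-nbrs⁺ G adjacent))
                (≤-trans (subst (λ v → deg v ≤ Δ) (agree pa) (low ab a<b (witness∈ pa))) (≤-reflexive (≡.sym (*-identityʳ Δ))))
                λ { (here refl) → verify ps (placed-⊑ (there , there) placed) (λ le edges∈ → h (⊑-trans (there , there) le)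
                      λ { (here refl) _ _ → proj₂ le (here refl) ; (there p) ad l → edges∈ p ad l }) })
        where
        pa : Partial 0 D st t a
        pa = placed (b , ab) z≤n
        adjacent : Adj G (t a) (t b)
        adjacent = subst₂ (Adj G) (agree pa) (agrees pa (edge ab) a<b) (emb-adj (witness pa) ab)

      completes₀ : Completes 0 D (length (allPairs k)) (verifyCost (length (allPairs k)))
      completes₀ st t placed = verify (allPairs k) placed λ le edges∈ →
        occurs (placed-⊑ le placed) (λ {a} {b} → edges∈ (∈-allPairs (a , b)))

      record Level (r : ℕ) (C : List (Fin N)) : Set where
        constructor level
        field
          unique : Unique C
          dense : n ≤ density₂ r * length C
          within : C ⊆ D
      open Level

      _[_≔_] : (Fin k → Fin n) → Fin k → Fin n → Fin k → Fin n
      (t [ i ≔ y ]) a with a Fin.≟ i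
      ... | yes _ = y
      ... | no _ = t a

      assign-same : ∀ t i y → (t [ i ≔ y ]) i ≡ y
      assign-same t i y with i Fin.≟ i
      ... | yes _ = refl
      ... | no ne = ⊥-elim (ne refl)

      assign-other : ∀ t i y {a} → a ≢ i → (t [ i ≔ y ]) a ≡ t a
      assign-other t i y {a} ne with a Fin.≟ i
      ... | yes e = ⊥-elim (ne e)
      ... | no _ = refl

      -- The roles placed before have witnesses in the thinned family `C'`, whereas the new role is
      -- witnessed only in `C`; so the family may grow again as roles are placed.
      place : ∀ {i c st t C C'} → C' ⊆ C → c ∈ C → emb c i ∈ visited st →
        (∀ {u} → Fill i u → ρ i < ρ u → emb c u ≡ t u) → Placed (suc (ρ i)) C' st t → Placed (ρ i) C st (t [ i ≔ emb c i ])
      place {i} {c} {st} {t} {C} {C'} sub c∈ v∈ ag placed {a} ni l = by-cases (a Fin.≟ i)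
        where
        t' = t [ i ≔ emb c i ]
        later : ∀ {u} → ρ i < ρ u → t' u ≡ t u
        later l = assign-other t i (emb c i) λ { refl → <-irrefl refl l }
        by-cases : Dec (a ≡ i) → Partial (ρ i) C st t' a
        by-cases (yes refl) = located (subst (_∈ visited st) (≡.sym (assign-same t i (emb c i))) v∈) c c∈
          (≡.sym (assign-same t i (emb c i))) (λ f l → trans (ag f l) (≡.sym (later l)))
        by-cases (no ne) = let i<a = ≤∧≢⇒< l (λ e → ne (≡.sym (ρ-injective e)))
                               p = placed ni i<a in
          located (subst (_∈ visited st) (≡.sym (later i<a)) (reached p)) (witness p) (sub (witness∈ p))
            (trans (agree p) (≡.sym (later i<a))) (λ f l → trans (agrees p f l) (≡.sym (later (<-trans i<a l))))

      -- The induction runs against the exploration: completing from rank `r` on yields completing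
      -- from `suc r` on, with one more role still to be placed.
      Lowered : ℕ → List (Fin N) → ℕ → ℕ → Set
      Lowered r C q M = ∃ λ C' → Level (suc r) C' ×
        Completes (suc r) C' (q + suc (k * s + s)) (M + (rootCost r M + branchCost r M))

      skip : ∀ {r C q M} → Level r C → Completes r C q M → (∀ {i} → NonIsolated i → ρ i ≢ r) → Lowered r C q M
      skip {r} {C} lev h none = C , level (unique lev) (≤-trans (dense lev) (*-monoˡ-≤ (length C) (m≤m+n (density₂ r) _))) (within lev) ,
        λ st t placed → succeeds-cast (m≤m+n _ _) (m≤m+n _ _)
          (h st t λ ni l → let p = placed ni (≤∧≢⇒< l (λ e → none ni (≡.sym e))) in
             located (reached p) (witness p) (witness∈ p) (agree p) (agrees p))

      record Current : Set where
        field
          i : Fin k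
          {C} : List (Fin N)
          {q M} : ℕ
          lev : Level (ρ i) C
          h : Completes (ρ i) C q M

      module Role (Z : Current) where
        open Current Z

        later? : Decidable (λ u → Fill i u × ρ i < ρ u)
        later? u = fill? i u ×-dec (ρ i <? ρ u)

        laters : List (Fin k)
        laters = filter later? (allFin k)

        ∈laters : ∀ {u} → Fill i u → ρ i < ρ u → u ∈ laters
        ∈laters f l = ∈-filter⁺ later? (∈-allFin _) (f , l)

        laters⁻ : ∀ {u} → u ∈ laters → Fill i u × ρ i < ρ u
        laters⁻ p = proj₂ (∈-filter⁻ later? {xs = allFin k} p)

        -- i has the largest rank in its component: sample a copy of a lower neighbour and climb.
        root : ∀ {x} → Adj H i x → (∀ {u} → u ∉ laters) → Lowered (ρ i) C q M
        root {x} ix none = C , level (unique lev) (≤-trans (dense lev) (*-monoˡ-≤ (length C) (m≤m+n (density₂ (ρ i)) _))) (within lev) ,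
          λ st t placed → succeeds-cast steps≤ (≤-trans (m≤m+n (rootCost (ρ i) M) _) (m≤n+m _ M))
            (succeeds-sample (density₂ (ρ i) * Δ) (m * M) seeds seeds-unique enough (climb st t placed))
          where
          xi : Adj H x i
          xi = Adj-sym H ix
          x<i : ρ x < ρ i
          x<i = ≤∧≢⇒< (≮⇒≥ λ l → none (∈laters (edge ix) l)) (λ e → Adj-irrefl H xi (ρ-injective e))
          steps≤ : suc (s + q) ≤ q + suc (k * s + s)
          steps≤ = ≤-trans (≤-reflexive (+-comm (suc s) q)) (+-monoʳ-≤ q (s≤s (m≤n+m s (k * s))))
          -- The image of `i` may have large degree and be common to all copies, so sampling it
          -- directly can fail. The image of the lower neighbour `x` has degree at most `Δ`, hence
          -- belongs to at most `Δ` copies.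
          seeds : List (Fin n)
          seeds = deduplicate Fin._≟_ (map (λ c → emb c x) C)
          seeds-unique : Unique seeds
          seeds-unique = deduplicate-! (map (λ c → emb c x) C)
            where open import Data.List.Relation.Unary.Unique.DecPropositional.Properties (Fin._≟_ {n}) using (deduplicate-!)
          seed : ∀ {y} → y ∈ seeds → ∃ λ c → c ∈ C × y ≡ emb c x
          seed p = ∈-map⁻ (λ c → emb c x) (∈-deduplicate⁻ Fin._≟_ (map (λ c → emb c x) C) p)
          open Count Fin._≟_ (λ c → emb c x)
          count≤ : ∀ {y} → y ∈ seeds → count C y ≤ Δ
          count≤ p with seed p
          ... | c , c∈ , refl = ≤-trans (copies-at xi (unique lev) _) (low xi x<i (within lev c∈))
          enough : n ≤ density₂ (ρ i) * Δ * length seeds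
          enough = begin
            n ≤⟨ dense lev ⟩
            density₂ (ρ i) * length C ≤⟨ *-monoʳ-≤ (density₂ (ρ i)) (length≤∑-count C seeds (λ p → ∈-deduplicate⁺ Fin._≟_ (∈-map⁺ _ p))) ⟩
            density₂ (ρ i) * ∑ seeds (count C) ≤⟨ *-monoʳ-≤ (density₂ (ρ i)) (≤-trans (∑-mono seeds count≤) (≤-reflexive (∑-const seeds Δ))) ⟩
            density₂ (ρ i) * (length seeds * Δ) ≡⟨ lemma (density₂ (ρ i)) (length seeds) Δ ⟩
            density₂ (ρ i) * Δ * length seeds ∎
            where
            open ≤-Reasoning
            lemma : ∀ a b c → a * (b * c) ≡ a * c * b
            lemma = solve-∀
          climb : ∀ st t → Placed (suc (ρ i)) C st t → ∀ {y} → y ∈ seeds → Succeeds (s + q) (visit y st) (m * M)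
          climb st t placed p with seed p
          ... | c , c∈ , refl = ups (edge xi) x<i (within lev c∈) (here refl) λ {st'} le v∈ →
                h st' _ (place {t = t} (λ p → p) c∈ v∈ (λ f l → ⊥-elim (none (∈laters f l)))
                  (placed-⊑ (⊑-trans (there , λ p → p) le) placed))

        -- The later neighbours of i all lie in the bag of the lowest one, p, so given the image of p few tuples are possible.
        record Lowest : Set where
          field
            p : Fin k
            p∈ : p ∈ laters
            lowest : ∀ {u} → u ∈ laters → ρ p ≤ ρ u

        module Child (V : Lowest) where
          open Lowest V

          ip : Fill i p
          ip = proj₁ (laters⁻ p∈)
          i<p : ρ i < ρ p
          i<p = proj₂ (laters⁻ p∈)

          -- Eliminating `i` joins its later neighbours pairwise.
          bag : ∀ {u} → u ∈ laters → u ≢ p → Fill p u × ρ p < ρ u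
          bag u∈ ne = elim i i<p (proj₂ (laters⁻ u∈)) (ne ∘ ≡.sym) ip (proj₁ (laters⁻ u∈)) ,
                      ≤∧≢⇒< (lowest u∈) (λ e → ne (≡.sym (ρ-injective e)))

          Key : Set
          Key = Fin n × List (Fin n)

          _≟K_ : DecidableEquality Key
          _≟K_ = ≡-dec Fin._≟_ (ListP.≡-dec Fin._≟_)

          -- The first component repeats the image of `p`, whose degree is the weight of the key.
          key : Fin N → Key
          key c = emb c p , map (emb c) laters

          key-agree : ∀ {c c'} → key c ≡ key c' → ∀ {u} → u ∈ laters → emb c u ≡ emb c' u
          key-agree {c} {c'} e = go laters (cong proj₂ e)
            where go : ∀ us → map (emb c) us ≡ map (emb c') us → ∀ {u} → u ∈ us → emb c u ≡ emb c' u
                  go (_ ∷ _) e (here refl) = ListP.∷-injectiveˡ e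
                  go (_ ∷ us) e (there q) = go us (ListP.∷-injectiveʳ e) q

          options : ∀ u → Dec (u ≡ p) → Fin n → List (Fin n)
          options u (yes _) a = a ∷ []
          options u (no ne) a with Any.any? (u Fin.≟_) laters
          ... | yes u∈ = proj₁ (fans (proj₁ (bag u∈ ne)) (proj₂ (bag u∈ ne)) a)
          ... | no _ = []

          options-length : ∀ u d a → length (options u d a) ≤ Δ
          options-length u (yes _) a = Δ≥1
          options-length u (no ne) a with Any.any? (u Fin.≟_) laters
          ... | yes u∈ = proj₁ (proj₂ (fans (proj₁ (bag u∈ ne)) (proj₂ (bag u∈ ne)) a))
          ... | no _ = z≤n

          options-∈ : ∀ {u} d → u ∈ laters → ∀ {c a} → c ∈ D → emb c p ≡ a → emb c u ∈ options u d a
          options-∈ (yes refl) u∈ c∈ e = here e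
          options-∈ {u} (no ne) u∈ {a = a} c∈ e with Any.any? (u Fin.≟_) laters
          ... | yes u∈' = proj₂ (proj₂ (fans (proj₁ (bag u∈' ne)) (proj₂ (bag u∈' ne)) a)) c∈ e
          ... | no ∉ = ⊥-elim (∉ u∈)

          tuples : List (Fin k) → Fin n → List (List (Fin n))
          tuples [] a = [] ∷ []
          tuples (u ∷ us) a = concatMap (λ v → map (v ∷_) (tuples us a)) (options u (u Fin.≟ p) a)

          tuples-length : ∀ us a → length (tuples us a) ≤ Δ ^ length us
          tuples-length [] a = ≤-refl
          tuples-length (u ∷ us) a = ≤-trans
            (length-concatMap-≤ _ (Δ ^ length us) (λ v → ≤-trans (≤-reflexive (length-map (v ∷_) (tuples us a))) (tuples-length us a)) (options u (u Fin.≟ p) a))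
            (*-monoˡ-≤ (Δ ^ length us) (options-length u (u Fin.≟ p) a))

          tuples-∈ : ∀ us → us ⊆ laters → ∀ {c a} → c ∈ D → emb c p ≡ a → map (emb c) us ∈ tuples us a
          tuples-∈ [] sub c∈ e = here refl
          tuples-∈ (u ∷ us) sub {c} {a} c∈ e = ∈-concatMap (λ v → map (v ∷_) (tuples us a)) (options-∈ (u Fin.≟ p) (sub (here refl)) c∈ e)
            (∈-map⁺ (emb c u ∷_) (tuples-∈ us (sub ∘ there) c∈ e))

          keys : List Key
          keys = concatMap (λ a → map (a ,_) (tuples laters a)) (allFin n)

          key∈keys : ∀ {c} → c ∈ C → key c ∈ keys
          key∈keys {c} c∈ = ∈-concatMap (λ a → map (a ,_) (tuples laters a)) (∈-allFin (emb c p))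
            (∈-map⁺ (emb c p ,_) (tuples-∈ laters (λ q → q) (within lev c∈) refl))

          keys-weight : ∑ keys (deg ∘ proj₁) ≤ Δ ^ k * 2 ^ l * n
          keys-weight = begin
            ∑ keys (deg ∘ proj₁) ≡⟨ ∑-concatMap (λ a → map (a ,_) (tuples laters a)) (allFin n) (deg ∘ proj₁) ⟩
            ∑ (allFin n) (λ a → ∑ (map (a ,_) (tuples laters a)) (deg ∘ proj₁)) ≤⟨ ∑-mono (allFin n) (λ {a} _ → each a) ⟩
            ∑ (allFin n) (λ a → Δ ^ k * deg a) ≡⟨ ∑-* (allFin n) (Δ ^ k) deg ⟩
            Δ ^ k * ∑ (allFin n) deg ≤⟨ *-monoʳ-≤ (Δ ^ k) degree-sum ⟩
            Δ ^ k * (2 ^ l * n) ≡⟨ *-assoc (Δ ^ k) (2 ^ l) n ⟨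
            Δ ^ k * 2 ^ l * n ∎
            where
            open ≤-Reasoning
            each : ∀ a → ∑ (map (a ,_) (tuples laters a)) (deg ∘ proj₁) ≤ Δ ^ k * deg a
            each a = begin
              ∑ (map (a ,_) (tuples laters a)) (deg ∘ proj₁) ≡⟨ ∑-map (a ,_) (tuples laters a) _ ⟩
              ∑ (tuples laters a) (λ _ → deg a) ≡⟨ ∑-const (tuples laters a) (deg a) ⟩
              length (tuples laters a) * deg a ≤⟨ *-monoˡ-≤ (deg a) (≤-trans (tuples-length laters a)
                 (^-monoʳ-≤ Δ {{>-nonZero Δ≥1}} (≤-trans (length-filter later? (allFin k)) (≤-reflexive (length-allFin k))))) ⟩
              Δ ^ k * deg a ∎

          weighted : Weighted (Fin N) Key
          weighted = record
            { _≟K_ = _≟K_ ; κ = key ; w = deg ∘ proj₁ ; xs = C ; xs-unique = unique lev ; keys = keys ; covered = key∈keys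
            ; n = n ; W = Δ ^ k * 2 ^ l ; d = density₂ (ρ i) ; weight = keys-weight ; dense = dense lev }

          open Thinning weighted

          child : NonIsolated p → Lowered (ρ i) C q M
          child nip = kept , level kept-unique kept-dense (λ c∈ → within lev (kept⊆xs c∈)) , descend
            where
            descend : Completes (suc (ρ i)) kept (q + suc (k * s + s)) (M + (rootCost (ρ i) M + branchCost (ρ i) M))
            -- The witness `c` of `p` is kept, hence rich: a query at the image of `p` enters a copy
            -- `c'` with the same key. Climbing in `c'` reaches its image of `i`, and `c'` agrees
            -- with `t` on all later neighbours of `i`, as `c` does.
            descend st t placed with neighbour-below ip i<p
            ... | x , ℓ , px , chain = succeeds-cast steps≤ (≤-trans (m≤n+m _ (rootCost (ρ i) M)) (m≤n+m _ M))
                  (spread px {A = B} {m ^ k * M} (agree pp) (reached pp) (group-unique (key c))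
                    (λ a → trans (cong proj₁ (proj₂ (group⁻ a))) (agree pp))
                    (subst (λ v → deg v ≤ B * count C (key c)) (agree pp) (is-rich (witness∈ pp)))
                    λ {c'} a → chain-up-k {r = ρ i} m≥1 (λ f l _ → ups f l) chain (within lev (proj₁ (group⁻ a))) (here refl)
                      (λ {st'} le v∈ → h st' _ (place {t = t} kept⊆xs (proj₁ (group⁻ a)) v∈
                        (λ f l → trans (key-agree (proj₂ (group⁻ a)) (∈laters f l)) (witness-agrees (∈laters f l)))
                        (placed-⊑ (⊑-trans (there , there) le) placed))))
              where
              pp : Partial (suc (ρ i)) kept st t p
              pp = placed nip i<p
              c : Fin N
              c = witness pp
              steps≤ : suc (k * s + q) ≤ q + suc (k * s + s)
              steps≤ = ≤-trans (≤-reflexive (+-comm (suc (k * s)) q)) (+-monoʳ-≤ q (s≤s (m≤m+n (k * s) s)))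
              witness-agrees : ∀ {u} → u ∈ laters → emb c u ≡ t u
              witness-agrees {u} u∈ with u Fin.≟ p
              ... | yes refl = agree pp
              ... | no ne = agrees pp (proj₁ (bag u∈ ne)) (proj₂ (bag u∈ ne))

      filled-nonIsolated : ∀ {a b} → Fill a b → NonIsolated a × NonIsolated b
      filled-nonIsolated (edge {a} {b} e) = (b , e) , (a , Adj-sym H e)
      filled-nonIsolated (elim m _ _ _ fa fb) = proj₂ (filled-nonIsolated fa) , proj₂ (filled-nonIsolated fb)

      lower-level : ∀ {r C q M} → Level r C → Completes r C q M → Lowered r C q M
      lower-level {r} {C} {q} {M} lev h with FinP.any? (λ i → (ρ i ≟ r) ×-dec nonIsolated? i)
      ... | no none = skip lev h (λ ni e → none (_ , e , ni))
      ... | yes (i , refl , (x , ix)) = by-laters laters refl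
        where
        current : Current
        current = record { i = i ; lev = lev ; h = h }
        open Role current
        by-laters : ∀ us → laters ≡ us → Lowered (ρ i) C q M
        by-laters [] eq = root ix λ u∈ → ∉[] (subst (_ ∈_) eq u∈)
        by-laters (u ∷ us) eq with argmin ρ u us
        ... | p , p∈ , lowest = Child.child (record { p∈ = p∈' ; lowest = λ z∈ → lowest (subst (_ ∈_) eq z∈) })
                (proj₂ (filled-nonIsolated (proj₁ (laters⁻ p∈'))))
          where p∈' = subst (p ∈_) (≡.sym eq) p∈

      phase₂ : Unique D → n ≤ d * length D → ∀ r → ∃ λ C → Level r C ×
        Completes r C (steps₂ k s (length (allPairs k)) r) (cost₂ (length (allPairs k)) r)
      phase₂ u dn zero = D , level u dn (λ p → p) , completes₀
      phase₂ u dn (suc r) = let (_ , lev , h) = phase₂ u dn r in lower-level lev h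

    copies-found : (k , H) ∈ ℋ → Fin N → ∀ g → n ≤ g * N → (∀ a b → Dec (Fill a b)) →
      Succeeds (totalSteps k) initial (totalCost k l S g)
    copies-found H∈ c₀ g enough fill? with Phase₁.phase₁ g fill? enough (suc k)
    -- At rank `suc k` no role is placed yet, so an arbitrary `t` will do.
    ... | D , F , lower = proj₂ (proj₂ (phase₂ (unique F) (dense F) (suc k))) initial (λ _ → inhabited)
          (λ {i} _ h → ⊥-elim (<⇒≱ h (ρ≤k i)))
      where
      open Constants k l S g
      open Phase₁ g fill? using (Good; good-fan; good-low; good-up; unique; dense)
      good : ∀ {i m} → Fill i m → ρ i < ρ m → Good (rounds k) D i m
      good {i} f l = lower f l (s≤s (ρ≤k i))
      stage : Stage
      stage = record
        { H∈ = H∈ ; c₀ = c₀ ; fill? = fill? ; d = density (rounds k) ; Δ≥1 = fan≥1 (rounds k) ; m≥1 = cost-positive (rounds k) ; D = D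
        ; fans = λ f l → good-fan (good f l) ; low = λ a l → good-low (good (edge a) l) a ; ups = λ f l → good-up (good f l) }
      open Phase₂ stage

-- Colouring, degree ranks and greedy extraction of copies.

module Regularity where

  open import Data.Nat
  open import Data.Nat.Properties
  import Data.List.Relation.Unary.All.Properties as AllP
  open Counting
  open Minors using (Adj; Adj?; Adj-sym; Adj-irrefl; graphOf; does⇒; ⇒does)
  open Exploration

  module Colouring {k : ℕ} (a₀ : Fin k) where

    Compatible : Maybe (Fin k) → Fin k → Set
    Compatible nothing b = ⊤
    Compatible (just a) b = b ≡ a

    compatible? : ∀ c b → Dec (Compatible c b)
    compatible? nothing b = yes tt
    compatible? (just a) b = b Fin.≟ a

    Respects : ∀ {n} → (Fin n → Fin k) → (Fin n → Maybe (Fin k)) → Set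
    Respects χ c = ∀ v → Compatible (c v) (χ v)

    respects? : ∀ {n} (χ : Fin n → Fin k) c → Dec (Respects χ c)
    respects? χ c = FinP.all? (λ v → compatible? (c v) (χ v))

    weight : Maybe (Fin k) → ℕ
    weight nothing = 1
    weight (just _) = k

    -- The reciprocal of the probability that a uniformly random colouring meets the demands of `c`.
    factor : ∀ {n} → (Fin n → Maybe (Fin k)) → ℕ
    factor {zero} c = 1
    factor {suc n} c = weight (c zero) * factor (c ∘ suc)

    ∑-filter : ∀ {A : Set} {P : A → Set} (P? : Decidable P) xs (f : A → ℕ) → ∑ (filter P? xs) f ≡ ∑ xs (λ x → ⟦ P? x ⟧ * f x)
    ∑-filter P? [] f = refl
    ∑-filter P? (x ∷ xs) f with P? x
    ... | yes _ = cong₂ _+_ (≡.sym (+-identityʳ (f x))) (∑-filter P? xs f)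
    ... | no _ = ∑-filter P? xs f

    ∑-filter-filter : ∀ {A : Set} {P Q R : A → Set} (P? : Decidable P) (Q? : Decidable Q) (R? : Decidable R) xs {f g : A → ℕ} →
      (∀ {x} → P x → Q x → R x) → (∀ x → f x ≤ g x) → ∑ (filter P? (filter Q? xs)) f ≤ ∑ (filter R? xs) g
    ∑-filter-filter P? Q? R? [] h le = z≤n
    ∑-filter-filter P? Q? R? (x ∷ xs) h le with Q? x
    ∑-filter-filter P? Q? R? (x ∷ xs) h le | yes q with P? x | R? x
    ... | yes p | yes r = +-mono-≤ (le x) (∑-filter-filter P? Q? R? xs h le)
    ... | yes p | no ¬r = ⊥-elim (¬r (h p q))
    ... | no _ | yes _ = ≤-trans (∑-filter-filter P? Q? R? xs h le) (m≤n+m _ _)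
    ... | no _ | no _ = ∑-filter-filter P? Q? R? xs h le
    ∑-filter-filter P? Q? R? (x ∷ xs) h le | no _ with R? x
    ... | yes _ = ≤-trans (∑-filter-filter P? Q? R? xs h le) (m≤n+m _ _)
    ... | no _ = ∑-filter-filter P? Q? R? xs h le

    -- The expected weight does not drop under a random colour: a free vertex accepts every colour
    -- at weight 1, a demand accepts a single colour at weight `k`.
    choices : ∀ c w → k * w ≤ ∑ (allFin k) (λ a → ⟦ compatible? c a ⟧ * (w * weight c))
    choices nothing w = ≤-reflexive (≡.sym (trans (∑-const (allFin k) _) (cong₂ _*_ (length-allFin k) (trans (+-identityʳ _) (*-identityʳ w)))))
    choices (just a) w = ≤-trans (≤-reflexive (trans (*-comm k w) (at a)))
      (∈⇒≤∑ (λ b → ⟦ b Fin.≟ a ⟧ * (w * k)) (∈-allFin a))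
      where at : ∀ b → w * k ≡ ⟦ b Fin.≟ b ⟧ * (w * k)
            at b with b Fin.≟ b
            ... | yes _ = ≡.sym (+-identityʳ _)
            ... | no ne = ⊥-elim (ne refl)

    share : ∀ {A : Set} {n} → List A → (A → Fin (suc n) → Maybe (Fin k)) → (A → ℕ) → Fin k → ℕ
    share xs con ω a = ∑ (filter (λ x → compatible? (con x zero) a) xs) (λ x → ω x * weight (con x zero))

    -- The method of conditional expectations, one vertex at a time.
    colouring : ∀ {A : Set} n (xs : List A) (con : A → Fin n → Maybe (Fin k)) (ω : A → ℕ) →
      ∃ λ χ → ∑ xs ω ≤ ∑ (filter (λ x → respects? χ (con x)) xs) (λ x → ω x * factor (con x))
    colouring zero xs con ω = (λ ()) , ≤-reflexive (≡.sym (trans (∑-filter (λ x → respects? (λ ()) (con x)) xs _) (∑-cong xs same)))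
      where same : ∀ x → ⟦ respects? (λ ()) (con x) ⟧ * (ω x * 1) ≡ ω x
            same x with respects? (λ ()) (con x)
            ... | yes _ = trans (+-identityʳ _) (*-identityʳ _)
            ... | no ¬r = ⊥-elim (¬r λ ())
    colouring {A} (suc n) xs con ω with ∃-max (share xs con ω) (allFin k) (∈⇒nonempty (∈-allFin a₀))
    ... | a , best with colouring n (filter (λ x → compatible? (con x zero) a) xs) (λ x → con x ∘ suc) (λ x → ω x * weight (con x zero))
    ... | χ , h = χ' , (begin
      ∑ xs ω ≤⟨ *-cancelˡ-≤ k {{FinP.nonZeroIndex a₀}} (begin
        k * ∑ xs ω ≡⟨ ∑-* xs k ω ⟨
        ∑ xs (λ x → k * ω x) ≤⟨ ∑-mono xs (λ {x} _ → choices (con x zero) (ω x)) ⟩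
        ∑ xs (λ x → ∑ (allFin k) (λ a → ⟦ compatible? (con x zero) a ⟧ * (ω x * weight (con x zero)))) ≡⟨ ∑-swap xs (allFin k) _ ⟩
        ∑ (allFin k) (λ a → ∑ xs (λ x → ⟦ compatible? (con x zero) a ⟧ * (ω x * weight (con x zero))))
          ≡⟨ ∑-cong (allFin k) (λ a → ≡.sym (∑-filter (λ x → compatible? (con x zero) a) xs _)) ⟩
        ∑ (allFin k) (share xs con ω) ≤⟨ best ⟩
        length (allFin k) * share xs con ω a ≡⟨ cong (_* share xs con ω a) (length-allFin k) ⟩
        k * share xs con ω a ∎) ⟩
      share xs con ω a ≤⟨ h ⟩
      ∑ (filter (λ x → respects? χ (con x ∘ suc)) (filter (λ x → compatible? (con x zero) a) xs)) (λ x → ω x * weight (con x zero) * factor (con x ∘ suc))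
        ≤⟨ ∑-filter-filter _ _ (λ x → respects? χ' (con x)) xs (λ r c → λ { zero → c ; (suc v) → r v })
             (λ x → ≤-reflexive (*-assoc (ω x) (weight (con x zero)) _)) ⟩
      ∑ (filter (λ x → respects? χ' (con x)) xs) (λ x → ω x * factor (con x)) ∎)
      where
      open ≤-Reasoning
      χ' : Fin (suc n) → Fin k
      χ' zero = a
      χ' (suc v) = χ v

    demands : ∀ {n} → (Fin n → Maybe (Fin k)) → ℕ
    demands {zero} c = 0
    demands {suc n} c with c zero
    ... | nothing = demands (c ∘ suc)
    ... | just _ = suc (demands (c ∘ suc))

    factor≡ : ∀ {n} (c : Fin n → Maybe (Fin k)) → factor c ≡ k ^ demands c
    factor≡ {zero} c = refl
    factor≡ {suc n} c with c zero
    ... | nothing = trans (+-identityʳ _) (factor≡ (c ∘ suc))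
    ... | just _ = cong (k *_) (factor≡ (c ∘ suc))

    -- The demanded colours are pairwise distinct. `used` collects those of earlier vertices, so
    -- demands and used colours together fit into `k` colours.
    demands-≤ : ∀ {n} (c : Fin n → Maybe (Fin k)) (used : List (Fin k)) → Unique used →
      (∀ {v v' a} → c v ≡ just a → c v' ≡ just a → v ≡ v') → (∀ {v a} → c v ≡ just a → a ∉ used) → demands c + length used ≤ k
    demands-≤ {zero} c used u inj fresh = ≤-trans (length-⊆ u (λ _ → ∈-allFin _)) (≤-reflexive (length-allFin k))
    demands-≤ {suc n} c used u inj fresh with c zero in eq
    ... | nothing = demands-≤ (c ∘ suc) used u (λ p q → FinP.suc-injective (inj p q)) fresh
    ... | just a = ≤-trans (≤-reflexive (≡.sym (+-suc (demands (c ∘ suc)) (length used))))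
          (demands-≤ (c ∘ suc) (a ∷ used) (All.tabulate (λ { p refl → fresh eq p }) ∷ u) (λ p q → FinP.suc-injective (inj p q))
            λ { p (here refl) → 0≢suc (inj eq p) ; p (there q) → fresh p q })
      where 0≢suc : ∀ {n} {v : Fin n} → zero ≢ suc v
            0≢suc ()

    role-of : ∀ {n} (f : Fin k → Fin n) → Fin n → Maybe (Fin k)
    role-of f v with FinP.any? (λ a → f a Fin.≟ v)
    ... | yes (a , _) = just a
    ... | no _ = nothing

    role-of⁻ : ∀ {n} (f : Fin k → Fin n) {v a} → role-of f v ≡ just a → f a ≡ v
    role-of⁻ f {v} e with FinP.any? (λ a → f a Fin.≟ v)
    role-of⁻ f refl | yes (a , p) = p

    role-of⁺ : ∀ {n} (f : Fin k → Fin n) → (∀ a b → f a ≡ f b → a ≡ b) → ∀ a → role-of f (f a) ≡ just a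
    role-of⁺ f inj a with FinP.any? (λ b → f b Fin.≟ f a)
    ... | yes (b , e) = cong just (inj b a e)
    ... | no none = ⊥-elim (none (a , refl))

    rainbow : ∀ {n} (fs : List (Fin k → Fin n)) → All (λ f → ∀ a b → f a ≡ f b → a ≡ b) fs →
      ∃ λ (χ : Fin n → Fin k) → length fs ≤ k ^ k * length (filter (λ f → respects? χ (role-of f)) fs)
    rainbow {n} fs inj with colouring n fs role-of (λ _ → 1)
    ... | χ , h = χ , (begin
      length fs ≡⟨ length≡∑ fs ⟩
      ∑ fs (λ _ → 1) ≤⟨ h ⟩
      ∑ good (λ f → 1 * factor (role-of f)) ≤⟨ ∑-mono good (λ {f} _ → ≤-trans (≤-reflexive (trans (+-identityʳ _) (factor≡ (role-of f))))
           (^-monoʳ-≤ k {{FinP.nonZeroIndex a₀}} (≤-trans (≤-reflexive (≡.sym (+-identityʳ _))) (demands-≤ (role-of f) [] [] (λ p q → trans (≡.sym (role-of⁻ f p)) (role-of⁻ f q)) λ _ ())))) ⟩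
      ∑ good (λ _ → k ^ k) ≡⟨ ∑-const good (k ^ k) ⟩
      length good * k ^ k ≡⟨ *-comm (length good) (k ^ k) ⟩
      k ^ k * length good ∎)
      where
      open ≤-Reasoning
      good : List (Fin k → Fin n)
      good = filter (λ f → respects? χ (role-of f)) fs

    rainbow-colour : ∀ {n} {χ : Fin n → Fin k} f → (∀ a b → f a ≡ f b → a ≡ b) → Respects χ (role-of f) → ∀ a → χ (f a) ≡ a
    rainbow-colour {χ = χ} f inj r a = subst (λ c → Compatible c (χ (f a))) (role-of⁺ f inj a) (r (f a))

  module Rank {n} (deg : Fin n → ℕ) (deg≤n : ∀ v → deg v ≤ n) where

    -- The lexicographic order by degree and then by vertex, which breaks ties between equal
    -- degrees.
    code : Fin n → Fin (suc n * n)
    code v = combine (fromℕ< (s≤s (deg≤n v))) v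

    position : Fin n → ℕ
    position v = toℕ (code v)

    position-injective : ∀ {v w} → position v ≡ position w → v ≡ w
    position-injective {v} {w} e = FinP.combine-injectiveʳ (fromℕ< (s≤s (deg≤n v))) v (fromℕ< (s≤s (deg≤n w))) w (FinP.toℕ-injective e)

    position-degree : ∀ {v w} → position v < position w → deg v ≤ deg w
    position-degree {v} {w} l = ≮⇒≥ λ w<v → <-asym l (FinP.combine-monoˡ-< w v
      (subst₂ _<_ (≡.sym (FinP.toℕ-fromℕ< (s≤s (deg≤n w)))) (≡.sym (FinP.toℕ-fromℕ< (s≤s (deg≤n v)))) w<v))

    module _ {k} (f : Fin k → Fin n) where

      smaller? : ∀ a → Decidable (λ b → position (f b) < position (f a))
      smaller? a b = position (f b) <? position (f a)

      rank : Fin k → ℕ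
      rank a = length (filter (smaller? a) (allFin k))

      rank≤k : ∀ a → rank a ≤ k
      rank≤k a = ≤-trans (length-filter (smaller? a) (allFin k)) (≤-reflexive (length-allFin k))

      rank-position : ∀ {a b} → rank a < rank b → position (f a) < position (f b)
      rank-position {a} {b} l = ≰⇒> λ h → <⇒≱ l (length-filter-mono (smaller? b) (smaller? a) (allFin k) (λ _ q → <-≤-trans q h))

      rank-mono-< : ∀ {a b} → position (f a) < position (f b) → rank a < rank b
      rank-mono-< {a} {b} l = length-⊆
        (All.tabulate (λ { p refl → <-irrefl refl (proj₂ (∈-filter⁻ (smaller? a) {xs = allFin k} p)) }) ∷ filter⁺ (smaller? a) (allFin⁺ k))
        λ { (here refl) → ∈-filter⁺ (smaller? b) (∈-allFin a) l
          ; (there p) → ∈-filter⁺ (smaller? b) (∈-allFin _) (<-trans (proj₂ (∈-filter⁻ (smaller? a) {xs = allFin k} p)) l) }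

      rank-injective : (∀ a b → f a ≡ f b → a ≡ b) → ∀ {a b} → rank a ≡ rank b → a ≡ b
      rank-injective inj {a} {b} e with <-cmp (position (f a)) (position (f b))
      ... | tri< l _ _ = ⊥-elim (<-irrefl e (rank-mono-< l))
      ... | tri≈ _ q _ = inj a b (position-injective q)
      ... | tri> _ _ l = ⊥-elim (<-irrefl (≡.sym e) (rank-mono-< l))

  module Extraction (ℋ : List AnyGraph) {n : ℕ} where

    size : Fin (length ℋ) → ℕ
    size i = proj₁ (lookup ℋ i)

    member : ∀ i → Graph (size i)
    member i = proj₂ (lookup ℋ i)

    Map : Fin (length ℋ) → Set
    Map i = Fin (size i) → Fin n

    IsCopy : Graph n → ∀ i → Map i → Set
    IsCopy G i f = (∀ a b → f a ≡ f b → a ≡ b) × (∀ a b → Adj (member i) a b → Adj G (f a) (f b))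

    Disjoint : Σ _ Map → Σ _ Map → Set
    Disjoint (i , f) (j , h) = ∀ a b a' b' → Adj (member i) a b → Adj (member j) a' b' → f a ≡ h a' → f b ≢ h b'

    pairsOf : Graph n → List (Fin n × Fin n)
    pairsOf G = filter (λ e → Adj? G (proj₁ e) (proj₂ e)) (allPairs n)

    copy? : ∀ G i → Dec (∃ λ f → IsCopy G i f)
    copy? G i = map′ (λ (f , inj , h) → f , inj , λ a b e → from (h a b e)) (λ (f , inj , h) → f , inj , λ a b e → inj₁ (to (h a b e)))
                     (occurs? (lookup ℋ i) (pairsOf G))
      where
      to : ∀ {x y} → Adj G x y → (x , y) ∈ pairsOf G
      to e = ∈-filter⁺ _ (∈-allPairs _) e
      back : ∀ {x y} → (x , y) ∈ pairsOf G → Adj G x y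
      back p = proj₂ (∈-filter⁻ (λ e → Adj? G (proj₁ e) (proj₂ e)) {xs = allPairs n} p)
      from : ∀ {x y} → Link (pairsOf G) x y → Adj G x y
      from (inj₁ p) = back p
      from (inj₂ p) = Adj-sym G (back p)

    module Remove (G : Graph n) (i : Fin (length ℋ)) (f : Map i) where

      Hit : Fin n → Fin n → Set
      Hit x y = ∃₂ λ a b → Adj (member i) a b × f a ≡ x × f b ≡ y

      hit? : ∀ x y → Dec (Hit x y)
      hit? x y = FinP.any? λ a → FinP.any? λ b → Adj? (member i) a b ×-dec ((f a Fin.≟ x) ×-dec (f b Fin.≟ y))

      remaining? : ∀ x y → Dec (Adj G x y × ¬ Hit x y)
      remaining? x y = Adj? G x y ×-dec ¬? (hit? x y)

      G' : Graph n
      G' = graphOf remaining? (λ (e , nh) → Adj-sym G e , λ (a , b , ab , p , q) → nh (b , a , Adj-sym (member i) ab , q , p))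
                              (λ (e , _) → Adj-irrefl G e refl)

      G'⊆G : SpanningSub G' G
      G'⊆G x y e = proj₁ (does⇒ (remaining? x y) e)

      unhit : ∀ {x y} → Adj G' x y → ¬ Hit x y
      unhit {x} {y} e = proj₂ (does⇒ (remaining? x y) e)

      edges-removed : edges G ≤ edges G' + size i * size i
      edges-removed = begin
        edges G ≤⟨ length-⊆ (filter⁺ (T? ∘ ordered G) (allPairs-unique n)) split ⟩
        length (edgeList G' ++ image) ≡⟨ length-++ (edgeList G') ⟩
        edges G' + length image ≡⟨ cong (edges G' +_) (trans (length-map image-of (allPairs (size i)))
                      (trans (length-cartesianProduct (allFin (size i)) (allFin (size i))) (cong₂ _*_ (length-allFin (size i)) (length-allFin (size i))))) ⟩
        edges G' + size i * size i ∎
        where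
        open ≤-Reasoning
        ordered : Graph n → Fin n × Fin n → _
        ordered G p = adj G (proj₁ p) (proj₂ p) ∧ (toℕ (proj₁ p) <ᵇ toℕ (proj₂ p))
        edgeList : Graph n → List (Fin n × Fin n)
        edgeList G = filter (T? ∘ ordered G) (allPairs n)
        image-of : Fin (size i) × Fin (size i) → Fin n × Fin n
        image-of (a , b) = f a , f b
        image : List (Fin n × Fin n)
        image = map image-of (allPairs (size i))
        T-∧ : ∀ {b c} → T (b ∧ c) → b ≡ true × T c
        T-∧ {true} t = refl , t
        ∧-T : ∀ {b c} → b ≡ true → T c → T (b ∧ c)
        ∧-T refl t = t
        split : ∀ {e} → e ∈ edgeList G → e ∈ edgeList G' ++ image
        split {x , y} p with ∈-filter⁻ (T? ∘ ordered G) {xs = allPairs n} p | hit? x y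
        ... | _ , t | yes (a , b , _ , refl , refl) = ∈-++⁺ʳ (edgeList G') (∈-map⁺ image-of (∈-allPairs (a , b)))
        ... | e∈ , t | no nh = let (xy , lt) = T-∧ {adj G x y} t in
              ∈-++⁺ˡ (∈-filter⁺ (T? ∘ ordered G') e∈ (∧-T (⇒does (remaining? x y) (xy , nh)) lt))

    sizes : ℕ
    sizes = ∑ (allFin (length ℋ)) (λ i → size i * size i)

    Packing : Graph n → ℕ → Set
    Packing G M = ∃ λ xs → length xs ≡ M × All (λ x → IsCopy G (proj₁ x) (proj₂ x)) xs × AllPairs Disjoint xs

    FreeRemainder : Graph n → ℕ → Set
    FreeRemainder G M = ∃₂ λ G' T → SpanningSub G' G × Free ℋ G' × edges G ≤ edges G' + sizes * T × T < M

    -- Copies are taken greedily and their edges removed; later copies live in the remainder and are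
    -- thus edge-disjoint from earlier ones. The bound `M` is what stops the process, since a copy
    -- of an edgeless member removes nothing.
    extract : ∀ M G → Packing G M ⊎ FreeRemainder G M
    extract zero G = inj₁ ([] , refl , [] , [])
    extract (suc M) G with FinP.any? (copy? G)
    ... | no none = inj₂ (G , 0 , (λ _ _ e → e) ,
            (λ H p (f , inj , h) → none (Any.index p , subst (λ H → Σ (Fin (proj₁ H) → Fin n) λ f → (∀ a b → f a ≡ f b → a ≡ b) × (∀ a b → Adj (proj₂ H) a b → Adj G (f a) (f b)))
                (lookup-index p) (f , (λ a b → inj) , h))) , m≤m+n _ _ , s≤s z≤n)
    ... | yes (i , f , inj , h) with extract M (Remove.G' G i f)
    ... | inj₁ (xs , len , copies , disjoint) = inj₁ ((i , f) ∷ xs , cong suc len ,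
            (inj , h) ∷ All.map (λ (inj' , h') → inj' , λ a b e → G'⊆G _ _ (h' a b e)) copies ,
            All.map (λ (_ , h') a b a' b' ab a'b' e e' → unhit (h' a' b' a'b') (a , b , ab , e , e')) copies ∷ disjoint)
      where open Remove G i f
    ... | inj₂ (G'' , T , sub , fr , bound , lt) = inj₂ (G'' , suc T , (λ x y e → G'⊆G x y (sub x y e)) , fr , (begin
            edges G ≤⟨ edges-removed ⟩
            edges G' + size i * size i ≤⟨ +-mono-≤ bound (∈⇒≤∑ (λ i → size i * size i) (∈-allFin i)) ⟩
            edges G'' + sizes * T + sizes ≡⟨ lemma (edges G'') sizes T ⟩
            edges G'' + sizes * suc T ∎) , s≤s lt)
      where
      open Remove G i f
      open ≤-Reasoning
      lemma : ∀ a s t → a + s * t + s ≡ a + s * suc t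
      lemma a s t = trans (+-assoc a (s * t) s) (cong (a +_) (trans (+-comm (s * t) s) (≡.sym (*-suc s t))))

    select : ∀ i → List (Σ _ Map) → List (Map i)
    select i [] = []
    select i ((j , f) ∷ xs) with j Fin.≟ i
    ... | yes refl = f ∷ select i xs
    ... | no _ = select i xs

    length-select : ∀ xs → length xs ≤ ∑ (allFin (length ℋ)) (λ i → length (select i xs))
    length-select [] = z≤n
    length-select ((j , f) ∷ xs) = begin
      suc (length xs) ≤⟨ +-mono-≤ (≤-trans (at j) (∈⇒≤∑ (λ i → ⟦ j Fin.≟ i ⟧) (∈-allFin j))) (length-select xs) ⟩
      ∑ (allFin (length ℋ)) (λ i → ⟦ j Fin.≟ i ⟧) + ∑ (allFin (length ℋ)) (λ i → length (select i xs)) ≡⟨ ∑-+ (allFin (length ℋ)) _ _ ⟨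
      ∑ (allFin (length ℋ)) (λ i → ⟦ j Fin.≟ i ⟧ + length (select i xs)) ≡⟨ ∑-cong (allFin (length ℋ)) same ⟩
      ∑ (allFin (length ℋ)) (λ i → length (select i ((j , f) ∷ xs))) ∎
      where
      open ≤-Reasoning
      at : ∀ j → 1 ≤ ⟦ j Fin.≟ j ⟧
      at j with j Fin.≟ j
      ... | yes _ = ≤-refl
      ... | no ne = ⊥-elim (ne refl)
      same : ∀ i → ⟦ j Fin.≟ i ⟧ + length (select i xs) ≡ length (select i ((j , f) ∷ xs))
      same i with j Fin.≟ i
      ... | yes refl = refl
      ... | no _ = refl

    select-All : ∀ {P : ∀ i → Map i → Set} i {xs} → All (λ x → P (proj₁ x) (proj₂ x)) xs → All (P i) (select i xs)
    select-All i [] = []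
    select-All i {(j , f) ∷ xs} (p ∷ ps) with j Fin.≟ i
    ... | yes refl = p ∷ select-All i ps
    ... | no _ = select-All i ps

    select-AllPairs : ∀ i {xs} → AllPairs Disjoint xs → AllPairs (λ f h → Disjoint (i , f) (i , h)) (select i xs)
    select-AllPairs i [] = []
    select-AllPairs i {(j , f) ∷ xs} (p ∷ ps) with j Fin.≟ i
    ... | yes refl = select-All {P = λ i' h → Disjoint (j , f) (i' , h)} j p ∷ select-AllPairs j ps
    ... | no _ = select-AllPairs i ps

-- Parameters of the tester and its detection probability.

module Detection where

  open import Data.Nat hiding (_/_; _%_)
  open import Data.Nat.Properties
  open import Data.Nat.DivMod using (_%_; m/n*n≤m; m≡m%n+[m/n]*n; m%n<n) renaming (_/_ to _div_)
  open import Data.Nat.Tactic.RingSolver using (solve-∀)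
  open import Data.Integer as ℤ using (+_)
  open import Data.Rational using (ℚ; 0ℚ; 1ℚ; mkℚ; _/_)
  import Data.List.Relation.Unary.All.Properties as AllP
  import Data.List.Relation.Unary.AllPairs.Properties as AllPairsP
  open Counting
  open Minors using (Adj; Adj?)
  open FillIn
  open Exploration
  open Packings
  open Regularity
  open Averages using (ι; ι-*; ι-mono; ι-cancel-<; ι-nonNeg; ι-pos; /-*-ι)

  ¬¬-Π : ∀ {n} {P : Fin n → Set} → (∀ i → ¬ ¬ P i) → ¬ ¬ (∀ i → P i)
  ¬¬-Π {zero} h c = c λ ()
  ¬¬-Π {suc n} h c = h zero λ p → ¬¬-Π (h ∘ suc) λ q → c λ { zero → p ; (suc i) → q i }

  AllPairs-lookup : ∀ {A : Set} {R : A → A → Set} → (∀ {x y} → R x y → R y x) → ∀ {xs} → AllPairs R xs →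
    ∀ c c' → c ≢ c' → R (lookup xs c) (lookup xs c')
  AllPairs-lookup s (p ∷ ps) zero zero ne = ⊥-elim (ne refl)
  AllPairs-lookup s (p ∷ ps) zero (suc c') ne = All.lookup p (∈-lookup c')
  AllPairs-lookup s (p ∷ ps) (suc c) zero ne = s (All.lookup p (∈-lookup c))
  AllPairs-lookup s (p ∷ ps) (suc c) (suc c') ne = AllPairs-lookup s ps c c' (ne ∘ cong suc)

  module _ (ℋ : List AnyGraph) {l} (L : Graph l) {n} (G : Graph n) (free : MinorFree L G) where
    open Explorer ℋ
    open Extraction ℋ {n}

    -- Restrict a packing of copies of one graph to those with a common degree order and a proper colouring.
    module Regular (i : Fin (length ℋ)) (fs : List (Map i)) (copies : All (IsCopy G i) fs)
      (disjoint : AllPairs (λ f h → Disjoint (i , f) (i , h)) fs) (a₀ b₀ : Fin (size i)) (edge₀ : Adj (member i) a₀ b₀)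
      (nonempty : 0 < length fs) where

      k : ℕ
      k = size i

      deg≤n : ∀ v → degree G v ≤ n
      deg≤n v = ≤-trans (length-filter _ (allFin n)) (≤-reflexive (length-allFin n))

      open Rank (degree G) deg≤n
      open Colouring a₀

      -- The rank function coded as a number, so that the pigeonhole principle over `suc k ^ k`
      -- values yields a common degree order.
      label : Map i → Fin (suc k ^ k)
      label f = funToFin (λ a → fromℕ< (s≤s (rank≤k f a)))

      open Count Fin._≟_ label

      abstract
        common-label : ∃ λ e → length fs ≤ suc k ^ k * count fs e
        common-label with ∃-max (count fs) (allFin (suc k ^ k)) (∈⇒nonempty (∈-allFin (some fs nonempty)))
          where some : ∀ (fs : List (Map i)) → 0 < length fs → Fin (suc k ^ k)
                some (f ∷ _) _ = label f
        ... | e , h = e , ≤-trans (length≤∑-count fs (allFin (suc k ^ k)) (λ _ → ∈-allFin _))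
                            (≤-trans h (≤-reflexive (cong (_* count fs e) (length-allFin (suc k ^ k)))))

      e : Fin (suc k ^ k)
      e = proj₁ common-label

      labelled : List (Map i)
      labelled = filter (λ f → label f Fin.≟ e) fs

      abstract
        coloured : ∃ λ (χ : Fin n → Fin k) → length labelled ≤ k ^ k * length (filter (λ f → respects? χ (role-of f)) labelled)
        coloured = rainbow labelled (AllP.filter⁺ (λ f → label f Fin.≟ e) (All.map proj₁ copies))

      χ : Fin n → Fin k
      χ = proj₁ coloured

      chosen : List (Map i)
      chosen = filter (λ f → respects? χ (role-of f)) labelled

      size-chosen : length fs ≤ suc k ^ k * (k ^ k * length chosen)
      size-chosen = ≤-trans (proj₂ common-label) (*-monoʳ-≤ (suc k ^ k) (proj₂ coloured))

      chosen⁻ : ∀ {f} → f ∈ chosen → IsCopy G i f × label f ≡ e × Respects χ (role-of f)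
      chosen⁻ p = let (q , r) = ∈-filter⁻ (λ f → respects? χ (role-of f)) {xs = labelled} p
                      (q' , s) = ∈-filter⁻ (λ f → label f Fin.≟ e) {xs = fs} q in All.lookup copies q' , s , r

      ρ : Fin k → ℕ
      ρ a = toℕ (finToFun {suc k} {k} e a)

      ρ-rank : ∀ {f} → f ∈ chosen → ∀ a → ρ a ≡ rank f a
      ρ-rank {f} p a = trans (cong (λ e → toℕ (finToFun {suc k} {k} e a)) (≡.sym (proj₁ (proj₂ (chosen⁻ p)))))
        (trans (cong toℕ (FinP.finToFun-funToFin (λ a → fromℕ< (s≤s (rank≤k f a))) a)) (FinP.toℕ-fromℕ< (s≤s (rank≤k f a))))

      emb : Fin (length chosen) → Map i
      emb = lookup chosen

      emb∈ : ∀ c → emb c ∈ chosen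
      emb∈ c = ∈-lookup c

      chosen-disjoint : AllPairs (λ f h → Disjoint (i , f) (i , h)) chosen
      chosen-disjoint = AllPairsP.filter⁺ (λ f → respects? χ (role-of f)) (AllPairsP.filter⁺ (λ f → label f Fin.≟ e) disjoint)

      emb-disjoint : ∀ {c c' a b} → Adj (member i) a b → emb c a ≡ emb c' a → emb c b ≡ emb c' b → c ≡ c'
      emb-disjoint {c} {c'} {a} {b} ab p q = decidable-stable (c Fin.≟ c') λ ne →
        AllPairs-lookup (λ d a b a' b' x y u v → d a' b' a b y x (≡.sym u) (≡.sym v)) chosen-disjoint c c' ne a b a b ab ab p q

      c₀ : Fin (length chosen)
      c₀ = index-0 chosen (nonzero (≤-trans nonempty size-chosen))
        where
        index-0 : ∀ (xs : List (Map i)) → 0 < length xs → Fin (length xs)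
        index-0 (x ∷ xs) _ = zero
        nonzero : ∀ {x} → 0 < suc k ^ k * (k ^ k * x) → 0 < x
        nonzero {zero} h = ⊥-elim (<⇒≱ h (≤-reflexive (trans (cong (suc k ^ k *_) (*-zeroʳ (k ^ k))) (*-zeroʳ (suc k ^ k)))))
        nonzero {suc x} _ = s≤s z≤n

      -- Decidability of `Fill` is supplied only under a double negation, by finitely many instances
      -- of excluded middle. This is harmless, as the final inequality of rationals is decidable.
      found : ∀ S g → n ≤ g * length chosen → (inhabited : Fin n) →
        ¬ ¬ Success.Succeeds G inhabited S (totalSteps k) initial (totalCost k l S g)
      found S g dense inhabited no-success = ¬¬-Π (λ a → ¬¬-Π (λ b → ¬¬-excluded-middle)) λ fill? → no-success
        (Copies.copies-found context (∈-lookup i) c₀ g dense fill?)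
        where
        context : Context
        context = record
          { L = L ; G = G ; free = free ; H = member i ; ρ = ρ
          ; ρ≤k = λ a → s≤s⁻¹ (FinP.toℕ<n (finToFun {suc k} {k} e a))
          ; ρ-injective = λ {a} {b} eq → rank-injective (emb c₀) (proj₁ (proj₁ (chosen⁻ (emb∈ c₀))))
              (trans (≡.sym (ρ-rank (emb∈ c₀) a)) (trans eq (ρ-rank (emb∈ c₀) b)))
          ; χ = χ ; emb = emb
          ; emb-adj = λ c {a} {b} → proj₂ (proj₁ (chosen⁻ (emb∈ c))) a b
          ; emb-χ = λ c → rainbow-colour (emb c) (proj₁ (proj₁ (chosen⁻ (emb∈ c)))) (proj₂ (proj₂ (chosen⁻ (emb∈ c))))
          ; emb-degree = λ c {a} {b} lt → position-degree (rank-position (emb c) (subst₂ _<_ (ρ-rank (emb∈ c) a) (ρ-rank (emb∈ c) b) lt))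
          ; emb-disjoint = λ {c} {c'} → emb-disjoint {c} {c'} ; inhabited = inhabited ; S = S }

  -- A positive rational is at least the reciprocal of its denominator; therefore the tester depends
  -- on `ε` only through `↧ₙ ε`.
  far-bound : ∀ {ε n X} → 0ℚ ℚ.< ε → ε ℚ.* (+ n / 1) ℚ.< (+ X / 1) → n < ℚ.↧ₙ ε * X
  far-bound {ε@(mkℚ (+ zero) d _)} pos h = ⊥-elim (ℚ.<-irrefl (≡.sym (ℚ.↥p≡0⇒p≡0 ε refl)) pos)
  far-bound {ε@(mkℚ ℤ.-[1+ _ ] d _)} pos h = ⊥-elim (ℚ.<-asym pos (ℚ.negative⁻¹ ε))
  far-bound {ε@(mkℚ (+ suc p) d _)} {n} {X} pos h = ι-cancel-< (begin-strict
    ι n ≡⟨ ℚ.*-identityˡ (ι n) ⟨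
    1ℚ ℚ.* ι n ≤⟨ ℚ.*-monoʳ-≤-nonNeg (ι n) {{ι-nonNeg n}} (ι-mono (s≤s (z≤n {p}))) ⟩
    ι (suc p) ℚ.* ι n ≡⟨ cong (ℚ._* ι n) (/-*-ι (suc p) d) ⟨
    (+ suc p / suc d) ℚ.* ι (suc d) ℚ.* ι n ≡⟨ cong (λ z → z ℚ.* ι (suc d) ℚ.* ι n) (ℚ.fromℚᵘ-toℚᵘ ε) ⟩
    ε ℚ.* ι (suc d) ℚ.* ι n ≡⟨ cong (ℚ._* ι n) (ℚ.*-comm ε (ι (suc d))) ⟩
    ι (suc d) ℚ.* ε ℚ.* ι n ≡⟨ ℚ.*-assoc (ι (suc d)) ε (ι n) ⟩
    ι (suc d) ℚ.* (ε ℚ.* ι n) <⟨ ℚ.*-monoʳ-<-pos (ι (suc d)) {{ι-pos d}} h ⟩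
    ι (suc d) ℚ.* ι X ≡⟨ ι-* (suc d) X ⟨
    ι (suc d * X) ∎)
    where open ℚ.≤-Reasoning

  ≤-*suc-div : ∀ n D {{_ : NonZero D}} → n ≤ D * suc (n div D)
  ≤-*suc-div n D = begin
    n ≡⟨ m≡m%n+[m/n]*n n D ⟩
    n % D + (n div D) * D ≤⟨ +-monoˡ-≤ ((n div D) * D) (<⇒≤ (m%n<n n D)) ⟩
    D + (n div D) * D ≡⟨ *-comm (suc (n div D)) D ⟩
    D * suc (n div D) ∎
    where open ≤-Reasoning

  module Tester-parameters (l : ℕ) (ℋ : List AnyGraph) where

    private
      order : Fin (length ℋ) → ℕ
      order i = proj₁ (lookup ℋ i)

    edgeBound : ℕ
    -- The sum bounds the edges lost with one copy; `suc` keeps the divisor in `quota` nonzero.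
    edgeBound = suc (∑ (allFin (length ℋ)) (λ i → order i * order i))

    -- The factors are the losses in passing from `n` to the number of extracted copies, to one
    -- member of `ℋ`, to one degree order and to one colouring.
    sparsity : ℕ → Fin (length ℋ) → ℕ
    sparsity E i = E * edgeBound * (length ℋ * (suc (order i) ^ order i * order i ^ order i))

    -- The sum covers whichever member of `ℋ` turns out to be abundant. The same number serves as
    -- `S`, since a run starts with nothing visited.
    depth : ℕ
    depth = ∑ (allFin (length ℋ)) (λ i → totalSteps (order i))

    trials : ℕ → ℕ
    trials E = suc (∑ (allFin (length ℋ)) (λ i → totalCost (order i) l depth (sparsity E i)))

    module _ {L : Graph l} {n} (G : Graph n) (free : MinorFree L G) (ε : ℚ) (pos : 0ℚ ℚ.< ε) (far : Far ε ℋ G) where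
      open Explorer ℋ
      open Extraction ℋ {n}

      E : ℕ
      E = ℚ.↧ₙ ε

      D : ℕ
      D = E * edgeBound

      D≢0 : NonZero D
      D≢0 = m*n≢0 E edgeBound

      abstract
        quota : ℕ
        quota = suc (_div_ n D {{D≢0}})

        quota-positive : 0 < quota
        quota-positive = s≤s z≤n

        n≤quota : n ≤ D * quota
        n≤quota = ≤-*suc-div n D {{D≢0}}

        -- Fewer than `quota` removals means at most `n / D` of them, which delete at most `n / E`
        -- edges; `far-bound` requires more than that.
        insufficient : ¬ FreeRemainder G quota
        insufficient (G' , T , sub , fr , bound , T<) = <⇒≱ (far-bound {ε} pos (far G' sub fr)) (begin
          E * (edges G ∸ edges G') ≤⟨ *-monoʳ-≤ E (≤-trans (m≤n+o⇒m∸n≤o (edges G) (edges G') bound) (*-monoˡ-≤ T (n≤1+n sizes))) ⟩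
          E * (edgeBound * T) ≡⟨ *-assoc E edgeBound T ⟨
          D * T ≤⟨ *-monoʳ-≤ D (s≤s⁻¹ T<) ⟩
          D * _div_ n D {{D≢0}} ≡⟨ *-comm D _ ⟩
          _div_ n D {{D≢0}} * D ≤⟨ m/n*n≤m n D {{D≢0}} ⟩
          n ∎)
          where open ≤-Reasoning

        packing : Packing G quota
        packing = [ (λ p → p) , ⊥-elim ∘ insufficient ]′ (extract quota G)

      xs : List (Σ _ Map)
      xs = proj₁ packing

      some-index : Fin (length ℋ)
      some-index = first xs (subst (0 <_) (≡.sym (proj₁ (proj₂ packing))) quota-positive)
        where first : ∀ (xs : List (Σ _ Map)) → 0 < length xs → Fin (length ℋ)
              first ((i , _) ∷ _) _ = i

      abstract
        frequent : ∃ λ i → quota ≤ length ℋ * length (select i xs)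
        frequent = let (i , h) = ∃-max (λ i → length (select i xs)) (allFin (length ℋ)) (∈⇒nonempty (∈-allFin some-index)) in i , (begin
          quota ≡⟨ proj₁ (proj₂ packing) ⟨
          length xs ≤⟨ length-select xs ⟩
          ∑ (allFin (length ℋ)) (λ i → length (select i xs)) ≤⟨ h ⟩
          length (allFin (length ℋ)) * length (select i xs) ≡⟨ cong (_* length (select i xs)) (length-allFin (length ℋ)) ⟩
          length ℋ * length (select i xs) ∎)
          where open ≤-Reasoning

      i : Fin (length ℋ)
      i = proj₁ frequent

      fs : List (Map i)
      fs = select i xs

      copies : All (IsCopy G i) fs
      copies = select-All {P = IsCopy G} i (proj₁ (proj₂ (proj₂ packing)))

      fs-nonempty : 0 < length fs
      fs-nonempty = nonempty (length fs) (proj₂ frequent)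
        where nonempty : ∀ x → quota ≤ length ℋ * x → 0 < x
              nonempty zero h = ⊥-elim (<⇒≱ quota-positive (≤-trans h (≤-reflexive (*-zeroʳ (length ℋ)))))
              nonempty (suc x) _ = s≤s z≤n

      abstract
        a-copy : ∃ λ f → IsCopy G i f
        a-copy = first fs copies fs-nonempty
          where first : ∀ (fs : List (Map i)) → All (IsCopy G i) fs → 0 < length fs → ∃ λ f → IsCopy G i f
                first (f ∷ _) (p ∷ _) _ = f , p

      detected : + 2 / 3 ℚ.≤ PrReject G (repeat (2 * trials E) depth)
      detected = by-cases (found? (initial {n}))
        where
        by-edges : ¬ Found (initial {n}) → Dec (∃₂ λ a b → Adj (member i) a b) → + 2 / 3 ℚ.≤ PrReject G (repeat (2 * trials E) depth)
        -- An edgeless member that embeds in `G` occurs already in the empty list of seen edges,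
        -- before any query.
        by-edges nf (no edgeless) = ⊥-elim (nf (lose (∈-lookup i)
          (proj₁ a-copy , proj₁ (proj₂ a-copy) , λ a b e → ⊥-elim (edgeless (a , b , e)))))
        by-edges nf (yes (a₀ , b₀ , e₀)) = decidable-stable (_ ℚ.≤? _) λ small →
            R.found depth (sparsity E i) dense (proj₁ a-copy a₀) λ success → small (repeat-≥⅔ ≤-refl
              (succeeds-≤ (∈⇒≤∑ (λ i → totalSteps (order i)) (∈-allFin i))
                (succeeds-mono (m≤n⇒m≤1+n (∈⇒≤∑ (λ i → totalCost (order i) l depth (sparsity E i)) (∈-allFin i))) success)))
          where
          module R = Regular ℋ L G free i fs copies (select-AllPairs i (proj₂ (proj₂ (proj₂ packing)))) a₀ b₀ e₀ fs-nonempty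
          open Success G (proj₁ a-copy a₀) depth
          dense : n ≤ sparsity E i * length R.chosen
          dense = begin
            n ≤⟨ n≤quota ⟩
            D * quota ≤⟨ *-monoʳ-≤ (E * edgeBound) (≤-trans (proj₂ frequent) (*-monoʳ-≤ (length ℋ) R.size-chosen)) ⟩
            E * edgeBound * (length ℋ * (suc (order i) ^ order i * (order i ^ order i * length R.chosen)))
              ≡⟨ lemma (E * edgeBound) (length ℋ) (suc (order i) ^ order i) (order i ^ order i) (length R.chosen) ⟩
            sparsity E i * length R.chosen ∎
            where
            open ≤-Reasoning
            lemma : ∀ a b c d x → a * (b * (c * (d * x))) ≡ a * (b * (c * d)) * x
            lemma = solve-∀
        by-cases : Dec (Found (initial {n})) → + 2 / 3 ℚ.≤ PrReject G (repeat (2 * trials E) depth)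
        by-cases (yes p) = ℚ.≤-trans (toWitness {a? = + 2 / 3 ℚ.≤? 1ℚ} _) (ℚ.≤-reflexive (≡.sym (repeat-found G p {pred (2 * trials E)})))
        by-cases (no nf) = by-edges nf (FinP.any? (λ a → FinP.any? (λ b → Adj? (member i) a b)))

open import Data.Integer using (+_)
open import Data.Rational using (ℚ; 0ℚ; _/_; _<_; _≤_; ↧ₙ_)

theorem9p2 : ∀ {l} (L : Graph l) (ℋ : List AnyGraph) →
    Σ (ℚ → ℕ) λ q →
    Σ (ℚ → (n : ℕ) → Tester n) λ T →
    ∀ (ε : ℚ) → 0ℚ < ε → (n : ℕ) →
    Queries≤ (q ε) (T ε n) ×
    (∀ (G : Graph n) → MinorFree L G →
    (Free ℋ G → PrReject G (T ε n) ≡ 0ℚ) ×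
    (Far ε ℋ G → ((+ 2) / 3) ≤ PrReject G (T ε n)))
theorem9p2 {l} L ℋ =
  (λ ε → 2 ℕ.* trials (↧ₙ ε) ℕ.* depth) ,
  (λ ε n → repeat (2 ℕ.* trials (↧ₙ ε)) depth) ,
  λ ε pos n → Queries≤-repeat (2 ℕ.* trials (↧ₙ ε)) depth ,
    λ G minor-free → (λ h → repeat-zero G h (2 ℕ.* trials (↧ₙ ε)) depth) , detected {L = L} G minor-free ε pos
  where
  open Detection.Tester-parameters l ℋ
  open Exploration.Explorer ℋ
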